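{- $\mathrm{PrCat}(\omega+\eta)=\mathrm{Cone}(\Delta^0_3)$.
   Context: $\omega+\eta$ is the linear order consisting of a copy of $\omega$ followed by a copy of $\eta$ (the order type of the rationals). A structure is punctual if its domain is $\omega$ and its relations are uniformly primitive recursive. For total $f,g:\omega\to\omega$, write $f\le_{PR}g$ if $f$ is primitive recursive relative to $g$; the induced equivalence classes are PR-degrees, and $f\le_{PR}\mathbf d$ means $f\le_{PR}$ a member of $\mathbf d$. For a punctual structure $A$, $\mathrm{PrCat}(A)$ is the set of PR-degrees $\mathbf d$ such that for every punctual $B\cong A$ there is an isomorphism $f:A\to B$ with $f\le_{PR}\mathbf d$ and $f^{ -1}\le_{PR}\mathbf d$; for an isomorphism type $S$ with a punctual presentation, $\mathrm{PrCat}(S)$ means $\mathrm{PrCat}(A)$ for a punctual $A\cong S$ (independent of the choice of $A$). $\mathrm{Cone}(\Delta^0_3)$ is the set of PR-degrees $\mathbf d$ such that $f\le_{PR}\mathbf d$ for every total $\Delta^0_3$ function $f:\omega\to\omega$. -}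

module Defs where

open import Data.Nat using (ℕ; zero; suc)
open import Data.Fin using (Fin)
open import Data.Vec using (Vec; []; _∷_; lookup)
open import Data.Sum using (_⊎_; inj₁; inj₂)
open import Data.Product using (Σ; ∃; _×_; _,_)
open import Data.Empty using (⊥)
open import Data.Unit using (⊤)
open import Relation.Nullary using (Dec)
open import Relation.Binary.PropositionalEquality using (_≡_)
import Data.Nat as N
import Data.Rational as Q

Classical : Set₁
Classical = (P : Set) → Dec P

_⟺_ : Set → Set → Set
P ⟺ Q = (P → Q) × (Q → P)

data PR : ℕ → Set where
  zer  : ∀ {n} → PR n
  sc   : PR 1
  proj : ∀ {n} → Fin n → PR n
  comp : ∀ {n m} → PR m → Vec (PR n) m → PR n
  rec  : ∀ {n} → PR n → PR (suc (suc n)) → PR (suc n)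
  orc  : PR 1

mutual
  eval : (ℕ → ℕ) → ∀ {n} → PR n → Vec ℕ n → ℕ
  eval g zer xs = 0
  eval g sc (x ∷ []) = suc x
  eval g (proj i) xs = lookup xs i
  eval g (comp h hs) xs = eval g h (evalV g hs xs)
  eval g (rec f h) (k ∷ xs) = evalRec g f h k xs
  eval g orc (x ∷ []) = g x

  evalV : (ℕ → ℕ) → ∀ {n m} → Vec (PR n) m → Vec ℕ n → Vec ℕ m
  evalV g [] xs = []
  evalV g (h ∷ hs) xs = eval g h xs ∷ evalV g hs xs

  evalRec : (ℕ → ℕ) → ∀ {n} → PR n → PR (suc (suc n)) → ℕ → Vec ℕ n → ℕ
  evalRec g f s zero xs = eval g f xs
  evalRec g f s (suc k) xs = eval g s (k ∷ evalRec g f s k xs ∷ xs)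

-- oracle-free evaluation (the oracle call is never needed: plain PR)
zeroOracle : ℕ → ℕ
zeroOracle _ = 0

_≤PR_ : (ℕ → ℕ) → (ℕ → ℕ) → Set
f ≤PR g = Σ (PR 1) λ t → ∀ x → eval g t (x ∷ []) ≡ f x

-- Punctual linear orders (domain ω, order relation primitive recursive)

record Punctual : Set where
  field
    χ : PR 2

Rel : Punctual → ℕ → ℕ → Set
Rel A x y = eval zeroOracle (Punctual.χ A) (x ∷ y ∷ []) ≡ 1

record Iso (A B : Punctual) : Set where
  field
    f    : ℕ → ℕ
    g    : ℕ → ℕ
    gf   : ∀ x → g (f x) ≡ x
    fg   : ∀ y → f (g y) ≡ y
    pres : ∀ x y → Rel A x y ⟺ Rel B (f x) (f y)

_<ωη_ : ℕ ⊎ Q.ℚ → ℕ ⊎ Q.ℚ → Set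
inj₁ m <ωη inj₁ n = m N.< n
inj₁ m <ωη inj₂ q = ⊤
inj₂ p <ωη inj₁ n = ⊥
inj₂ p <ωη inj₂ q = p Q.< q

record IsoωPlusη (A : Punctual) : Set where
  field
    h    : ℕ → ℕ ⊎ Q.ℚ
    h⁻¹  : ℕ ⊎ Q.ℚ → ℕ
    left  : ∀ x → h⁻¹ (h x) ≡ x
    right : ∀ z → h (h⁻¹ z) ≡ z
    pres : ∀ x y → Rel A x y ⟺ (h x <ωη h y)

-- PrCat and Cone(Δ⁰₃), as predicates on representatives d of PR-degrees

PrCat : Punctual → (ℕ → ℕ) → Set
PrCat A d = ∀ (B : Punctual) → Iso A B →
  Σ (Iso A B) λ i → (Iso.f i ≤PR d) × (Iso.g i ≤PR d)

-- Σ⁰₃ / Π⁰₃ binary relations (Kleene normal form, primitive recursive matrix)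
Σ⁰₃ : (ℕ → ℕ → Set) → Set
Σ⁰₃ P = Σ (PR 5) λ t → ∀ x y →
  P x y ⟺ (∃ λ a → ∀ b → ∃ λ c → eval zeroOracle t (a ∷ b ∷ c ∷ x ∷ y ∷ []) ≡ 0)

Π⁰₃ : (ℕ → ℕ → Set) → Set
Π⁰₃ P = Σ (PR 5) λ t → ∀ x y →
  P x y ⟺ (∀ a → ∃ λ b → ∀ c → eval zeroOracle t (a ∷ b ∷ c ∷ x ∷ y ∷ []) ≡ 0)

Δ⁰₃ : (ℕ → ℕ) → Set
Δ⁰₃ f = Σ⁰₃ (λ x y → f x ≡ y) × Π⁰₃ (λ x y → f x ≡ y)

Cone-Δ⁰₃ : (ℕ → ℕ) → Set
Cone-Δ⁰₃ d = ∀ (f : ℕ → ℕ) → Δ⁰₃ f → f ≤PR d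

module Submission where

-- (⊇) Let T(x, p, b, c) be primitive recursive and ∃p ∀b ∃c T for every x.  If T is antitone in b,
-- the least such p is a Δ⁰₃ function of x.  On a punctual copy of ω + η this produces Δ⁰₃ functions
-- which decide the copy of ω, enumerate and bound it, and bound the searches of a back-and-forth
-- construction on the copy of η, so the isomorphism is primitive recursive in any d above them.
--
-- (⊆) Let f be Δ⁰₃.  Choose a Π⁰₂ relation R such that R(i, p) determines f(i) from p, let p_i be the
-- least solution at i, and let the true path be the sequence 2p_i + 1.  A punctual copy B of ω + η
-- consists of eventually zero sequences under the lexicographic order: those left of the true path
-- get evidence only finitely often and form the copy of ω, those right of it form the copy of η.
-- An isomorphism from a standard copy yields elements of the copy of η below any given one, and
-- its inverse recognises them; this suffices to read off the true path, hence f, entry by entry.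

open import Defs
open import Data.Nat
open import Data.Nat.Properties
open import Data.Vec using (Vec; []; _∷_; lookup; head; tail; tabulate)
open import Data.Product using (Σ; ∃; _×_; _,_; proj₁; proj₂)
open import Data.Sum using (_⊎_; inj₁; inj₂; [_,_]′)
open import Data.Empty using (⊥-elim)
open import Data.Unit using (tt)
open import Data.Fin using (Fin; toℕ; fromℕ<) renaming (zero to fz; suc to fs)
open import Data.Fin.Properties using (toℕ-fromℕ<; toℕ<n; pigeonhole)
open import Relation.Nullary using (yes; no; ¬_)
open import Relation.Binary.PropositionalEquality
open import Relation.Binary.Definitions using (Tri; tri<; tri≈; tri>)
import Data.Integer as ℤ
import Data.Rational as Q
import Data.Rational.Properties as Q

-- In (⊆) the obstacle is that the copy cannot wait: every number must be a point whose position is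
-- decided primitive recursively. So a wanted sequence e is attached to `pair e r`, with r the first
-- stage at which it is wanted, and every other number goes to a spare position. The rule for
-- wanting meets three demands. Finiteness: up to any fixed place, only finitely many points may
-- leave the true path to the left; hence evidence comparable in strength to the code of the
-- sequence is required, and wrong odd entries left of the path have bounded evidence. Density: a
-- prefix right of the path may also have bounded evidence, yet needs infinitely many extensions;
-- hence an extension e of its truncation t asks only strength t of the prefix, and strength e of
-- something to its left, which the true path supplies when e is right of it. Small indices: the
-- readout may only search below a number K already known. Even entries mark where a prefix ends and
-- are never on the path.

module Logic (lem : Classical) where

  -- Classical reasoning, bounded search and finite bounds.

  by-contradiction : {P : Set} → ¬ ¬ P → P
  by-contradiction {P} f with lem P
  ... | yes p = p
  ... | no ¬p = ⊥-elim (f ¬p)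

  ¬∀⇒∃¬ : {P : ℕ → Set} → ¬ (∀ n → P n) → ∃ λ n → ¬ P n
  ¬∀⇒∃¬ f = by-contradiction λ h → f λ n → by-contradiction λ np → h (n , np)

  opaque
    𝟙 : Set → ℕ
    𝟙 P with lem P
    ... | yes _ = 1
    ... | no _ = 0

    𝟙-yes : {P : Set} → P → 𝟙 P ≡ 1
    𝟙-yes {P} p with lem P
    ... | yes _ = refl
    ... | no ¬p = ⊥-elim (¬p p)

    𝟙-no : {P : Set} → ¬ P → 𝟙 P ≡ 0
    𝟙-no {P} ¬p with lem P
    ... | yes p = ⊥-elim (¬p p)
    ... | no _ = refl

    𝟙-true : {P : Set} → 𝟙 P ≡ 1 → P
    𝟙-true {P} e with lem P
    ... | yes p = p
    𝟙-true {P} () | no _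

    𝟙-cong : {P Q : Set} → (P → Q) → (Q → P) → 𝟙 P ≡ 𝟙 Q
    𝟙-cong {P} {Q} f g with lem P
    ... | yes p = sym (𝟙-yes (f p))
    ... | no ¬p = sym (𝟙-no (λ q → ¬p (g q)))

    ite : Set → ℕ → ℕ → ℕ
    ite P a b = 𝟙 P * a + (1 ∸ 𝟙 P) * b

    ite-yes : {P : Set} {a b : ℕ} → P → ite P a b ≡ a
    ite-yes {P} {a} p rewrite 𝟙-yes p = trans (+-identityʳ _) (+-identityʳ a)

    ite-no : {P : Set} {a b : ℕ} → ¬ P → ite P a b ≡ b
    ite-no {P} {a} {b} ¬p rewrite 𝟙-no ¬p = +-identityʳ b

  natrec : ℕ → (ℕ → ℕ → ℕ) → ℕ → ℕ
  natrec z s zero = z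
  natrec z s (suc k) = s k (natrec z s k)

  opaque
    -- Bounded search; μ P n is n when no i ≤ n satisfies P.
    μ : (ℕ → Set) → ℕ → ℕ
    μ P = natrec 0 (λ k a → ite (P a) a (suc k))

    μ-inv : (P : ℕ → Set) (n : ℕ) →
            (P (μ P n) × μ P n ≤ n × (∀ j → j < μ P n → ¬ P j))
            ⊎ (μ P n ≡ n × (∀ j → j ≤ n → ¬ P j))
    μ-inv P zero with lem (P 0)
    ... | yes p = inj₁ (p , z≤n , λ _ ())
    ... | no ¬p = inj₂ (refl , λ { .0 z≤n → ¬p })
    μ-inv P (suc n) with μ-inv P n
    ... | inj₁ (p , le , h) rewrite ite-yes {P (μ P n)} {μ P n} {suc n} p =
          inj₁ (p , m≤n⇒m≤1+n le , h)
    ... | inj₂ (e , h)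
          rewrite ite-no {P (μ P n)} {μ P n} {suc n} (h _ (≤-reflexive e))
          with lem (P (suc n))
    ...   | yes p = inj₁ (p , ≤-refl , λ { j (s≤s le) → h j le })
    ...   | no ¬p = inj₂ (refl , λ j le → [ (λ { (s≤s l) → h j l }) , (λ { refl → ¬p }) ]′ (m≤n⇒m<n∨m≡n le))

    μ-sat : (P : ℕ → Set) {n i : ℕ} → i ≤ n → P i → P (μ P n)
    μ-sat P {n} {i} le p with μ-inv P n
    ... | inj₁ (q , _) = q
    ... | inj₂ (_ , h) = ⊥-elim (h i le p)

    μ-min : (P : ℕ → Set) {n i : ℕ} → i < μ P n → ¬ P i
    μ-min P {n} {i} lt with μ-inv P n
    ... | inj₁ (_ , _ , h) = h i lt
    ... | inj₂ (e , h) = h i (<⇒≤ (subst (i <_) e lt))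

    μ-≤ : (P : ℕ → Set) (n : ℕ) → μ P n ≤ n
    μ-≤ P n with μ-inv P n
    ... | inj₁ (_ , le , _) = le
    ... | inj₂ (e , _) = ≤-reflexive e

  least : {P : ℕ → Set} → ∃ P → ∃ λ n → P n × (∀ m → m < n → ¬ P m)
  least {P} (n , p) = μ P n , μ-sat P ≤-refl p , λ m → μ-min P {n} {m}

  -- Bounding principle: by monotonicity the sum of finitely many individual bounds serves all `i`
  -- at once.
  collect : {P : ℕ → ℕ → Set} → (∀ {i r r'} → r ≤ r' → P i r → P i r') → (n : ℕ) →
            (∀ i → i < n → ∃ (P i)) → ∃ λ r → ∀ i → i < n → P i r
  collect mono zero h = 0 , λ _ ()
  collect {P} mono (suc n) h with collect {P} mono n (λ i lt → h i (m≤n⇒m≤1+n lt)) | h n ≤-refl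
  ... | r , hr | r' , p = r + r' , λ i lt →
        [ (λ { (s≤s l) → mono (m≤m+n r r') (hr i l) })
        , (λ { refl → mono (m≤n+m r' r) p }) ]′ (m≤n⇒m<n∨m≡n lt)

  -- Antisymmetry is not assumed, because different indices may stand for the same point in the
  -- back-and-forth construction.
  max-below : {P : ℕ → Set} {_≼_ : ℕ → ℕ → Set} (k : ℕ) →
    (∀ {i j} → i < k → j < k → P i → P j → i ≼ j ⊎ j ≼ i) →
    (∀ {i j l} → i < k → j < k → l < k → P i → P j → P l → i ≼ j → j ≼ l → i ≼ l) →
    (∀ i → i < k → ¬ P i) ⊎ (∃ λ i → i < k × P i × (∀ j → j < k → P j → j ≼ i))
  max-below zero tot tr = inj₁ λ _ ()
  max-below {P} {_≼_} (suc k) tot tr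
    with max-below {P} {_≼_} k (λ a b → tot (m<n⇒m<1+n a) (m<n⇒m<1+n b))
           (λ a b c → tr (m<n⇒m<1+n a) (m<n⇒m<1+n b) (m<n⇒m<1+n c)) | lem (P k)
  ... | inj₁ h | no ¬p = inj₁ λ i lt → [ (λ { (s≤s l) → h i l }) , (λ { refl → ¬p }) ]′ (m≤n⇒m<n∨m≡n lt)
  ... | inj₁ h | yes p = inj₂ (k , ≤-refl , p , λ j lt q →
        [ (λ { (s≤s l) → ⊥-elim (h j l q) })
        , (λ { refl → [ (λ x → x) , (λ x → x) ]′ (tot ≤-refl ≤-refl p p) }) ]′ (m≤n⇒m<n∨m≡n lt))
  ... | inj₂ (i , i< , p , h) | no ¬p = inj₂ (i , m<n⇒m<1+n i< , p , λ j lt q →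
        [ (λ { (s≤s l) → h j l q }) , (λ { refl → ⊥-elim (¬p q) }) ]′ (m≤n⇒m<n∨m≡n lt))
  ... | inj₂ (i , i< , p , h) | yes pk with tot (m<n⇒m<1+n i<) ≤-refl p pk
  ...   | inj₁ i≼k = inj₂ (k , ≤-refl , pk , λ j lt q →
          [ (λ { (s≤s l) → tr (m<n⇒m<1+n l) (m<n⇒m<1+n i<) ≤-refl q p pk (h j l q) i≼k })
          , (λ { refl → [ (λ x → x) , (λ x → x) ]′ (tot ≤-refl ≤-refl pk pk) }) ]′ (m≤n⇒m<n∨m≡n lt))
  ...   | inj₂ k≼i = inj₂ (i , m<n⇒m<1+n i< , p , λ j lt q →
          [ (λ { (s≤s l) → h j l q }) , (λ { refl → k≼i }) ]′ (m≤n⇒m<n∨m≡n lt))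

  unbounded : (u : ℕ → ℕ) → (∀ i j → i < j → u i ≢ u j) → (n : ℕ) → ¬ (∀ i → i ≤ n → u i < n)
  unbounded u inj n h with pigeonhole {n} {suc n} ≤-refl (λ i → fromℕ< (h (toℕ i) (≤-pred (toℕ<n i))))
  ... | i , j , i<j , eq = inj (toℕ i) (toℕ j) i<j
        (trans (sym (toℕ-fromℕ< _)) (trans (cong toℕ eq) (toℕ-fromℕ< _)))

  -- Parity and halves

  opaque
    par : ℕ → ℕ
    par = natrec 0 (λ _ a → 1 ∸ a)

    half : ℕ → ℕ
    half = natrec 0 (λ k a → a + par k)

    par-suc : ∀ n → par (suc n) ≡ 1 ∸ par n
    par-suc n = refl

    par-cases : ∀ n → par n ≡ 0 ⊎ par n ≡ 1
    par-cases zero = inj₁ refl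
    par-cases (suc n) with par-cases n
    ... | inj₁ e rewrite e = inj₂ refl
    ... | inj₂ e rewrite e = inj₁ refl

    par-dbl : ∀ n → par (n + n) ≡ 0
    par-dbl zero = refl
    par-dbl (suc n) rewrite +-suc n n | par-dbl n = refl

    par-dbl1 : ∀ n → par (suc (n + n)) ≡ 1
    par-dbl1 n rewrite par-dbl n = refl

    half-dbl : ∀ n → half (n + n) ≡ n
    half-dbl zero = refl
    half-dbl (suc n) rewrite +-suc n n | par-dbl n | half-dbl n | +-identityʳ n = +-comm n 1

    half-dbl1 : ∀ n → half (suc (n + n)) ≡ n
    half-dbl1 n rewrite par-dbl n | half-dbl n = +-identityʳ n

    half-par : ∀ n → (half n + half n) + par n ≡ n
    half-par zero = refl
    half-par (suc n) with half-par n | par-cases n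
    ... | e | inj₁ p rewrite p | +-identityʳ (half n) = trans (+-comm _ 1) (cong suc (trans (sym (+-identityʳ _)) e))
    ... | e | inj₂ p rewrite p | +-identityʳ (half n + 1 + (half n + 1)) =
          trans (cong (half n + 1 +_) (+-comm (half n) 1))
            (trans (+-assoc (half n) 1 _)
              (trans (+-suc (half n) _) (cong suc (trans (+-suc (half n) (half n)) (trans (sym (+-comm _ 1)) e)))))

    odd-half : ∀ {n} → par n ≡ 1 → suc (half n + half n) ≡ n
    odd-half {n} e = trans (sym (trans (cong (half n + half n +_) e) (+-comm _ 1))) (half-par n)

  -- Cantor pairing

  opaque
    triangle : ℕ → ℕ
    triangle = natrec 0 (λ k a → a + suc k)

    pair : ℕ → ℕ → ℕ
    pair a b = triangle (a + b) + b

    triangle-mono : ∀ {m n} → m ≤ n → triangle m ≤ triangle n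
    triangle-mono {n = zero} z≤n = z≤n
    triangle-mono {m} {suc n} le with m≤n⇒m<n∨m≡n le
    ... | inj₁ (s≤s l) = ≤-trans (triangle-mono l) (m≤m+n _ _)
    ... | inj₂ refl = ≤-refl

    n≤triangle : ∀ n → n ≤ triangle n
    n≤triangle zero = z≤n
    n≤triangle (suc n) = m≤n+m (suc n) (triangle n)

    pair-mono : ∀ {a a' b b'} → a ≤ a' → b ≤ b' → pair a b ≤ pair a' b'
    pair-mono p q = +-mono-≤ (triangle-mono (+-mono-≤ p q)) q

    fst≤pair : ∀ a b → a ≤ pair a b
    fst≤pair a b = ≤-trans (m≤m+n a b) (≤-trans (n≤triangle (a + b)) (m≤m+n _ b))

    snd≤pair : ∀ a b → b ≤ pair a b
    snd≤pair a b = m≤n+m b _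

    pair-sucʳ : ∀ a b → pair a (suc b) ≡ suc (pair (suc a) b)
    pair-sucʳ a b rewrite +-suc a b = +-suc (triangle (a + b) + suc (a + b)) b

    pair-suc0 : ∀ a → pair (suc a) 0 ≡ suc (pair 0 a)
    pair-suc0 a rewrite +-identityʳ a = trans (+-identityʳ _) (+-suc (triangle a) a)

    unpair : ∀ n → ∃ λ a → ∃ λ b → pair a b ≡ n
    unpair zero = 0 , 0 , refl
    unpair (suc n) with unpair n
    ... | zero , b , refl = suc b , 0 , pair-suc0 b
    ... | suc a , b , refl = a , suc b , pair-sucʳ a b

    pair-inj : ∀ {a b a' b'} → pair a b ≡ pair a' b' → a ≡ a' × b ≡ b'
    pair-inj {a} {b} {a'} {b'} e with <-cmp (a + b) (a' + b')
    ... | c = go c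
      where
      far : ∀ x y x' y' → x + y < x' + y' → pair x y < pair x' y'
      far x y x' y' lt = ≤-trans (≤-reflexive (sym (+-suc _ y)))
        (≤-trans (+-monoʳ-≤ (triangle (x + y)) (s≤s (m≤n+m y x)))
          (≤-trans (triangle-mono lt) (m≤m+n _ y')))
      go : Tri (a + b < a' + b') (a + b ≡ a' + b') (a' + b' < a + b) → a ≡ a' × b ≡ b'
      go (tri< lt _ _) = ⊥-elim (<⇒≢ (far a b a' b' lt) e)
      go (tri> _ _ gt) = ⊥-elim (<⇒≢ (far a' b' a b gt) (sym e))
      go (tri≈ _ eq _) = +-cancelʳ-≡ b a a' (trans eq (cong (a' +_) (sym b≡))) , b≡
        where
        b≡ : b ≡ b'
        b≡ = +-cancelˡ-≡ (triangle (a + b)) b b' (trans e (cong (λ t → triangle t + b') (sym eq)))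

  opaque
    π₁ π₂ : ℕ → ℕ
    π₁ n = μ (λ a → Σ ℕ λ b → b < suc n × pair a b ≡ n) n
    π₂ n = μ (λ b → pair (π₁ n) b ≡ n) n

    pair-π : ∀ n → pair (π₁ n) (π₂ n) ≡ n
    pair-π n with unpair n
    ... | a , b , e = h₂
      where
      h₁ : Σ ℕ λ b → b < suc n × pair (π₁ n) b ≡ n
      h₁ = μ-sat (λ a → Σ ℕ λ b → b < suc n × pair a b ≡ n) {n} {a}
             (≤-trans (fst≤pair a b) (≤-reflexive e))
             (b , s≤s (≤-trans (snd≤pair a b) (≤-reflexive e)) , e)
      h₂ : pair (π₁ n) (π₂ n) ≡ n
      h₂ = μ-sat (λ b → pair (π₁ n) b ≡ n) {n} (≤-pred (proj₁ (proj₂ h₁))) (proj₂ (proj₂ h₁))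

    π₁-pair : ∀ a b → π₁ (pair a b) ≡ a
    π₁-pair a b = proj₁ (pair-inj {π₁ (pair a b)} {π₂ (pair a b)} (pair-π (pair a b)))

    π₂-pair : ∀ a b → π₂ (pair a b) ≡ b
    π₂-pair a b = proj₂ (pair-inj {π₁ (pair a b)} {π₂ (pair a b)} (pair-π (pair a b)))

    π₂≤ : ∀ n → π₂ n ≤ n
    π₂≤ n = ≤-trans (snd≤pair (π₁ n) (π₂ n)) (≤-reflexive (pair-π n))

    π₁≤ : ∀ n → π₁ n ≤ n
    π₁≤ n = ≤-trans (fst≤pair (π₁ n) (π₂ n)) (≤-reflexive (pair-π n))

  opaque
    unfolding pair triangle
    pair-< : ∀ a b → pair a b ≢ 0 → b < pair a b
    pair-< zero zero h = ⊥-elim (h refl)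
    pair-< zero (suc b) h = +-monoˡ-≤ (suc b) (≤-trans (s≤s z≤n) (n≤triangle (suc b)))
    pair-< (suc a) b h = +-monoˡ-≤ b (≤-trans (s≤s z≤n) (n≤triangle (suc a + b)))

  π₂< : ∀ n → n ≢ 0 → π₂ n < n
  π₂< n h = subst (π₂ n <_) (pair-π n) (pair-< (π₁ n) (π₂ n) (λ e → h (trans (sym (pair-π n)) e)))

  -- Every number e codes the eventually zero sequence seq e; the coding is bijective.

  opaque
    drop : ℕ → ℕ → ℕ
    drop e = natrec e (λ _ a → π₂ a)

    seq : ℕ → ℕ → ℕ
    seq e i = π₁ (drop e i)

    drop-shift : ∀ e i → drop e (suc i) ≡ drop (π₂ e) i
    drop-shift e zero = refl
    drop-shift e (suc i) = cong π₂ (drop-shift e i)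

    seq-zero : ∀ e → seq e 0 ≡ π₁ e
    seq-zero e = refl

    seq-suc : ∀ e i → seq e (suc i) ≡ seq (π₂ e) i
    seq-suc e i = cong π₁ (drop-shift e i)

    seq-pair0 : ∀ a b → seq (pair a b) 0 ≡ a
    seq-pair0 = π₁-pair

    seq-pairS : ∀ a b i → seq (pair a b) (suc i) ≡ seq b i
    seq-pairS a b i = trans (seq-suc (pair a b) i) (cong (λ z → seq z i) (π₂-pair a b))

    drop0 : ∀ i → drop 0 i ≡ 0
    drop0 zero = refl
    drop0 (suc i) = trans (cong π₂ (drop0 i)) (n≤0⇒n≡0 (π₂≤ 0))

    seq0 : ∀ i → seq 0 i ≡ 0
    seq0 i = trans (cong π₁ (drop0 i)) (n≤0⇒n≡0 (π₁≤ 0))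

    seq-tail : ∀ e i → e ≤ i → seq e i ≡ 0
    seq-tail zero i _ = seq0 i
    seq-tail e@(suc _) (suc i) le =
      trans (seq-suc e i) (seq-tail (π₂ e) i (≤-pred (≤-trans (π₂< e (λ ())) le)))

  code-exists : (s : ℕ → ℕ) (n : ℕ) → ∃ λ c → (∀ i → i < n → seq c i ≡ s i) × (∀ i → n ≤ i → seq c i ≡ 0)
  code-exists s zero = 0 , (λ _ ()) , λ i _ → seq0 i
  code-exists s (suc n) with code-exists (λ i → s (suc i)) n
  ... | c , h , z = pair (s 0) c
      , (λ { zero _ → seq-pair0 (s 0) c ; (suc i) (s≤s lt) → trans (seq-pairS (s 0) c i) (h i lt) })
      , (λ { (suc i) (s≤s le) → trans (seq-pairS (s 0) c i) (z i le) })

  splice-exists : (s : ℕ → ℕ) (m v : ℕ) →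
    ∃ λ c → (∀ i → i < m → seq c i ≡ s i) × seq c m ≡ v × (∀ i → m < i → seq c i ≡ 0)
  splice-exists s m v with code-exists (λ i → ite (i ≡ m) v (s i)) (suc m)
  ... | c , h , z = c , (λ i lt → trans (h i (m<n⇒m<1+n lt)) (ite-no (<⇒≢ lt))) , trans (h m ≤-refl) (ite-yes refl) , z

  -- Codes inherit monotonicity from pairing. This bounds the code of a truncation by the code of
  -- the sequence, and the index of a separator by the index of a known element. The argument `n` is
  -- fuel for the recursion through `π₂`.
  code-mono : ∀ n {c c'} → c ≤ n → (∀ i → seq c i ≤ seq c' i) → c ≤ c'
  code-mono n {zero} _ h = z≤n
  code-mono (suc n) {c@(suc _)} {c'} le h =
    subst₂ _≤_ (pair-π c) (pair-π c')
      (pair-mono (subst₂ _≤_ (seq-zero c) (seq-zero c') (h 0)) (code-mono n (≤-pred (≤-trans (π₂< c (λ ())) le))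
        (λ i → subst₂ _≤_ (seq-suc c i) (seq-suc c' i) (h (suc i)))))

  seq-mono : ∀ {c c'} → (∀ i → seq c i ≤ seq c' i) → c ≤ c'
  seq-mono {c} = code-mono c ≤-refl

  seq-inj : ∀ {c c'} → (∀ i → seq c i ≡ seq c' i) → c ≡ c'
  seq-inj h = ≤-antisym (seq-mono (λ i → ≤-reflexive (h i))) (seq-mono (λ i → ≤-reflexive (sym (h i))))

  -- Lexicographic order of sequences

  Agree : ℕ → (ℕ → ℕ) → (ℕ → ℕ) → Set
  Agree n s t = ∀ i → i < n → s i ≡ t i

  LexAt : ℕ → (ℕ → ℕ) → (ℕ → ℕ) → Set
  LexAt n s t = Agree n s t × s n < t n

  Lex : (ℕ → ℕ) → (ℕ → ℕ) → Set
  Lex s t = ∃ λ n → LexAt n s t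

  lex-irr : ∀ {s} → ¬ Lex s s
  lex-irr (n , _ , lt) = <-irrefl refl lt

  -- The bound on the place `k` is what later bounds predecessors: whatever lies below a sequence
  -- that leaves the true path to the left at place `n` leaves it at some place ≤ `n`.
  lexAt-trans : ∀ {s t u} {m n} → LexAt m s t → LexAt n t u → Σ ℕ λ k → k ≤ m × k ≤ n × LexAt k s u
  lexAt-trans {s} {t} {u} {m} {n} (a , lt) (b , lt') with <-cmp m n
  ... | c = go c
    where
    go : Tri (m < n) (m ≡ n) (n < m) → Σ ℕ λ k → k ≤ m × k ≤ n × LexAt k s u
    go (tri< m<n _ _) = m , ≤-refl , <⇒≤ m<n , (λ i l → trans (a i l) (b i (<-trans l m<n))) , subst (s m <_) (b m m<n) lt
    go (tri≈ _ refl _) = m , ≤-refl , ≤-refl , (λ i l → trans (a i l) (b i l)) , <-trans lt lt'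
    go (tri> _ _ n<m) = n , <⇒≤ n<m , ≤-refl , (λ i l → trans (a i (<-trans l n<m)) (b i l)) , subst (_< u n) (sym (a n n<m)) lt'

  lex-trans : ∀ {s t u} → Lex s t → Lex t u → Lex s u
  lex-trans (_ , p) (_ , q) with lexAt-trans p q
  ... | k , _ , _ , r = k , r

  lex-asym : ∀ {s t} → Lex s t → ¬ Lex t s
  lex-asym p q = lex-irr (lex-trans p q)

  lex-tri : ∀ {s t} n → s n ≢ t n → Lex s t ⊎ Lex t s
  lex-tri {s} {t} n ne with least {λ i → s i ≢ t i} (n , ne)
  ... | i , d , h with <-cmp (s i) (t i)
  ... | c = go c
    where
    go : Tri (s i < t i) (s i ≡ t i) (t i < s i) → Lex s t ⊎ Lex t s
    go (tri< lt _ _) = inj₁ (i , (λ j l → by-contradiction (h j l)) , lt)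
    go (tri≈ _ e _) = ⊥-elim (d e)
    go (tri> _ _ gt) = inj₂ (i , (λ j l → sym (by-contradiction (h j l))) , gt)

  Lexᶜ : ℕ → ℕ → Set
  Lexᶜ a b = Lex (seq a) (seq b)

  lexᶜ-tri : ∀ a b → a ≡ b ⊎ (Lexᶜ a b ⊎ Lexᶜ b a)
  lexᶜ-tri a b with lem (∃ λ i → seq a i ≢ seq b i)
  ... | yes (i , ne) = inj₂ (lex-tri i ne)
  ... | no h = inj₁ (seq-inj λ i → by-contradiction λ ne → h (i , ne))

  -- A sequence vanishes from its own code on, so two sequences cannot differ beyond both codes.
  -- This bounds the search that decides `Lexᶜ`.
  lexᶜ-bound : ∀ a b {n} → LexAt n (seq a) (seq b) → n < a + b
  lexᶜ-bound a b {n} (_ , lt) with n <? a + b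
  ... | yes p = p
  ... | no ¬p = ⊥-elim (<-irrefl refl (subst₂ _<_ (seq-tail a n (≤-trans (m≤m+n a b) le)) (seq-tail b n (≤-trans (m≤n+m b a) le)) lt))
    where
    le : a + b ≤ n
    le = ≮⇒≥ ¬p

  lexᶜ-between : ∀ {a b} → Lexᶜ a b → ∃ λ c → Lexᶜ a c × Lexᶜ c b
  -- Raising the entry of `a` just after the place of difference stays below `b`, since that place
  -- itself is untouched.
  lexᶜ-between {a} {b} (n , ag , lt) with splice-exists (seq a) (suc n) (suc (seq a (suc n)))
  ... | c , e , v , _ = c , (suc n , (λ i l → sym (e i l)) , ≤-reflexive (sym v))
                          , (n , (λ i l → trans (e i (m<n⇒m<1+n l)) (ag i l)) , subst (_< seq b n) (sym (e n ≤-refl)) lt)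

  lexᶜ-above : ∀ a → ∃ λ c → Lexᶜ a c
  lexᶜ-above a with splice-exists (seq a) 0 (suc (seq a 0))
  ... | c , _ , v , _ = c , 0 , (λ _ ()) , ≤-reflexive (sym v)

  -- Prefixing a zero delays the first nonzero entry by one place. The witness is explicit so that
  -- it gives a primitive recursive function on the standard copy.
  lexᶜ-below : ∀ c → c ≢ 0 → Lexᶜ (pair 0 c) c
  lexᶜ-below c c≢0 with least {λ i → seq c i ≢ 0} (by-contradiction λ h →
      c≢0 (seq-inj λ i → trans (by-contradiction (λ ne → h (i , ne))) (sym (seq0 i))))
  ... | n , ne , mn = n , (λ i lt → trans (shifted i (<⇒≤ lt)) (sym (zero-below i lt)))
                        , subst (_< seq c n) (sym (shifted n ≤-refl)) (n≢0⇒n>0 ne)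
    where
    zero-below : ∀ i → i < n → seq c i ≡ 0
    zero-below i lt = by-contradiction (mn i lt)
    shifted : ∀ i → i ≤ n → seq (pair 0 c) i ≡ 0
    shifted zero _ = seq-pair0 0 c
    shifted (suc i) lt = trans (seq-pairS 0 c i) (zero-below i lt)

  lexᶜ-nonzero : ∀ {a c} → Lexᶜ a c → c ≢ 0
  lexᶜ-nonzero {a} (n , _ , lt) refl = n≮0 (subst (seq a n <_) (seq0 n) lt)

-- Classes of functions closed under primitive recursion.

record PRIn (d : ℕ → ℕ) (n : ℕ) (F : Vec ℕ n → ℕ) : Set where
  constructor mkPR
  field
    prog : PR n
    correct : ∀ ρ → eval d prog ρ ≡ F ρ

-- The trivial class. With it the back-and-forth construction yields the bare existence of
-- isomorphisms.
data Arbitrary (n : ℕ) (F : Vec ℕ n → ℕ) : Set where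
  arbitrary : Arbitrary n F

module Clones (lem : Classical) where
  open Logic lem public

  -- An abstract class of functions lets one construction serve three purposes: plain primitive
  -- recursion, primitive recursion in `d`, and no effectivity at all.
  record Clone (𝒞 : (n : ℕ) → (Vec ℕ n → ℕ) → Set) : Set where
    field
      ext : ∀ {n F G} → (∀ ρ → F ρ ≡ G ρ) → 𝒞 n F → 𝒞 n G
      zeroᶜ : ∀ {n} → 𝒞 n (λ _ → 0)
      succᶜ : ∀ {n F} → 𝒞 n F → 𝒞 n (λ ρ → suc (F ρ))
      var : ∀ {n} (i : Fin n) → 𝒞 n (λ ρ → lookup ρ i)
      sub : ∀ {m n F} → 𝒞 m F → (gs : Vec ℕ n → Vec ℕ m) →
            (∀ i → 𝒞 n (λ ρ → lookup (gs ρ) i)) → 𝒞 n (λ ρ → F (gs ρ))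
      prim : ∀ {n F G} → 𝒞 n F → 𝒞 (suc (suc n)) G →
             𝒞 (suc n) (λ ρ → natrec (F (tail ρ)) (λ k a → G (k ∷ a ∷ tail ρ)) (head ρ))

  sum< : (ℕ → ℕ) → ℕ → ℕ
  sum< f = natrec 0 (λ k a → a + f k)

  term≤sum : ∀ f {n i} → i < n → f i ≤ sum< f n
  term≤sum f {suc n} lt with m≤n⇒m<n∨m≡n lt
  ... | inj₁ (s≤s l) = ≤-trans (term≤sum f l) (m≤m+n _ _)
  ... | inj₂ refl = m≤n+m _ _

  vec-ext : ∀ {n} {u v : Vec ℕ n} → (∀ i → lookup u i ≡ lookup v i) → u ≡ v
  vec-ext {u = []} {[]} h = refl
  vec-ext {u = x ∷ u} {y ∷ v} h = cong₂ _∷_ (h fz) (vec-ext (λ i → h (fs i)))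

  arbitrary-clone : Clone Arbitrary
  arbitrary-clone = record
    { ext = λ _ _ → arbitrary ; zeroᶜ = arbitrary ; succᶜ = λ _ → arbitrary
    ; var = λ _ → arbitrary ; sub = λ _ _ _ → arbitrary ; prim = λ _ _ → arbitrary }

  evalV-tabulate : ∀ d {n m} (p : Fin m → PR n) (ρ : Vec ℕ n) (i : Fin m) →
                   lookup (evalV d (tabulate p) ρ) i ≡ eval d (p i) ρ
  evalV-tabulate d p ρ fz = refl
  evalV-tabulate d p ρ (fs i) = evalV-tabulate d (λ j → p (fs j)) ρ i

  PRIn-clone : ∀ d → Clone (PRIn d)
  PRIn-clone d = record
    { ext = λ e (mkPR t c) → mkPR t λ ρ → trans (c ρ) (e ρ)
    ; zeroᶜ = mkPR zer λ _ → refl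
    ; succᶜ = λ (mkPR t c) → mkPR (comp sc (t ∷ [])) λ ρ → cong suc (c ρ)
    ; var = λ i → mkPR (proj i) λ _ → refl
    ; sub = λ { {F = F} (mkPR t c) gs ps →
        mkPR (comp t (tabulate (λ i → PRIn.prog (ps i)))) λ ρ →
          trans (cong (eval d t) (vec-ext λ i → trans (evalV-tabulate d _ ρ i) (PRIn.correct (ps i) ρ)))
                (c (gs ρ)) }
    ; prim = λ { {F = F} {G} (mkPR t c) (mkPR u e) → mkPR (rec t u) (λ { (k ∷ ρ) → go F G t c u e k ρ }) } }
    where
    go : ∀ {n} F G (t : PR n) (c : ∀ ρ → eval d t ρ ≡ F ρ) (u : PR (suc (suc n))) (e : ∀ ρ → eval d u ρ ≡ G ρ)
         k ρ → evalRec d t u k ρ ≡ natrec (F ρ) (λ k a → G (k ∷ a ∷ ρ)) k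
    go F G t c u e zero ρ = c ρ
    go F G t c u e (suc k) ρ =
      trans (cong (λ a → eval d u (k ∷ a ∷ ρ)) (go F G t c u e k ρ)) (e _)

  mutual
    -- Programs for punctual structures are evaluated with `zeroOracle`; turning oracle calls into
    -- the constant 0 makes their values the same under every oracle.
    erase : ∀ {n} → PR n → PR n
    erase zer = zer
    erase sc = sc
    erase (proj i) = proj i
    erase (comp t ts) = comp (erase t) (eraseV ts)
    erase (rec t u) = rec (erase t) (erase u)
    erase orc = zer

    eraseV : ∀ {n m} → Vec (PR n) m → Vec (PR n) m
    eraseV [] = []
    eraseV (t ∷ ts) = erase t ∷ eraseV ts

  mutual
    eval-erase : ∀ d {n} (t : PR n) ρ → eval d (erase t) ρ ≡ eval zeroOracle t ρ
    eval-erase d zer ρ = refl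
    eval-erase d sc (x ∷ []) = refl
    eval-erase d (proj i) ρ = refl
    eval-erase d (comp t ts) ρ = trans (cong (eval d (erase t)) (evalV-erase d ts ρ)) (eval-erase d t _)
    eval-erase d (rec t u) (k ∷ ρ) = evalRec-erase d t u k ρ
    eval-erase d orc (x ∷ []) = refl

    evalV-erase : ∀ d {n m} (ts : Vec (PR n) m) ρ → evalV d (eraseV ts) ρ ≡ evalV zeroOracle ts ρ
    evalV-erase d [] ρ = refl
    evalV-erase d (t ∷ ts) ρ = cong₂ _∷_ (eval-erase d t ρ) (evalV-erase d ts ρ)

    evalRec-erase : ∀ d {n} (t : PR n) u k ρ → evalRec d (erase t) (erase u) k ρ ≡ evalRec zeroOracle t u k ρ
    evalRec-erase d t u zero ρ = eval-erase d t ρ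
    evalRec-erase d t u (suc k) ρ =
      trans (cong (λ a → eval d (erase u) (k ∷ a ∷ ρ)) (evalRec-erase d t u k ρ)) (eval-erase d u _)

  fromPR : ∀ d {n} (t : PR n) → PRIn d n (eval zeroOracle t)
  fromPR d t = mkPR (erase t) (eval-erase d t)

  module Closure {𝒞 : (n : ℕ) → (Vec ℕ n → ℕ) → Set} (clone : Clone 𝒞) where
    open Clone clone public

    record Fn1 (F : ℕ → ℕ) : Set where
      constructor fn1
      field fn : 𝒞 1 (λ ρ → F (lookup ρ fz))

    record Fn2 (F : ℕ → ℕ → ℕ) : Set where
      constructor fn2
      field fn : 𝒞 2 (λ ρ → F (lookup ρ fz) (lookup ρ (fs fz)))

    record Rec {n : ℕ} (P : Vec ℕ n → Set) : Set where
      constructor isRec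
      field char : 𝒞 n (λ ρ → 𝟙 (P ρ))
    open Rec public

    record Rel1 (P : ℕ → Set) : Set where
      constructor rel1
      field rel : Rec {1} (λ ρ → P (lookup ρ fz))

    record Rel2 (P : ℕ → ℕ → Set) : Set where
      constructor rel2
      field rel : Rec {2} (λ ρ → P (lookup ρ fz) (lookup ρ (fs fz)))

    record Rel3 (P : ℕ → ℕ → ℕ → Set) : Set where
      constructor rel3
      field rel : Rec {3} (λ ρ → P (lookup ρ fz) (lookup ρ (fs fz)) (lookup ρ (fs (fs fz))))

    record Rel4 (P : ℕ → ℕ → ℕ → ℕ → Set) : Set where
      constructor rel4
      field rel : Rec {4} (λ ρ → P (lookup ρ fz) (lookup ρ (fs fz)) (lookup ρ (fs (fs fz))) (lookup ρ (fs (fs (fs fz)))))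

    v0 : ∀ {n} → 𝒞 (suc n) (λ ρ → lookup ρ fz)
    v0 = var fz
    v1 : ∀ {n} → 𝒞 (2 + n) (λ ρ → lookup ρ (fs fz))
    v1 = var (fs fz)
    v2 : ∀ {n} → 𝒞 (3 + n) (λ ρ → lookup ρ (fs (fs fz)))
    v2 = var (fs (fs fz))
    v3 : ∀ {n} → 𝒞 (4 + n) (λ ρ → lookup ρ (fs (fs (fs fz))))
    v3 = var (fs (fs (fs fz)))
    v4 : ∀ {n} → 𝒞 (5 + n) (λ ρ → lookup ρ (fs (fs (fs (fs fz)))))
    v4 = var (fs (fs (fs (fs fz))))
    v5 : ∀ {n} → 𝒞 (6 + n) (λ ρ → lookup ρ (fs (fs (fs (fs (fs fz))))))
    v5 = var (fs (fs (fs (fs (fs fz)))))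

    const : ∀ {n} k → 𝒞 n (λ _ → k)
    const zero = zeroᶜ
    const (suc k) = succᶜ (const k)

    rsub : ∀ {m n} {P : Vec ℕ m → Set} → Rec P → (gs : Vec ℕ n → Vec ℕ m) →
           (∀ i → 𝒞 n (λ ρ → lookup (gs ρ) i)) → Rec (λ ρ → P (gs ρ))
    rsub (isRec p) gs h = isRec (sub p gs h)

    rext : ∀ {n} {P Q : Vec ℕ n → Set} → (∀ ρ → P ρ → Q ρ) → (∀ ρ → Q ρ → P ρ) → Rec P → Rec Q
    rext f g (isRec p) = isRec (ext (λ ρ → 𝟙-cong (f ρ) (g ρ)) p)

    private
      args1 : ∀ {n} {g : Vec ℕ n → ℕ} → 𝒞 n g → ∀ i → 𝒞 n (λ ρ → lookup (g ρ ∷ []) i)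
      args1 p fz = p

      args2 : ∀ {n} {g h : Vec ℕ n → ℕ} → 𝒞 n g → 𝒞 n h → ∀ i → 𝒞 n (λ ρ → lookup (g ρ ∷ h ρ ∷ []) i)
      args2 p q fz = p
      args2 p q (fs fz) = q

      args3 : ∀ {n} {g h k : Vec ℕ n → ℕ} → 𝒞 n g → 𝒞 n h → 𝒞 n k →
              ∀ i → 𝒞 n (λ ρ → lookup (g ρ ∷ h ρ ∷ k ρ ∷ []) i)
      args3 p q r fz = p
      args3 p q r (fs fz) = q
      args3 p q r (fs (fs fz)) = r

      args4 : ∀ {n} {g h k l : Vec ℕ n → ℕ} → 𝒞 n g → 𝒞 n h → 𝒞 n k → 𝒞 n l →
              ∀ i → 𝒞 n (λ ρ → lookup (g ρ ∷ h ρ ∷ k ρ ∷ l ρ ∷ []) i)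
      args4 p q r s fz = p
      args4 p q r s (fs fz) = q
      args4 p q r s (fs (fs fz)) = r
      args4 p q r s (fs (fs (fs fz))) = s

    ap1 : ∀ {n F} {g : Vec ℕ n → ℕ} → Fn1 F → 𝒞 n g → 𝒞 n (λ ρ → F (g ρ))
    ap1 (fn1 f) p = sub f (λ ρ → _ ∷ []) (args1 p)

    ap2 : ∀ {n F} {g h : Vec ℕ n → ℕ} → Fn2 F → 𝒞 n g → 𝒞 n h → 𝒞 n (λ ρ → F (g ρ) (h ρ))
    ap2 (fn2 f) p q = sub f (λ ρ → _ ∷ _ ∷ []) (args2 p q)

    rap1 : ∀ {n P} {g : Vec ℕ n → ℕ} → Rel1 P → 𝒞 n g → Rec (λ ρ → P (g ρ))
    rap1 (rel1 r) p = rsub r (λ ρ → _ ∷ []) (args1 p)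

    rap2 : ∀ {n P} {g h : Vec ℕ n → ℕ} → Rel2 P → 𝒞 n g → 𝒞 n h → Rec (λ ρ → P (g ρ) (h ρ))
    rap2 (rel2 r) p q = rsub r (λ ρ → _ ∷ _ ∷ []) (args2 p q)

    rap3 : ∀ {n P} {g h k : Vec ℕ n → ℕ} → Rel3 P → 𝒞 n g → 𝒞 n h → 𝒞 n k → Rec (λ ρ → P (g ρ) (h ρ) (k ρ))
    rap3 (rel3 r) p q s = rsub r (λ ρ → _ ∷ _ ∷ _ ∷ []) (args3 p q s)

    rap4 : ∀ {n P} {g h k l : Vec ℕ n → ℕ} → Rel4 P → 𝒞 n g → 𝒞 n h → 𝒞 n k → 𝒞 n l →
           Rec (λ ρ → P (g ρ) (h ρ) (k ρ) (l ρ))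
    rap4 (rel4 r) p q s t = rsub r (λ ρ → _ ∷ _ ∷ _ ∷ _ ∷ []) (args4 p q s t)

    natrecᶜ : ∀ {n F G t} → 𝒞 n F → 𝒞 (2 + n) G → 𝒞 n t →
              𝒞 n (λ ρ → natrec (F ρ) (λ k a → G (k ∷ a ∷ ρ)) (t ρ))
    natrecᶜ {t = t} f g p = sub (prim f g) (λ ρ → t ρ ∷ ρ) λ { fz → p ; (fs i) → var i }

    private
      dropFirst : ∀ {n} → Vec ℕ (2 + n) → Vec ℕ (suc n)
      dropFirst ρ = lookup ρ fz ∷ tail (tail ρ)

      lookup-dropFirst : ∀ {n} (ρ : Vec ℕ (2 + n)) (i : Fin n) → lookup ρ (fs (fs i)) ≡ lookup (tail (tail ρ)) i
      lookup-dropFirst (_ ∷ _ ∷ _) i = refl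

    skipAcc : ∀ {n G} → 𝒞 (suc n) G → 𝒞 (2 + n) (λ ρ → G (lookup ρ fz ∷ tail (tail ρ)))
    skipAcc p = sub p dropFirst λ { fz → v0 ; (fs i) → ext (λ ρ → lookup-dropFirst ρ i) (var (fs (fs i))) }

    -- Bounded quantifiers test the index of the recursion, but bounded search tests its current
    -- candidate, which is the accumulator.
    skipIdx : ∀ {n G} → 𝒞 (suc n) G → 𝒞 (2 + n) (λ ρ → G (lookup ρ (fs fz) ∷ tail (tail ρ)))
    skipIdx p = sub p (λ ρ → lookup ρ (fs fz) ∷ tail (tail ρ))
                  λ { fz → v1 ; (fs i) → ext (λ ρ → lookup-dropFirst ρ i) (var (fs (fs i))) }

    infixl 6 _+ᶜ_ _∸ᶜ_
    infixl 7 _*ᶜ_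

    _+ᶜ_ : ∀ {n f g} → 𝒞 n f → 𝒞 n g → 𝒞 n (λ ρ → f ρ + g ρ)
    _+ᶜ_ {f = f} {g} p q = ext (λ ρ → go (g ρ) (f ρ)) (natrecᶜ q (succᶜ v1) p)
      where
      go : ∀ b a → natrec b (λ _ x → suc x) a ≡ a + b
      go b zero = refl
      go b (suc a) = cong suc (go b a)

    predᶜ : ∀ {n f} → 𝒞 n f → 𝒞 n (λ ρ → pred (f ρ))
    predᶜ {f = f} p = ext (λ ρ → go (f ρ)) (natrecᶜ zeroᶜ v0 p)
      where
      go : ∀ a → natrec 0 (λ k _ → k) a ≡ pred a
      go zero = refl
      go (suc a) = refl

    _∸ᶜ_ : ∀ {n f g} → 𝒞 n f → 𝒞 n g → 𝒞 n (λ ρ → f ρ ∸ g ρ)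
    _∸ᶜ_ {f = f} {g} p q = ext (λ ρ → go (f ρ) (g ρ)) (natrecᶜ p (predᶜ v1) q)
      where
      go : ∀ a b → natrec a (λ _ x → pred x) b ≡ a ∸ b
      go a zero = refl
      go a (suc b) = trans (cong pred (go a b)) (pred[m∸n]≡m∸[1+n] a b)

    _*ᶜ_ : ∀ {n f g} → 𝒞 n f → 𝒞 n g → 𝒞 n (λ ρ → f ρ * g ρ)
    _*ᶜ_ {n} {f} {g} p q = ext (λ ρ → go (g ρ) (f ρ)) (natrecᶜ zeroᶜ (v1 +ᶜ wk2 q) p)
      where
      wk2 : ∀ {g} → 𝒞 n g → 𝒞 (2 + n) (λ ρ → g (tail (tail ρ)))
      wk2 q = sub q (λ ρ → tail (tail ρ)) λ i → ext (λ ρ → lookup-dropFirst ρ i) (var (fs (fs i)))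
      go : ∀ b a → natrec 0 (λ _ x → x + b) a ≡ a * b
      go b zero = refl
      go b (suc a) = trans (+-comm _ b) (cong (b +_) (go b a))

    infixr 5 _∧ᵣ_
    infixr 4 _∨ᵣ_
    infixr 3 _⇒ᵣ_
    infix 6 _≡ᵣ_ _≤ᵣ_ _<ᵣ_

    ¬ᵣ : ∀ {n} {P : Vec ℕ n → Set} → Rec P → Rec (λ ρ → ¬ P ρ)
    ¬ᵣ {P = P} (isRec p) = isRec (ext go (const 1 ∸ᶜ p))
      where
      go : ∀ ρ → 1 ∸ 𝟙 (P ρ) ≡ 𝟙 (¬ P ρ)
      go ρ with lem (P ρ)
      ... | yes x = trans (cong (1 ∸_) (𝟙-yes x)) (sym (𝟙-no (λ h → h x)))
      ... | no x = trans (cong (1 ∸_) (𝟙-no x)) (sym (𝟙-yes x))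

    _∧ᵣ_ : ∀ {n} {P Q : Vec ℕ n → Set} → Rec P → Rec Q → Rec (λ ρ → P ρ × Q ρ)
    _∧ᵣ_ {P = P} {Q} (isRec p) (isRec q) = isRec (ext go (p *ᶜ q))
      where
      go : ∀ ρ → 𝟙 (P ρ) * 𝟙 (Q ρ) ≡ 𝟙 (P ρ × Q ρ)
      go ρ with lem (P ρ) | lem (Q ρ)
      ... | yes x | yes y = trans (cong₂ _*_ (𝟙-yes x) (𝟙-yes y)) (sym (𝟙-yes (x , y)))
      ... | yes x | no y = trans (cong₂ _*_ (𝟙-yes x) (𝟙-no y)) (sym (𝟙-no λ z → y (proj₂ z)))
      ... | no x | _ = trans (cong (_* 𝟙 (Q ρ)) (𝟙-no x)) (sym (𝟙-no λ z → x (proj₁ z)))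

    _∨ᵣ_ : ∀ {n} {P Q : Vec ℕ n → Set} → Rec P → Rec Q → Rec (λ ρ → P ρ ⊎ Q ρ)
    p ∨ᵣ q = rext (λ ρ h → by-contradiction λ k → h ((λ x → k (inj₁ x)) , λ x → k (inj₂ x)))
                  (λ ρ s (f , g) → [ f , g ]′ s) (¬ᵣ (¬ᵣ p ∧ᵣ ¬ᵣ q))

    _⇒ᵣ_ : ∀ {n} {P Q : Vec ℕ n → Set} → Rec P → Rec Q → Rec (λ ρ → P ρ → Q ρ)
    p ⇒ᵣ q = rext (λ ρ h x → by-contradiction λ k → h (x , k)) (λ ρ f (x , k) → k (f x)) (¬ᵣ (p ∧ᵣ ¬ᵣ q))

    _≤ᵣ_ : ∀ {n f g} → 𝒞 n f → 𝒞 n g → Rec (λ ρ → f ρ ≤ g ρ)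
    _≤ᵣ_ {f = f} {g} p q = isRec (ext go (const 1 ∸ᶜ (p ∸ᶜ q)))
      where
      go : ∀ ρ → 1 ∸ (f ρ ∸ g ρ) ≡ 𝟙 (f ρ ≤ g ρ)
      go ρ with f ρ ≤? g ρ
      ... | yes x = trans (cong (1 ∸_) (m≤n⇒m∸n≡0 x)) (sym (𝟙-yes x))
      ... | no x = trans (m≤n⇒m∸n≡0 (m<n⇒0<n∸m (≰⇒> x))) (sym (𝟙-no x))

    _<ᵣ_ : ∀ {n f g} → 𝒞 n f → 𝒞 n g → Rec (λ ρ → f ρ < g ρ)
    p <ᵣ q = succᶜ p ≤ᵣ q

    _≡ᵣ_ : ∀ {n f g} → 𝒞 n f → 𝒞 n g → Rec (λ ρ → f ρ ≡ g ρ)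
    p ≡ᵣ q = rext (λ ρ (a , b) → ≤-antisym a b) (λ ρ e → ≤-reflexive e , ≤-reflexive (sym e))
                  ((p ≤ᵣ q) ∧ᵣ (q ≤ᵣ p))

    ∀ᵣ : ∀ {n t} {P : Vec ℕ (suc n) → Set} → 𝒞 n t → Rec P → Rec (λ ρ → ∀ i → i < t ρ → P (i ∷ ρ))
    ∀ᵣ {n} {t} {P} p (isRec q) = isRec (ext (λ ρ → go ρ (t ρ)) (natrecᶜ (const 1) (v1 *ᶜ skipAcc q) p))
      where
      go : ∀ ρ m → natrec 1 (λ k a → a * 𝟙 (P (k ∷ ρ))) m ≡ 𝟙 (∀ i → i < m → P (i ∷ ρ))
      go ρ zero = sym (𝟙-yes λ _ ())
      go ρ (suc m) with lem (∀ i → i < m → P (i ∷ ρ)) | lem (P (m ∷ ρ))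
      ... | yes x | yes y = trans (cong₂ _*_ (trans (go ρ m) (𝟙-yes x)) (𝟙-yes y))
              (sym (𝟙-yes λ i lt → [ (λ { (s≤s l) → x i l }) , (λ { refl → y }) ]′ (m≤n⇒m<n∨m≡n lt)))
      ... | yes x | no y = trans (cong₂ _*_ (trans (go ρ m) (𝟙-yes x)) (𝟙-no y))
              (sym (𝟙-no λ h → y (h m ≤-refl)))
      ... | no x | _ = trans (cong (_* 𝟙 (P (m ∷ ρ))) (trans (go ρ m) (𝟙-no x)))
              (sym (𝟙-no λ h → x (λ i l → h i (m<n⇒m<1+n l))))

    ∃ᵣ : ∀ {n t} {P : Vec ℕ (suc n) → Set} → 𝒞 n t → Rec P → Rec (λ ρ → Σ ℕ λ i → i < t ρ × P (i ∷ ρ))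
    ∃ᵣ p q = rext (λ ρ h → by-contradiction λ k → h λ i lt x → k (i , lt , x))
                  (λ ρ (i , lt , x) h → h i lt x) (¬ᵣ (∀ᵣ p (¬ᵣ q)))

    opaque
      unfolding ite
      iteᶜ : ∀ {n f g} {P : Vec ℕ n → Set} → Rec P → 𝒞 n f → 𝒞 n g → 𝒞 n (λ ρ → ite (P ρ) (f ρ) (g ρ))
      iteᶜ (isRec p) f g = p *ᶜ f +ᶜ (const 1 ∸ᶜ p) *ᶜ g

    opaque
      unfolding μ
      μᶜ : ∀ {n t} {P : Vec ℕ (suc n) → Set} → Rec P → 𝒞 n t → 𝒞 n (λ ρ → μ (λ i → P (i ∷ ρ)) (t ρ))
      μᶜ (isRec p) q = natrecᶜ zeroᶜ (iteᶜ (isRec (skipIdx p)) v1 (succᶜ v0)) q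

    opaque
      unfolding par half
      par-fn : Fn1 par
      par-fn = fn1 (natrecᶜ zeroᶜ (const 1 ∸ᶜ v1) v0)

      half-fn : Fn1 half
      half-fn = fn1 (natrecᶜ zeroᶜ (v1 +ᶜ ap1 par-fn v0) v0)

    opaque
      unfolding pair triangle
      pair-fn : Fn2 pair
      pair-fn = fn2 (natrecᶜ zeroᶜ (v1 +ᶜ succᶜ v0) (v0 +ᶜ v1) +ᶜ v1)

    opaque
      unfolding π₁ π₂
      π₁-fn : Fn1 π₁
      π₁-fn = fn1 (μᶜ (∃ᵣ (succᶜ v1) (ap2 pair-fn v1 v0 ≡ᵣ v2)) v0)

      π₂-fn : Fn1 π₂
      π₂-fn = fn1 (μᶜ (ap2 pair-fn (ap1 π₁-fn v1) v0 ≡ᵣ v1) v0)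

    opaque
      unfolding seq drop
      drop-fn : Fn2 drop
      drop-fn = fn2 (natrecᶜ v0 (ap1 π₂-fn v1) v1)

      seq-fn : Fn2 seq
      seq-fn = fn2 (ap1 π₁-fn (ap2 drop-fn v0 v1))

    opaque
      lexᶜ-rel : Rel2 Lexᶜ
      lexᶜ-rel = rel2 (rext
        (λ ρ (n , _ , a , lt) → n , a , lt)
        (λ ρ (n , a , lt) → n , lexᶜ-bound (lookup ρ fz) (lookup ρ (fs fz)) (a , lt) , a , lt)
        (∃ᵣ (v0 +ᶜ v1) (∀ᵣ v0 (ap2 seq-fn v2 v0 ≡ᵣ ap2 seq-fn v3 v0) ∧ᵣ (ap2 seq-fn v1 v0 <ᵣ ap2 seq-fn v2 v0))))

    sum<ᶜ : ∀ {n t f} → 𝒞 (suc n) f → 𝒞 n t → 𝒞 n (λ ρ → sum< (λ i → f (i ∷ ρ)) (t ρ))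
    sum<ᶜ p q = natrecᶜ zeroᶜ (v1 +ᶜ skipAcc p) q

-- W is the copy of ω and H the copy of η; numbers outside W ∪ H are not points of the order.
record OrderωPlusη : Set₁ where
  field
    O : ℕ → ℕ → Set
    W H : ℕ → Set
    irr : ∀ {x} → ¬ O x x
    trans< : ∀ {x y z} → O x y → O y z → O x z
    tri : ∀ {x y} → W x ⊎ H x → W y ⊎ H y → x ≡ y ⊎ (O x y ⊎ O y x)
    disj : ∀ {x} → W x → ¬ H x
    W<H : ∀ {x y} → W x → H y → O x y
    W-down : ∀ {x y} → O x y → W y → W x
    H-up : ∀ {x y} → O x y → H x → H y
    e₀ : ℕ
    W-e₀ : W e₀
    e₀-least : ∀ {x} → W x → x ≡ e₀ ⊎ O e₀ x
    succ-ex : ∀ {x} → W x → ∃ λ y → W y × O x y × (∀ z → ¬ (O x z × O z y))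
    bound-ex : ∀ {x} → W x → ∃ λ n → ∀ y → O y x → y < n
    q₀ : ℕ
    H-q₀ : H q₀
    low-ex : ∀ {x} → H x → ∃ λ y → H y × O y x
    up-ex : ∀ {x} → H x → ∃ λ y → O x y
    mid-ex : ∀ {x y} → H x → H y → O x y → ∃ λ z → O x z × O z y

  asym< : ∀ {x y} → O x y → ¬ O y x
  asym< p q = irr (trans< p q)

-- Back-and-forth with bounded searches.

module BackAndForth (lem : Classical) where
  open Clones lem public

  -- Skolem functions for the existence axioms, inside the class; they supply the bounds for all
  -- searches that follow.
  record Presented (𝒞 : (n : ℕ) → (Vec ℕ n → ℕ) → Set) (clone : Clone 𝒞) (X : OrderωPlusη) : Set where
    open OrderωPlusη X
    open Closure clone
    field
      O-rel : Rel2 O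
      W-rel : Rel1 W
      H-rel : Rel1 H
      next bound low up : ℕ → ℕ
      mid : ℕ → ℕ → ℕ
      next-fn : Fn1 next
      bound-fn : Fn1 bound
      low-fn : Fn1 low
      up-fn : Fn1 up
      mid-fn : Fn2 mid
      next-spec : ∀ {x} → W x → W (next x) × O x (next x) × (∀ z → ¬ (O x z × O z (next x)))
      bound-spec : ∀ {x} → W x → ∀ y → O y x → y < bound x
      low-spec : ∀ {x} → H x → H (low x) × O (low x) x
      up-spec : ∀ {x} → H x → O x (up x)
      mid-spec : ∀ {x y} → H x → H y → O x y → O x (mid x y) × O (mid x y) y

  module Side {𝒞} {clone : Clone 𝒞} {X : OrderωPlusη} (PX : Presented 𝒞 clone X) where
    open OrderωPlusη X public
    open Presented PX public
    open Closure clone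

    enum : ℕ → ℕ
    enum = natrec e₀ (λ _ a → next a)

    W-enum : ∀ n → W (enum n)
    W-enum zero = W-e₀
    W-enum (suc n) = proj₁ (next-spec (W-enum n))

    enum-step : ∀ n → O (enum n) (enum (suc n))
    enum-step n = proj₁ (proj₂ (next-spec (W-enum n)))

    enum-mono : ∀ {m n} → m < n → O (enum m) (enum n)
    enum-mono {m} {suc n} lt with m≤n⇒m<n∨m≡n lt
    ... | inj₁ (s≤s l) = trans< (enum-mono l) (enum-step n)
    ... | inj₂ refl = enum-step n

    enum-reflect : ∀ {m n} → O (enum m) (enum n) → m < n
    enum-reflect {m} {n} o with <-cmp m n
    ... | tri< lt _ _ = lt
    ... | tri≈ _ refl _ = ⊥-elim (irr o)
    ... | tri> _ _ gt = ⊥-elim (asym< o (enum-mono gt))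

    enum-inj : ∀ {m n} → enum m ≡ enum n → m ≡ n
    enum-inj {m} {n} e with <-cmp m n
    ... | tri< lt _ _ = ⊥-elim (irr (subst (O (enum m)) (sym e) (enum-mono lt)))
    ... | tri≈ _ eq _ = eq
    ... | tri> _ _ gt = ⊥-elim (irr (subst (λ z → O z (enum m)) (sym e) (enum-mono gt)))

    enum-reaches : ∀ {x} → W x → ∀ n → (∃ λ i → i ≤ n × enum i ≡ x) ⊎ O (enum n) x
    enum-reaches w zero with e₀-least w
    ... | inj₁ e = inj₁ (0 , z≤n , sym e)
    ... | inj₂ o = inj₂ o
    enum-reaches {x} w (suc n) with enum-reaches w n
    ... | inj₁ (i , le , e) = inj₁ (i , m≤n⇒m≤1+n le , e)
    ... | inj₂ o with tri (inj₁ w) (inj₁ (W-enum (suc n)))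
    ...   | inj₁ e = inj₁ (suc n , ≤-refl , sym e)
    ...   | inj₂ (inj₁ o') = ⊥-elim (proj₂ (proj₂ (next-spec (W-enum n))) x (o , o'))
    ...   | inj₂ (inj₂ o') = inj₂ o'

    -- Otherwise the first `bound x` + 1 values of `enum` would be distinct predecessors of `x`, all
    -- smaller than `bound x`.
    enum-onto : ∀ {x} → W x → ∃ λ i → i ≤ bound x × enum i ≡ x
    enum-onto {x} w with enum-reaches w (bound x)
    ... | inj₁ h = h
    ... | inj₂ o = ⊥-elim (unbounded enum (λ i j lt e → <⇒≢ lt (enum-inj e)) (bound x) λ i le → bound-spec w (enum i)
            ([ (λ l → trans< (enum-mono l) o) , (λ { refl → o }) ]′ (m≤n⇒m<n∨m≡n le)))

    rank : ℕ → ℕ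
    rank x = μ (λ n → enum n ≡ x) (bound x)

    enum-rank : ∀ {x} → W x → enum (rank x) ≡ x
    enum-rank {x} w with enum-onto w
    ... | i , le , e = μ-sat (λ n → enum n ≡ x) le e

    rank-enum : ∀ n → rank (enum n) ≡ n
    rank-enum n = enum-inj (enum-rank (W-enum n))

    enum-fn : Fn1 enum
    enum-fn = fn1 (natrecᶜ (const e₀) (ap1 next-fn v1) v0)

    rank-fn : Fn1 rank
    rank-fn = fn1 (μᶜ (ap1 enum-fn v0 ≡ᵣ v1) (ap1 bound-fn v0))

    -- Every cut of the elements ≤ n of H is filled by a number ≤ near n.
    near : ℕ → ℕ
    near n = sum< (λ u → low u + up u + sum< (λ v → mid u v) (suc n)) (suc n)

    near-fn : Fn1 near
    near-fn = fn1 (sum<ᶜ (ap1 low-fn v0 +ᶜ ap1 up-fn v0 +ᶜ sum<ᶜ (ap2 mid-fn v1 v0) (succᶜ v1)) (succᶜ v0))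

    low≤ : ∀ {u n} → u ≤ n → low u ≤ near n
    low≤ {u} {n} le = ≤-trans (≤-trans (m≤m+n (low u) (up u)) (m≤m+n _ _))
      (term≤sum (λ u → low u + up u + sum< (λ v → mid u v) (suc n)) (s≤s le))

    up≤ : ∀ {u n} → u ≤ n → up u ≤ near n
    up≤ {u} {n} le = ≤-trans (≤-trans (m≤n+m (up u) (low u)) (m≤m+n _ _))
      (term≤sum (λ u → low u + up u + sum< (λ v → mid u v) (suc n)) (s≤s le))

    mid≤ : ∀ {u v n} → u ≤ n → v ≤ n → mid u v ≤ near n
    mid≤ {u} {v} {n} le le' = ≤-trans (≤-trans (term≤sum (mid u) (s≤s le')) (m≤n+m _ (low u + up u)))
      (term≤sum (λ u → low u + up u + sum< (λ v → mid u v) (suc n)) (s≤s le))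

    -- Defaults to `q₀`, so that every stage has an element of `H` to treat; repetitions do no harm.
    elt : ℕ → ℕ
    elt m = ite (H m) m q₀

    H-elt : ∀ m → H (elt m)
    H-elt m with lem (H m)
    ... | yes h = subst H (sym (ite-yes h)) h
    ... | no h = subst H (sym (ite-no h)) H-q₀

    elt≤ : ∀ m → elt m ≤ m + q₀
    elt≤ m with lem (H m)
    ... | yes h = ≤-trans (≤-reflexive (ite-yes h)) (m≤m+n m q₀)
    ... | no h = ≤-trans (≤-reflexive (ite-no h)) (m≤n+m q₀ m)

    elt-fn : Fn1 elt
    elt-fn = fn1 (iteᶜ (rap1 H-rel v0) v0 (const q₀))

    hull : ∀ {x y} → H x → H y → x ≡ y ⊎ (O x y ⊎ O y x)
    hull h k = tri (inj₂ h) (inj₂ k)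

  module Extend {𝒞} {clone : Clone 𝒞} {X Y : OrderωPlusη}
                (PX : Presented 𝒞 clone X) (PY : Presented 𝒞 clone Y) where
    module X = Side PX
    module Y = Side PY

    -- A new `e` is placed relative to the greatest `u i` below it and the least one above it. The
    -- four cases, according to which of these exist, use `q₀`, `up`, `low` and `mid`; the first is
    -- bounded by `n`, the others by `near n`.
    extend : (k : ℕ) (u v : ℕ → ℕ) (e n : ℕ) →
      (∀ i → i < k → X.H (u i)) → (∀ i → i < k → Y.H (v i)) → (∀ i → i < k → v i ≤ n) →
      (∀ i j → i < k → j < k → X.O (u i) (u j) → Y.O (v i) (v j)) →
      (∀ i j → i < k → j < k → Y.O (v i) (v j) → X.O (u i) (u j)) →
      X.H e → Y.q₀ ≤ n →
      ∃ λ y → y ≤ n + Y.near n × Y.H y × (∀ i → i < k →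
        (X.O (u i) e ⟺ Y.O (v i) y) × (X.O e (u i) ⟺ Y.O y (v i)))
    extend k u v e n Hu Hv v≤ to from He q≤ with lem (∃ λ i → i < k × u i ≡ e)
    -- An element treated before keeps its partner.
    ... | yes (i , i< , refl) = v i , ≤-trans (v≤ i i<) (m≤m+n n _) , Hv i i< ,
            λ j j< → (to j i j< i< , from j i j< i<) , (to i j i< j< , from i j i< j<)
    -- The negated relations read "at most" and "at least", which are total even if points repeat.
    ... | no new = choose
            (max-below {λ i → X.O (u i) e} {λ i j → ¬ X.O (u j) (u i)} k (λ {i} {j} a b _ _ → total a b)
              (λ a b c _ _ _ → transit a b c))
            (max-below {λ i → X.O e (u i)} {λ i j → ¬ X.O (u i) (u j)} k
              (λ {i} {j} a b _ _ → [ inj₂ , inj₁ ]′ (total a b))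
              (λ a b c _ _ _ p q → transit c b a q p))
      where
      total : ∀ {i j} → i < k → j < k → ¬ X.O (u j) (u i) ⊎ ¬ X.O (u i) (u j)
      total {i} {j} a b with lem (X.O (u j) (u i))
      ... | yes o = inj₂ (X.asym< o)
      ... | no ¬o = inj₁ ¬o

      transit : ∀ {i j l} → i < k → j < k → l < k → ¬ X.O (u j) (u i) → ¬ X.O (u l) (u j) → ¬ X.O (u l) (u i)
      transit {i} {j} {l} a b c p q o with X.hull (Hu j b) (Hu i a)
      ... | inj₁ eq = q (subst (X.O (u l)) (sym eq) o)
      ... | inj₂ (inj₁ o') = p o'
      ... | inj₂ (inj₂ o') = q (X.trans< o o')

      Fits : Set
      Fits = ∃ λ y → y ≤ n + Y.near n × Y.H y × (∀ i → i < k →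
        (X.O (u i) e ⟺ Y.O (v i) y) × (X.O e (u i) ⟺ Y.O y (v i)))

      finish : ∀ y → y ≤ n + Y.near n → Y.H y → (∀ i → i < k → X.O (u i) e → Y.O (v i) y) →
               (∀ i → i < k → X.O e (u i) → Y.O y (v i)) → Fits
      finish y le h f g = y , le , h , λ i i< → (f i i< , back₁ i i<) , (g i i< , back₂ i i<)
        where
        back₁ : ∀ i → i < k → Y.O (v i) y → X.O (u i) e
        back₁ i i< o with X.hull (Hu i i<) He
        ... | inj₁ eq = ⊥-elim (new (i , i< , eq))
        ... | inj₂ (inj₁ o') = o'
        ... | inj₂ (inj₂ o') = ⊥-elim (Y.asym< o (g i i< o'))
        back₂ : ∀ i → i < k → Y.O y (v i) → X.O e (u i)
        back₂ i i< o with X.hull (Hu i i<) He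
        ... | inj₁ eq = ⊥-elim (new (i , i< , eq))
        ... | inj₂ (inj₁ o') = ⊥-elim (Y.asym< o (f i i< o'))
        ... | inj₂ (inj₂ o') = o'

      below : ∀ {i j y} → i < k → j < k → ¬ X.O (u j) (u i) → Y.O (v j) y → Y.O (v i) y
      below {i} {j} {y} a b ¬o o with Y.hull (Hv i a) (Hv j b)
      ... | inj₁ eq = subst (λ z → Y.O z y) (sym eq) o
      ... | inj₂ (inj₁ o') = Y.trans< o' o
      ... | inj₂ (inj₂ o') = ⊥-elim (¬o (from j i b a o'))

      above : ∀ {i j y} → i < k → j < k → ¬ X.O (u i) (u j) → Y.O y (v j) → Y.O y (v i)
      above {i} {j} {y} a b ¬o o with Y.hull (Hv i a) (Hv j b)
      ... | inj₁ eq = subst (Y.O y) (sym eq) o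
      ... | inj₂ (inj₁ o') = ⊥-elim (¬o (from i j a b o'))
      ... | inj₂ (inj₂ o') = Y.trans< o o'

      grow : ∀ {y} → y ≤ Y.near n → y ≤ n + Y.near n
      grow le = ≤-trans le (m≤n+m _ n)

      choose : ((∀ i → i < k → ¬ X.O (u i) e) ⊎
                (∃ λ i → i < k × X.O (u i) e × (∀ j → j < k → X.O (u j) e → ¬ X.O (u i) (u j)))) →
               ((∀ i → i < k → ¬ X.O e (u i)) ⊎
                (∃ λ i → i < k × X.O e (u i) × (∀ j → j < k → X.O e (u j) → ¬ X.O (u j) (u i)))) → Fits
      choose (inj₁ noL) (inj₁ noR) =
        finish Y.q₀ (≤-trans q≤ (m≤m+n n _)) Y.H-q₀ (λ i i< o → ⊥-elim (noL i i< o)) (λ i i< o → ⊥-elim (noR i i< o))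
      choose (inj₂ (i , i< , o , mx)) (inj₁ noR) =
        finish (Y.up (v i)) (grow (Y.up≤ (v≤ i i<))) (Y.H-up (Y.up-spec (Hv i i<)) (Hv i i<))
          (λ j j< o' → below j< i< (mx j j< o') (Y.up-spec (Hv i i<)))
          (λ j j< o' → ⊥-elim (noR j j< o'))
      choose (inj₁ noL) (inj₂ (i , i< , o , mn)) =
        finish (Y.low (v i)) (grow (Y.low≤ (v≤ i i<))) (proj₁ (Y.low-spec (Hv i i<)))
          (λ j j< o' → ⊥-elim (noL j j< o'))
          (λ j j< o' → above j< i< (mn j j< o') (proj₂ (Y.low-spec (Hv i i<))))
      choose (inj₂ (i , i< , o , mx)) (inj₂ (i' , i'< , o' , mn)) =
        finish (Y.mid (v i) (v i')) (grow (Y.mid≤ (v≤ i i<) (v≤ i' i'<))) (Y.H-up (proj₁ m) (Hv i i<))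
          (λ j j< p → below j< i< (mx j j< p) (proj₁ m))
          (λ j j< p → above j< i'< (mn j j< p) (proj₂ m))
        where
        m = Y.mid-spec (Hv i i<) (Hv i' i'<) (to i i' i< i'< (X.trans< o o'))

  record IsoOn (X Y : OrderωPlusη) (f g : ℕ → ℕ) : Set where
    private
      module X = OrderωPlusη X
      module Y = OrderωPlusη Y
    field
      f-W : ∀ {x} → X.W x → Y.W (f x)
      f-H : ∀ {x} → X.H x → Y.H (f x)
      gf : ∀ {x} → X.W x ⊎ X.H x → g (f x) ≡ x
      f-O : ∀ {x y} → X.W x ⊎ X.H x → X.W y ⊎ X.H y → X.O x y → Y.O (f x) (f y)

  -- The sequence of partners and the resulting isomorphism.

  module TwoOrders {𝒞} {clone : Clone 𝒞} {X Y : OrderωPlusη}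
                   (PX : Presented 𝒞 clone X) (PY : Presented 𝒞 clone Y) where
    open Closure clone

    -- Sides are numbers so that the parity of a stage can select one inside the class. All positive
    -- numbers name `Y`, so a test for 0 settles every selection.
    S : ℕ → OrderωPlusη
    S zero = X
    S (suc _) = Y

    P : ∀ p → Presented 𝒞 clone (S p)
    P zero = PX
    P (suc _) = PY

    module A (p : ℕ) = Side (P p)

    -- Stating facts for opposite sides proves both directions of the back-and-forth at once.
    data Opp : ℕ → ℕ → Set where
      xy : Opp 0 1
      yx : Opp 1 0

    opp-sym : ∀ {p p'} → Opp p p' → Opp p' p
    opp-sym xy = yx
    opp-sym yx = xy

    opp-flip : ∀ {p p'} → Opp p p' → 1 ∸ p ≡ p'
    opp-flip xy = refl
    opp-flip yx = refl

    opp-par : ∀ k → Opp (par k) (1 ∸ par k)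
    opp-par k with par k | par-cases k
    ... | .0 | inj₁ refl = xy
    ... | .1 | inj₂ refl = yx

    par-opp : ∀ {p p'} → Opp p p' → ∀ i → par i ≡ p ⊎ par i ≡ p'
    par-opp xy i = par-cases i
    par-opp yx i = [ inj₂ , inj₁ ]′ (par-cases i)

    opp≢ : ∀ {p p'} → Opp p p' → p ≢ p'
    opp≢ xy ()
    opp≢ yx ()

    fnSel : (f : ℕ → ℕ → ℕ) → Fn1 (f 0) → Fn1 (f 1) → (∀ k x → f (suc k) x ≡ f 1 x) → Fn2 f
    fnSel f a b e = fn2 (ext (λ ρ → go (lookup ρ fz) (lookup ρ (fs fz)))
                             (iteᶜ (v0 ≡ᵣ zeroᶜ) (ap1 a v1) (ap1 b v1)))
      where
      go : ∀ p x → ite (p ≡ 0) (f 0 x) (f 1 x) ≡ f p x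
      go zero x = ite-yes refl
      go (suc p) x = trans (ite-no (λ ())) (sym (e p x))

    relSel2 : (R : ℕ → ℕ → Set) → Rel1 (R 0) → Rel1 (R 1) → (∀ k x → R (suc k) x ≡ R 1 x) → Rel2 R
    relSel2 R a b e = rel2 (rext (λ ρ → f (lookup ρ fz) (lookup ρ (fs fz))) (λ ρ → g (lookup ρ fz) (lookup ρ (fs fz)))
                       (((v0 ≡ᵣ zeroᶜ) ∧ᵣ rap1 a v1) ∨ᵣ (¬ᵣ (v0 ≡ᵣ zeroᶜ) ∧ᵣ rap1 b v1)))
      where
      f : ∀ p x → ((p ≡ 0) × R 0 x) ⊎ ((p ≢ 0) × R 1 x) → R p x
      f zero x (inj₁ (_ , r)) = r
      f zero x (inj₂ (h , _)) = ⊥-elim (h refl)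
      f (suc p) x (inj₂ (_ , r)) = subst (λ z → z) (sym (e p x)) r
      g : ∀ p x → R p x → ((p ≡ 0) × R 0 x) ⊎ ((p ≢ 0) × R 1 x)
      g zero x r = inj₁ (refl , r)
      g (suc p) x r = inj₂ ((λ ()) , subst (λ z → z) (e p x) r)

    relSel3 : (R : ℕ → ℕ → ℕ → Set) → Rel2 (R 0) → Rel2 (R 1) → (∀ k x y → R (suc k) x y ≡ R 1 x y) → Rel3 R
    relSel3 R a b e = rel3 (rext (λ ρ → f (lookup ρ fz) (lookup ρ (fs fz)) (lookup ρ (fs (fs fz))))
                                 (λ ρ → g (lookup ρ fz) (lookup ρ (fs fz)) (lookup ρ (fs (fs fz))))
                       (((v0 ≡ᵣ zeroᶜ) ∧ᵣ rap2 a v1 v2) ∨ᵣ (¬ᵣ (v0 ≡ᵣ zeroᶜ) ∧ᵣ rap2 b v1 v2)))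
      where
      f : ∀ p x y → ((p ≡ 0) × R 0 x y) ⊎ ((p ≢ 0) × R 1 x y) → R p x y
      f zero x y (inj₁ (_ , r)) = r
      f zero x y (inj₂ (h , _)) = ⊥-elim (h refl)
      f (suc p) x y (inj₂ (_ , r)) = subst (λ z → z) (sym (e p x y)) r
      g : ∀ p x y → R p x y → ((p ≡ 0) × R 0 x y) ⊎ ((p ≢ 0) × R 1 x y)
      g zero x y r = inj₁ (refl , r)
      g (suc p) x y r = inj₂ ((λ ()) , subst (λ z → z) (e p x y) r)

    O-sel : Rel3 (λ p x y → A.O p x y)
    O-sel = relSel3 _ (Presented.O-rel PX) (Presented.O-rel PY) (λ _ _ _ → refl)

    W-sel : Rel2 (λ p x → A.W p x)
    W-sel = relSel2 _ (Presented.W-rel PX) (Presented.W-rel PY) (λ _ _ → refl)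

    H-sel : Rel2 (λ p x → A.H p x)
    H-sel = relSel2 _ (Presented.H-rel PX) (Presented.H-rel PY) (λ _ _ → refl)

    elt-sel : Fn2 (λ p x → A.elt p x)
    elt-sel = fnSel _ (A.elt-fn 0) (A.elt-fn 1) (λ _ _ → refl)

    enum-sel : Fn2 (λ p x → A.enum p x)
    enum-sel = fnSel _ (A.enum-fn 0) (A.enum-fn 1) (λ _ _ → refl)

    rank-sel : Fn2 (λ p x → A.rank p x)
    rank-sel = fnSel _ (A.rank-fn 0) (A.rank-fn 1) (λ _ _ → refl)

    -- Stage k = 2x + p takes care of the element x of side p; z k is its partner on the other side.
    -- val z p i is the component on side p of the i-th pair.
    opaque
      val : (ℕ → ℕ) → ℕ → ℕ → ℕ
      val z p i = ite (par i ≡ p) (A.elt p (half i)) (z i)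

    opaque
      unfolding val
      val-same : ∀ z {p i} → par i ≡ p → val z p i ≡ A.elt p (half i)
      val-same z e = ite-yes e

      val-other : ∀ z {p p' i} → Opp p p' → par i ≡ p → val z p' i ≡ z i
      val-other z op e = ite-no λ e' → opp≢ op (trans (sym e) e')

      val-cong : ∀ {z z'} p i → z i ≡ z' i → val z p i ≡ val z' p i
      val-cong p i e = cong (ite (par i ≡ p) (A.elt p (half i))) e

    FitsAt : ℕ → ℕ → ℕ → ℕ → ℕ → ℕ → Set
    FitsAt p p' e y a b = (A.O p a e ⟺ A.O p' b y) × (A.O p e a ⟺ A.O p' y b)

    Good′ : (ℕ → ℕ) → ℕ → ℕ → ℕ → ℕ → Set
    Good′ z k p p' y = A.H p' y × (∀ i → i < k → FitsAt p p' (A.elt p (half k)) y (val z p i) (val z p' i))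

    Good : (ℕ → ℕ) → ℕ → ℕ → Set
    Good z k y = Good′ z k (par k) (1 ∸ par k) y

    -- Dominates both components of the first `k` pairs. In each step the summand `k` pays for the
    -- element being treated, the values of `near` for its partner.
    height : ℕ → ℕ
    height = natrec (A.q₀ 0 + A.q₀ 1) (λ k a → a + (k + (A.near 0 a + A.near 1 a)))

    opaque
      step : ℕ → ℕ → ℕ
      step k c = μ (λ y → Good (λ i → seq c (k ∸ suc i)) k y) (height (suc k))

      -- hist k codes the sequence of the earlier partners, the latest first.
      hist : ℕ → ℕ
      hist = natrec 0 (λ k a → pair (step k a) a)

      partner : ℕ → ℕ
      partner k = step k (hist k)

      partner-sat : ∀ k {y} → y ≤ height (suc k) → Good (λ i → seq (hist k) (k ∸ suc i)) k y →
                    Good (λ i → seq (hist k) (k ∸ suc i)) k (partner k)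
      partner-sat k = μ-sat (λ y → Good (λ i → seq (hist k) (k ∸ suc i)) k y)

      partner-≤ : ∀ k → partner k ≤ height (suc k)
      partner-≤ k = μ-≤ (λ y → Good (λ i → seq (hist k) (k ∸ suc i)) k y) (height (suc k))

    iso : ℕ → ℕ → ℕ
    iso p x = ite (A.W p x) (A.enum (1 ∸ p) (A.rank p x)) (partner (x + x + p))

    height-fn : Fn1 height
    height-fn = fn1 (natrecᶜ (const (A.q₀ 0 + A.q₀ 1)) (v1 +ᶜ (v0 +ᶜ (ap1 (A.near-fn 0) v1 +ᶜ ap1 (A.near-fn 1) v1))) v0)

    _⇔ᵣ_ : ∀ {n} {P Q : Vec ℕ n → Set} → Rec P → Rec Q → Rec (λ ρ → P ρ ⟺ Q ρ)
    p ⇔ᵣ q = (p ⇒ᵣ q) ∧ᵣ (q ⇒ᵣ p)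

    opaque
      unfolding val
      valᶜ : ∀ {n} (z : Vec ℕ n → ℕ → ℕ) {p i : Vec ℕ n → ℕ} → 𝒞 n (λ ρ → z ρ (i ρ)) → 𝒞 n p → 𝒞 n i →
             𝒞 n (λ ρ → val (z ρ) (p ρ) (i ρ))
      valᶜ z q p i = iteᶜ (ap1 par-fn i ≡ᵣ p) (ap2 elt-sel p (ap1 half-fn i)) q

    opaque
      unfolding step hist partner
      step-fn : Fn2 step
      step-fn =
        let p = ap1 par-fn (v2 {1})
            p' = const 1 ∸ᶜ p
            e = ap2 elt-sel p (ap1 half-fn v2)
            z = λ (ρ : Vec ℕ 4) i → seq (lookup ρ (fs (fs (fs fz)))) (lookup ρ (fs (fs fz)) ∸ suc i)
            zi = ap2 seq-fn v3 (v2 ∸ᶜ succᶜ v0)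
            va = valᶜ z zi p v0
            vb = valᶜ z zi p' v0
        in fn2 (μᶜ
          (rap2 H-sel (const 1 ∸ᶜ ap1 par-fn v1) v0 ∧ᵣ
           ∀ᵣ v1 ((rap3 O-sel p va e ⇔ᵣ rap3 O-sel p' vb v1) ∧ᵣ (rap3 O-sel p e va ⇔ᵣ rap3 O-sel p' v1 vb)))
          (ap1 height-fn (succᶜ v0)))

      hist-fn : Fn1 hist
      hist-fn = fn1 (natrecᶜ zeroᶜ (ap2 pair-fn (ap2 step-fn v0 v1) v1) v0)

      partner-fn : Fn1 partner
      partner-fn = fn1 (ap2 step-fn v0 (ap1 hist-fn v0))

    iso-fn : ∀ p → Fn1 (iso p)
    iso-fn p = fn1 (iteᶜ (rap2 W-sel (const p) v0) (ap2 enum-sel (const (1 ∸ p)) (ap2 rank-sel (const p) v0))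
                         (ap1 partner-fn (v0 +ᶜ v0 +ᶜ const p)))

    opaque
      unfolding step hist partner
      hist-suc : ∀ k → hist (suc k) ≡ pair (partner k) (hist k)
      hist-suc k = refl

    hist-seq : ∀ k i → i < k → seq (hist k) (k ∸ suc i) ≡ partner i
    hist-seq (suc k) i lt rewrite hist-suc k with m≤n⇒m<n∨m≡n lt
    ... | inj₂ refl = trans (cong (seq (pair (partner k) (hist k))) (n∸n≡0 k)) (seq-pair0 (partner k) (hist k))
    ... | inj₁ (s≤s l) = trans (cong (seq (pair (partner k) (hist k))) (+-∸-assoc 1 l))
                           (trans (seq-pairS (partner k) (hist k) (k ∸ suc i)) (hist-seq k i l))

    height-mono : ∀ {i k} → i ≤ k → height i ≤ height k
    height-mono {zero} {zero} z≤n = ≤-refl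
    height-mono {i} {suc k} le with m≤n⇒m<n∨m≡n le
    ... | inj₁ (s≤s l) = ≤-trans (height-mono l) (m≤m+n _ _)
    ... | inj₂ refl = ≤-refl

    q≤height : ∀ {p p'} → Opp p p' → ∀ k → A.q₀ p ≤ height k
    q≤height xy k = ≤-trans (m≤m+n _ _) (height-mono {0} {k} z≤n)
    q≤height yx k = ≤-trans (m≤n+m _ (A.q₀ 0)) (height-mono {0} {k} z≤n)

    near≤height : ∀ {p p'} → Opp p p' → ∀ k → height k + A.near p (height k) ≤ height (suc k)
    near≤height xy k = +-monoʳ-≤ (height k) (≤-trans (m≤m+n _ _) (m≤n+m _ k))
    near≤height yx k = +-monoʳ-≤ (height k) (≤-trans (m≤n+m _ (A.near 0 (height k))) (m≤n+m _ k))

    half≤ : ∀ i → half i ≤ i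
    half≤ i = ≤-trans (≤-trans (m≤m+n (half i) (half i)) (m≤m+n _ (par i))) (≤-reflexive (half-par i))

    elt≤height : ∀ {p p'} → Opp p p' → ∀ i → A.elt p (half i) ≤ height (suc i)
    elt≤height {p} op i = ≤-trans (A.elt≤ p (half i)) (≤-trans (≤-reflexive (+-comm _ (A.q₀ p)))
      (+-mono-≤ (q≤height op i) (≤-trans (half≤ i) (m≤m+n i _))))

    good-cong : ∀ {z z' k y} → (∀ i → i < k → z i ≡ z' i) → Good z k y → Good z' k y
    good-cong {z} {z'} {k} {y} eq (h , f) = h , λ i lt →
      subst₂ (FitsAt (par k) (1 ∸ par k) (A.elt (par k) (half k)) y)
        (val-cong (par k) i (eq i lt)) (val-cong (1 ∸ par k) i (eq i lt)) (f i lt)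

    v : ℕ → ℕ → ℕ
    v = val partner

    GoodUpTo : ℕ → Set
    GoodUpTo k = ∀ i → i < k → Good partner i (partner i) × partner i ≤ height (suc i)

    good-at : ∀ {p p'} → Opp p p' → ∀ i → par i ≡ p → Good partner i (partner i) →
              A.H p' (v p' i) × (∀ j → j < i → FitsAt p p' (v p i) (v p' i) (v p j) (v p' j))
    good-at {p} {p'} op i refl g with opp-flip op
    ... | refl = subst (A.H p') (sym eq') (proj₁ g)
          , λ j lt → subst₂ (λ e y → FitsAt p p' e y (v p j) (v p' j)) (sym eq) (sym eq') (proj₂ g j lt)
      where
      eq : v p i ≡ A.elt p (half i)
      eq = val-same partner {p} refl
      eq' : v p' i ≡ partner i
      eq' = val-other partner op refl

    module UpTo {k} (G : GoodUpTo k) where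
      v-H : ∀ {p p'} → Opp p p' → ∀ i → i < k → A.H p (v p i)
      v-H {p} op i lt with par-opp op i
      ... | inj₁ e = subst (A.H p) (sym (val-same partner e)) (A.H-elt p (half i))
      ... | inj₂ e = proj₁ (good-at (opp-sym op) i e (proj₁ (G i lt)))

      v-≤ : ∀ {p p'} → Opp p p' → ∀ i → i < k → v p i ≤ height k
      v-≤ {p} op i lt with par-opp op i
      ... | inj₁ e = ≤-trans (≤-reflexive (val-same partner e)) (≤-trans (elt≤height op i) (height-mono lt))
      ... | inj₂ e = ≤-trans (≤-reflexive (val-other partner (opp-sym op) e)) (≤-trans (proj₂ (G i lt)) (height-mono lt))

      v-O : ∀ {p p'} → Opp p p' → ∀ i j → i < k → j < k → A.O p (v p i) (v p j) → A.O p' (v p' i) (v p' j)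
      v-O {p} {p'} op i j i< j< o with <-cmp i j
      ... | tri≈ _ refl _ = ⊥-elim (A.irr p o)
      ... | tri< lt _ _ with par-opp op j
      ...   | inj₁ e = proj₁ (proj₁ (proj₂ (good-at op j e (proj₁ (G j j<))) i lt)) o
      ...   | inj₂ e = proj₂ (proj₁ (proj₂ (good-at (opp-sym op) j e (proj₁ (G j j<))) i lt)) o
      v-O {p} {p'} op i j i< j< o | tri> _ _ gt with par-opp op i
      ...   | inj₁ e = proj₁ (proj₂ (proj₂ (good-at op i e (proj₁ (G i i<))) j gt)) o
      ...   | inj₂ e = proj₂ (proj₂ (proj₂ (good-at (opp-sym op) i e (proj₁ (G i i<))) j gt)) o

      -- The extension lemma gives a suitable partner below `height (suc k)`, so the bounded search
      -- finds one; `good-cong` passes between the partners and their coded history.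
      next-good : Good partner k (partner k) × partner k ≤ height (suc k)
      next-good = from-hist (extend-by (opp-par k)) , partner-≤ k
        where
        extend-by : ∀ {p p'} → Opp p p' → ∃ λ y → y ≤ height (suc k) × Good′ partner k p p' y
        extend-by {p} {p'} op with Extend.extend (P p) (P p') k (v p) (v p') (A.elt p (half k)) (height k)
          (v-H op) (v-H (opp-sym op)) (v-≤ (opp-sym op)) (v-O op) (v-O (opp-sym op))
          (A.H-elt p (half k)) (q≤height (opp-sym op) k)
        ... | y , le , h , f = y , ≤-trans le (near≤height (opp-sym op) k) , h , f
        from-hist : (∃ λ y → y ≤ height (suc k) × Good partner k y) → Good partner k (partner k)
        from-hist (y , le , g) = good-cong (hist-seq k)
          (partner-sat k le
            (good-cong (λ i lt → sym (hist-seq k i lt)) g))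

    good-upto : ∀ k → GoodUpTo k
    good-upto (suc k) i lt with m≤n⇒m<n∨m≡n lt
    ... | inj₁ (s≤s l) = good-upto k i l
    ... | inj₂ refl = UpTo.next-good (good-upto k)

    vH : ∀ {p p'} → Opp p p' → ∀ i → A.H p (v p i)
    vH op i = UpTo.v-H (good-upto (suc i)) op i ≤-refl

    vO : ∀ {p p'} → Opp p p' → ∀ i j → A.O p (v p i) (v p j) → A.O p' (v p' i) (v p' j)
    vO op i j = UpTo.v-O (good-upto (suc (i + j))) op i j (s≤s (m≤m+n i j)) (s≤s (m≤n+m j i))

    -- Makes the result independent of the stage: an element treated several times always has the
    -- same partner.
    v-inj : ∀ {p p'} → Opp p p' → ∀ i j → v p i ≡ v p j → v p' i ≡ v p' j
    v-inj {p} {p'} op i j e with A.hull p' (vH (opp-sym op) i) (vH (opp-sym op) j)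
    ... | inj₁ eq = eq
    ... | inj₂ (inj₁ o) = ⊥-elim (A.irr p (subst (A.O p (v p i)) (sym e) (vO (opp-sym op) i j o)))
    ... | inj₂ (inj₂ o) = ⊥-elim (A.irr p (subst (A.O p (v p j)) e (vO (opp-sym op) j i o)))

    stage : ℕ → ℕ → ℕ
    stage p x = x + x + p

    stage-par : ∀ {p p'} → Opp p p' → ∀ x → par (stage p x) ≡ p
    stage-par xy x = trans (cong par (+-identityʳ (x + x))) (par-dbl x)
    stage-par yx x = trans (cong par (+-comm (x + x) 1)) (par-dbl1 x)

    stage-half : ∀ {p p'} → Opp p p' → ∀ x → half (stage p x) ≡ x
    stage-half xy x = trans (cong half (+-identityʳ (x + x))) (half-dbl x)
    stage-half yx x = trans (cong half (+-comm (x + x) 1)) (half-dbl1 x)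

    stage-v : ∀ {p p'} → Opp p p' → ∀ {x} → A.H p x → v p (stage p x) ≡ x
    stage-v {p} op {x} h = trans (val-same partner (stage-par op x))
      (trans (cong (A.elt p) (stage-half op x)) (ite-yes h))

    iso-W : ∀ {p p'} → Opp p p' → ∀ {x} → A.W p x → iso p x ≡ A.enum p' (A.rank p x)
    iso-W {p} op {x} w = trans (ite-yes w) (cong (λ q → A.enum q (A.rank p x)) (opp-flip op))

    iso-H : ∀ {p p'} → Opp p p' → ∀ {x} → A.H p x → iso p x ≡ v p' (stage p x)
    iso-H {p} op {x} h = trans (ite-no λ w → A.disj p w h) (sym (val-other partner op (stage-par op x)))

    iso-pres-W : ∀ {p p'} → Opp p p' → ∀ {x} → A.W p x → A.W p' (iso p x)
    iso-pres-W {p} {p'} op {x} w = subst (A.W p') (sym (iso-W op w)) (A.W-enum p' (A.rank p x))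

    iso-pres-H : ∀ {p p'} → Opp p p' → ∀ {x} → A.H p x → A.H p' (iso p x)
    iso-pres-H {p} {p'} op {x} h = subst (A.H p') (sym (iso-H op h)) (vH (opp-sym op) _)

    iso-inv : ∀ {p p'} → Opp p p' → ∀ {x} → A.W p x ⊎ A.H p x → iso p' (iso p x) ≡ x
    iso-inv {p} {p'} op {x} (inj₁ w) = trans (iso-W (opp-sym op) (iso-pres-W op w))
      (trans (cong (λ y → A.enum p (A.rank p' y)) (iso-W op w))
        (trans (cong (A.enum p) (A.rank-enum p' (A.rank p x))) (A.enum-rank p w)))
    -- The stage of `iso p x` on side `p'` and the stage of `x` on side `p` have the same component
    -- on side `p'`, hence also on side `p`.
    iso-inv {p} {p'} op {x} (inj₂ h) = trans (iso-H (opp-sym op) (iso-pres-H op h))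
      (trans (v-inj (opp-sym op) _ (stage p x) (trans (stage-v (opp-sym op) (iso-pres-H op h)) (iso-H op h)))
        (stage-v op h))

    iso-O : ∀ {p p'} → Opp p p' → ∀ {x y} → A.W p x ⊎ A.H p x → A.W p y ⊎ A.H p y →
            A.O p x y → A.O p' (iso p x) (iso p y)
    iso-O {p} {p'} op {x} {y} (inj₁ w) (inj₁ w') o =
      subst₂ (A.O p') (sym (iso-W op w)) (sym (iso-W op w')) (A.enum-mono p' {A.rank p x} {A.rank p y} (A.enum-reflect p {A.rank p x} {A.rank p y}
        (subst₂ (A.O p) (sym (A.enum-rank p w)) (sym (A.enum-rank p w')) o)))
    iso-O {p} {p'} op (inj₁ w) (inj₂ h) o = A.W<H p' (iso-pres-W op w) (iso-pres-H op h)
    iso-O {p} {p'} op (inj₂ h) (inj₁ w) o = ⊥-elim (A.asym< p o (A.W<H p w h))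
    iso-O {p} {p'} op {x} {y} (inj₂ h) (inj₂ h') o =
      subst₂ (A.O p') (sym (iso-H op h)) (sym (iso-H op h'))
        (vO op (stage p x) (stage p y) (subst₂ (A.O p) (sym (stage-v op h)) (sym (stage-v op h')) o))

    isoOn : ∀ {p p'} → Opp p p' → IsoOn (S p) (S p') (iso p) (iso p')
    isoOn op = record { f-W = iso-pres-W op ; f-H = iso-pres-H op ; gf = iso-inv op ; f-O = iso-O op }

    isomorphism : ∃ λ f → ∃ λ g → Fn1 f × Fn1 g × IsoOn X Y f g × IsoOn Y X g f
    isomorphism = iso 0 , iso 1 , iso-fn 0 , iso-fn 1 , isoOn xy , isoOn yx

-- Copies of ω + η and their classical isomorphisms.

module Copies (lem : Classical) where
  open BackAndForth lem public

  Point : Set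
  Point = ℕ ⊎ Q.ℚ

  <ωη-irr : ∀ {u} → ¬ (u <ωη u)
  <ωη-irr {inj₁ m} = <-irrefl refl
  <ωη-irr {inj₂ q} = Q.<-irrefl refl

  <ωη-trans : ∀ {u v w} → u <ωη v → v <ωη w → u <ωη w
  <ωη-trans {inj₁ _} {inj₁ _} {inj₁ _} p q = <-trans p q
  <ωη-trans {inj₁ _} {inj₁ _} {inj₂ _} p q = tt
  <ωη-trans {inj₁ _} {inj₂ _} {inj₂ _} p q = tt
  <ωη-trans {inj₂ _} {inj₂ _} {inj₂ _} p q = Q.<-trans p q

  <ωη-tri : ∀ u v → u ≡ v ⊎ (u <ωη v ⊎ v <ωη u)
  <ωη-tri (inj₁ m) (inj₁ n) with <-cmp m n
  ... | tri< lt _ _ = inj₂ (inj₁ lt)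
  ... | tri≈ _ e _ = inj₁ (cong inj₁ e)
  ... | tri> _ _ gt = inj₂ (inj₂ gt)
  <ωη-tri (inj₁ m) (inj₂ q) = inj₂ (inj₁ tt)
  <ωη-tri (inj₂ p) (inj₁ n) = inj₂ (inj₂ tt)
  <ωη-tri (inj₂ p) (inj₂ q) with Q.<-cmp p q
  ... | tri< lt _ _ = inj₂ (inj₁ lt)
  ... | tri≈ _ e _ = inj₁ (cong inj₂ e)
  ... | tri> _ _ gt = inj₂ (inj₂ gt)

  q<q+1 : ∀ q → q Q.< q Q.+ Q.1ℚ
  q<q+1 q = subst (Q._< q Q.+ Q.1ℚ) (Q.+-identityʳ q) (Q.+-monoʳ-< q (Q.positive⁻¹ Q.1ℚ))

  q-1<q : ∀ q → q Q.+ (Q.- Q.1ℚ) Q.< q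
  q-1<q q = subst (q Q.+ (Q.- Q.1ℚ) Q.<_) (Q.+-identityʳ q) (Q.+-monoʳ-< q (Q.negative⁻¹ (Q.- Q.1ℚ)))

  -- Used with the inverse of a given isomorphism, and with an explicit numbering of the points that
  -- is not onto.
  module Coded (enc : Point → ℕ) (enc-inj : ∀ {u v} → enc u ≡ enc v → u ≡ v) where

    O : ℕ → ℕ → Set
    W H : ℕ → Set
    O x y = Σ Point λ u → Σ Point λ v → enc u ≡ x × enc v ≡ y × u <ωη v
    W x = ∃ λ n → enc (inj₁ n) ≡ x
    H x = Σ Q.ℚ λ q → enc (inj₂ q) ≡ x

    point : ∀ {x} → W x ⊎ H x → Σ Point λ u → enc u ≡ x
    point (inj₁ (n , e)) = inj₁ n , e
    point (inj₂ (q , e)) = inj₂ q , e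

    O-enc : ∀ {u v} → O (enc u) (enc v) → u <ωη v
    O-enc {u} {v} (u' , v' , e , e' , l) = subst₂ _<ωη_ (enc-inj e) (enc-inj e') l

    enc-O : ∀ {u v} → u <ωη v → O (enc u) (enc v)
    enc-O {u} {v} l = u , v , refl , refl , l

    order : OrderωPlusη
    order = record
      { O = O ; W = W ; H = H
      ; irr = λ { (u , v , refl , e , l) → <ωη-irr {u} (subst (u <ωη_) (enc-inj e) l) }
      ; trans< = λ { (u , v , e , refl , l) (v' , w , e' , e'' , l') →
          u , w , e , e'' , <ωη-trans {u} {v} {w} l (subst (_<ωη w) (enc-inj e') l') }
      ; tri = tri′
      ; disj = λ { (n , refl) (q , e) → case-absurd (enc-inj e) }
      ; W<H = λ { (n , refl) (q , refl) → enc-O {inj₁ n} {inj₂ q} tt }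
      ; W-down = λ { (u , v , refl , e , l) (n , refl) → down u v (enc-inj e) l }
      ; H-up = λ { (u , v , e , refl , l) (q , refl) → up u v (enc-inj e) l }
      ; e₀ = enc (inj₁ 0)
      ; W-e₀ = 0 , refl
      ; e₀-least = λ { (zero , e) → inj₁ (sym e) ; (suc n , refl) → inj₂ (enc-O {inj₁ 0} {inj₁ (suc n)} (s≤s z≤n)) }
      ; succ-ex = λ { (n , refl) → enc (inj₁ (suc n)) , (suc n , refl) , enc-O {inj₁ n} {inj₁ (suc n)} ≤-refl
          , λ { z (p , q) → between n p q } }
      -- The sum exceeds the code of every natural number below `n`.
      ; bound-ex = λ { (n , refl) → sum< (λ m → suc (enc (inj₁ m))) n , λ { y (inj₁ m , v , refl , e , l) → bnd m v n (enc-inj e) l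
                                     ; y (inj₂ q , v , refl , e , l) → ⊥-elim (nope q v n (enc-inj e) l) } }
      ; q₀ = enc (inj₂ Q.0ℚ)
      ; H-q₀ = Q.0ℚ , refl
      ; low-ex = λ { (q , refl) → enc (inj₂ (q Q.+ (Q.- Q.1ℚ))) , (_ , refl) , enc-O {inj₂ _} {inj₂ q} (q-1<q q) }
      ; up-ex = λ { (q , refl) → enc (inj₂ (q Q.+ Q.1ℚ)) , enc-O {inj₂ q} {inj₂ _} (q<q+1 q) }
      ; mid-ex = λ { (q , refl) (r , refl) o → mid q r (O-enc {inj₂ q} {inj₂ r} o) }
      }
      where
      case-absurd : ∀ {n : ℕ} {q : Q.ℚ} {A : Set} → inj₂ q ≡ inj₁ n → A
      case-absurd ()
      tri′ : ∀ {x y} → W x ⊎ H x → W y ⊎ H y → x ≡ y ⊎ (O x y ⊎ O y x)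
      tri′ gx gy with point gx | point gy
      ... | u , refl | v , refl with <ωη-tri u v
      ...   | inj₁ e = inj₁ (cong enc e)
      ...   | inj₂ (inj₁ l) = inj₂ (inj₁ (enc-O {u} {v} l))
      ...   | inj₂ (inj₂ l) = inj₂ (inj₂ (enc-O {v} {u} l))
      down : ∀ u v {n} → v ≡ inj₁ n → u <ωη v → W (enc u)
      down (inj₁ m) .(inj₁ _) refl l = m , refl
      up : ∀ u v {q} → u ≡ inj₂ q → u <ωη v → H (enc v)
      up .(inj₂ _) (inj₂ r) refl l = r , refl
      between : ∀ n {z} → O (enc (inj₁ n)) z → ¬ O z (enc (inj₁ (suc n)))
      between n (u , inj₁ m , e , refl , l) o with enc-inj {u} {inj₁ n} e
      ... | refl = <⇒≱ l (≤-pred (O-enc {inj₁ m} {inj₁ (suc n)} o))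
      between n (u , inj₂ q , e , refl , l) o = O-enc {inj₂ q} {inj₁ (suc n)} o
      bnd : ∀ m v n → v ≡ inj₁ n → inj₁ m <ωη v → enc (inj₁ m) < sum< (λ m → suc (enc (inj₁ m))) n
      bnd m .(inj₁ n) n refl l = term≤sum (λ m → suc (enc (inj₁ m))) l
      nope : ∀ q v n → v ≡ inj₁ n → ¬ (inj₂ q <ωη v)
      nope q .(inj₁ n) n refl ()
      mid : ∀ q r → q Q.< r → ∃ λ z → O (enc (inj₂ q)) z × O z (enc (inj₂ r))
      mid q r l with Q.<-dense l
      ... | s , a , b = enc (inj₂ s) , enc-O {inj₂ q} {inj₂ s} a , enc-O {inj₂ s} {inj₂ r} b

  pick : (R : ℕ → ℕ → Set) → ℕ → ℕ
  pick R x with lem (∃ (R x))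
  ... | yes (y , _) = y
  ... | no _ = 0

  pick-spec : (R : ℕ → ℕ → Set) {x : ℕ} → ∃ (R x) → R x (pick R x)
  pick-spec R {x} h with lem (∃ (R x))
  ... | yes (y , r) = r
  ... | no ¬h = ⊥-elim (¬h h)

  -- Excluded middle turns the existence axioms into functions, with value 0 where there is no
  -- witness.
  presented : (X : OrderωPlusη) → Presented Arbitrary arbitrary-clone X
  presented X = record
    { O-rel = rel2 (isRec arbitrary) ; W-rel = rel1 (isRec arbitrary) ; H-rel = rel1 (isRec arbitrary)
    ; next = pick Next ; bound = pick Bound ; low = pick Low ; up = pick O ; mid = λ x → pick (Mid x)
    ; next-fn = fn1 arbitrary ; bound-fn = fn1 arbitrary ; low-fn = fn1 arbitrary ; up-fn = fn1 arbitrary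
    ; mid-fn = fn2 arbitrary
    ; next-spec = λ w → pick-spec Next (succ-ex w) ; bound-spec = λ w → pick-spec Bound (bound-ex w)
    ; low-spec = λ h → pick-spec Low (low-ex h) ; up-spec = λ h → pick-spec O (up-ex h)
    ; mid-spec = λ {x} h k o → pick-spec (Mid x) (mid-ex h k o) }
    where
    open OrderωPlusη X
    open Closure arbitrary-clone
    Next Bound Low : ℕ → ℕ → Set
    Next x y = W y × O x y × (∀ z → ¬ (O x z × O z y))
    Bound x n = ∀ y → O y x → y < n
    Low x y = H y × O y x
    Mid : ℕ → ℕ → ℕ → Set
    Mid x y z = O x z × O z y

  -- All of the copy of ω lies below `x`. Points of the copy of ω have bounded predecessors, so
  -- membership in `H` becomes the Π⁰₂ condition that predecessors are unbounded.
  H-unbounded : (X : OrderωPlusη) → let open OrderωPlusη X in ∀ {x} → H x → ∀ b → ∃ λ c → b ≤ c × O c x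
  H-unbounded X {x} h b = by-contradiction λ k →
    unbounded enum (λ i j lt e → <⇒≢ lt (enum-inj e)) b
      λ i _ → ≰⇒> λ le → k (enum i , le , W<H (W-enum i) h)
    where open Side (presented X)

  isomorphic : ∀ X Y → ∃ λ f → ∃ λ g → IsoOn X Y f g × IsoOn Y X g f
  isomorphic X Y with TwoOrders.isomorphism (presented X) (presented Y)
  ... | f , g , _ , _ , i , j = f , g , i , j

  record Presents (A : Punctual) (X : OrderωPlusη) : Set where
    open OrderωPlusη X
    field
      O⟺ : ∀ x y → O x y ⟺ Rel A x y
      all : ∀ x → W x ⊎ H x

  iso-from : ∀ {A B X Y f g} → Presents A X → Presents B Y → IsoOn X Y f g → IsoOn Y X g f → Iso A B
  iso-from {A} {B} {X} {Y} {f} {g} PA PB i j = record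
    { f = f ; g = g
    ; gf = λ x → IsoOn.gf i (Presents.all PA x)
    ; fg = λ y → IsoOn.gf j (Presents.all PB y)
    ; pres = λ x y →
        (λ r → proj₁ (Presents.O⟺ PB _ _) (IsoOn.f-O i (Presents.all PA x) (Presents.all PA y) (proj₂ (Presents.O⟺ PA x y) r)))
      , (λ r → proj₁ (Presents.O⟺ PA x y) (subst₂ (OrderωPlusη.O X) (IsoOn.gf i (Presents.all PA x)) (IsoOn.gf i (Presents.all PA y))
          (IsoOn.f-O j (Presents.all PB _) (Presents.all PB _) (proj₂ (Presents.O⟺ PB _ _) r)))) }

  module _ {A : Punctual} (I : IsoωPlusη A) where
    open IsoωPlusη I

    private
      h⁻¹-inj : ∀ {u v} → h⁻¹ u ≡ h⁻¹ v → u ≡ v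
      h⁻¹-inj {u} {v} e = trans (sym (right u)) (trans (cong h e) (right v))

    orderOf : OrderωPlusη
    orderOf = Coded.order h⁻¹ h⁻¹-inj

    presents : Presents A orderOf
    presents = record
      { O⟺ = λ x y →
          (λ { (u , v , refl , refl , l) → proj₂ (pres _ _) (subst₂ _<ωη_ (sym (right u)) (sym (right v)) l) })
        , (λ r → h x , h y , left x , left y , proj₁ (pres x y) r)
      ; all = λ x → good x (h x) refl }
      where
      good : ∀ x u → h x ≡ u → OrderωPlusη.W orderOf x ⊎ OrderωPlusη.H orderOf x
      good x (inj₁ n) e = inj₁ (n , trans (cong h⁻¹ (sym e)) (left x))
      good x (inj₂ q) e = inj₂ (q , trans (cong h⁻¹ (sym e)) (left x))

  transfer : ∀ {A B} → IsoωPlusη A → Iso A B → IsoωPlusη B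
  transfer {A} {B} I i = record
    { h = λ y → I.h (i.g y) ; h⁻¹ = λ u → i.f (I.h⁻¹ u)
    ; left = λ y → trans (cong i.f (I.left _)) (i.fg y)
    ; right = λ u → trans (cong I.h (i.gf _)) (I.right u)
    ; pres = λ x y →
        (λ r → proj₁ (I.pres _ _) (proj₂ (i.pres _ _) (subst₂ (Rel B) (sym (i.fg x)) (sym (i.fg y)) r)))
      , (λ l → subst₂ (Rel B) (i.fg x) (i.fg y) (proj₁ (i.pres _ _) (proj₂ (I.pres _ _) l))) }
    where
    module I = IsoωPlusη I
    module i = Iso i

  Rel-rel : ∀ d (A : Punctual) → Closure.Rel2 (PRIn-clone d) (Rel A)
  Rel-rel d A = rel2 (ext (λ { (x ∷ y ∷ []) → refl }) (fromPR d (Punctual.χ A)) ≡ᵣ const 1)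
    where open Closure (PRIn-clone d)

-- The inclusion (⊇): Δ⁰₃ functions that present a punctual copy.

module ConeBound (lem : Classical) where
  open Copies lem public

  module Z = Closure (PRIn-clone zeroOracle)

  opaque
    -- In the normal form truth is the value 0, so the program is the characteristic function of the
    -- negation.
    matrix : {P : ℕ → ℕ → ℕ → ℕ → ℕ → Set} →
             Z.Rec {5} (λ ρ → P (lookup ρ fz) (lookup ρ (fs fz)) (lookup ρ (fs (fs fz)))
                                (lookup ρ (fs (fs (fs fz)))) (lookup ρ (fs (fs (fs (fs fz)))))) →
             Σ (PR 5) λ t → ∀ a b c x y → P a b c x y ⟺ (eval zeroOracle t (a ∷ b ∷ c ∷ x ∷ y ∷ []) ≡ 0)
    matrix {P} p = PRIn.prog (Z.char q) , λ a b c x y →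
        (λ z → trans (PRIn.correct (Z.char q) _) (𝟙-no λ k → k z))
      , (λ e → by-contradiction λ k → 0≢1 (trans (sym e) (trans (PRIn.correct (Z.char q) _) (𝟙-yes k))))
      where
      q : Z.Rec {5} (λ ρ → ¬ P (lookup ρ fz) (lookup ρ (fs fz)) (lookup ρ (fs (fs fz)))
                               (lookup ρ (fs (fs (fs fz)))) (lookup ρ (fs (fs (fs (fs fz))))))
      q = Z.¬ᵣ p
      0≢1 : 0 ≢ 1
      0≢1 ()

  module LeastΠ₂ (T : ℕ → ℕ → ℕ → ℕ → Set) (T-rel : Z.Rel4 T)
                 (antitone : ∀ x p c {b b'} → b' ≤ b → T x p b c → T x p b' c)
                 (total : ∀ x → ∃ λ p → ∀ b → ∃ λ c → T x p b c) where

    R : ℕ → ℕ → Set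
    R x p = ∀ b → ∃ λ c → T x p b c

    opaque
      F : ℕ → ℕ
      F x = proj₁ (least (total x))

      F-sat : ∀ x → R x (F x)
      F-sat x = proj₁ (proj₂ (least (total x)))

      F-min : ∀ x p → p < F x → ¬ R x p
      F-min x = proj₂ (proj₂ (least (total x)))

    F-unique : ∀ {x y} → R x y → (∀ p → p < y → ¬ R x p) → F x ≡ y
    F-unique {x} {y} r m with <-cmp (F x) y
    ... | tri< lt _ _ = ⊥-elim (m (F x) lt (F-sat x))
    ... | tri≈ _ e _ = e
    ... | tri> _ _ gt = ⊥-elim (F-min x y gt r)

    -- Each smaller `p` fails at some level; antitonicity lets one level serve them all.
    refute : ∀ x → ∃ λ a → ∀ p → p < F x → ∀ c → ¬ T x p a c
    refute x = collect (λ {p} le h c t → h c (antitone x p c le t)) (F x) λ p lt →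
      let b , nb = ¬∀⇒∃¬ (F-min x p lt) in b , λ c t → nb (c , t)

    -- The quantifiers are shared. In `ΣMatrix` the variable `b` is the level at which `y` needs a
    -- witness and also the would-be witness denied to smaller `p`. In `ΠMatrix` it bounds the
    -- witness for `y` and is also the level refuting smaller `p`, so it may be enlarged at will by
    -- antitonicity.
    ΣMatrix ΠMatrix : ℕ → ℕ → ℕ → ℕ → ℕ → Set
    ΣMatrix a b c x y = T x y b c × (∀ p → p < y → ¬ T x p a b)
    ΠMatrix a b c x y = (∃ λ c' → c' < b × T x y a c') × (∀ p → p < y → ¬ T x p b c)

    opaque
      Σ-program : Σ (PR 5) λ t → ∀ a b c x y → ΣMatrix a b c x y ⟺ (eval zeroOracle t (a ∷ b ∷ c ∷ x ∷ y ∷ []) ≡ 0)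
      Σ-program = matrix {ΣMatrix} (Z.rap4 T-rel Z.v3 Z.v4 Z.v1 Z.v2 Z.∧ᵣ Z.∀ᵣ Z.v4 (Z.¬ᵣ (Z.rap4 T-rel Z.v4 Z.v0 Z.v1 Z.v2)))

      Π-program : Σ (PR 5) λ t → ∀ a b c x y → ΠMatrix a b c x y ⟺ (eval zeroOracle t (a ∷ b ∷ c ∷ x ∷ y ∷ []) ≡ 0)
      Π-program = matrix {ΠMatrix} (Z.∃ᵣ Z.v1 (Z.rap4 T-rel Z.v4 Z.v5 Z.v1 Z.v0)
                                    Z.∧ᵣ Z.∀ᵣ Z.v4 (Z.¬ᵣ (Z.rap4 T-rel Z.v4 Z.v0 Z.v2 Z.v3)))

    graph-Σ : ∀ x y → (F x ≡ y) ⟺ (∃ λ a → ∀ b → ∃ λ c → ΣMatrix a b c x y)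
    graph-Σ x y = to , from
      where
      to : F x ≡ y → ∃ λ a → ∀ b → ∃ λ c → ΣMatrix a b c x y
      to refl with refute x
      ... | a , h = a , λ b → proj₁ (F-sat x b) , proj₂ (F-sat x b) , λ p lt → h p lt b
      from : (∃ λ a → ∀ b → ∃ λ c → ΣMatrix a b c x y) → F x ≡ y
      from (a , h) = F-unique (λ b → proj₁ (h b) , proj₁ (proj₂ (h b)))
        (λ p lt r → proj₂ (proj₂ (h (proj₁ (r a)))) p lt (proj₂ (r a)))

    graph-Π : ∀ x y → (F x ≡ y) ⟺ (∀ a → ∃ λ b → ∀ c → ΠMatrix a b c x y)
    graph-Π x y = to , from
      where
      to : F x ≡ y → ∀ a → ∃ λ b → ∀ c → ΠMatrix a b c x y
      to refl a with F-sat x a | refute x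
      ... | c' , s | a' , h = suc c' + a' , λ c → (c' , s≤s (m≤m+n c' a') , s)
                              , λ p lt s' → h p lt c (antitone x p c (m≤n+m a' (suc c')) s')
      from : (∀ a → ∃ λ b → ∀ c → ΠMatrix a b c x y) → F x ≡ y
      from h = F-unique (λ a → let k = proj₁ (proj₂ (h a) 0) in proj₁ k , proj₂ (proj₂ k))
        (λ p lt r → proj₂ (proj₂ (h 0) (proj₁ (r (proj₁ (h 0))))) p lt (proj₂ (r (proj₁ (h 0)))))

    opaque
      graph-Σ⁰₃ : Σ⁰₃ (λ x y → F x ≡ y)
      graph-Σ⁰₃ = fromProgram Σ-program
        where
        fromProgram : Σ (PR 5) (λ t → ∀ a b c x y → ΣMatrix a b c x y ⟺ (eval zeroOracle t (a ∷ b ∷ c ∷ x ∷ y ∷ []) ≡ 0)) →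
                      Σ⁰₃ (λ x y → F x ≡ y)
        fromProgram (t , spec) = t , λ x y →
            (λ e → let a , h = proj₁ (graph-Σ x y) e in a , λ b → proj₁ (h b) , proj₁ (spec a b _ x y) (proj₂ (h b)))
          , (λ (a , h) → proj₂ (graph-Σ x y) (a , λ b → proj₁ (h b) , proj₂ (spec a b _ x y) (proj₂ (h b))))

      graph-Π⁰₃ : Π⁰₃ (λ x y → F x ≡ y)
      graph-Π⁰₃ = fromProgram Π-program
        where
        fromProgram : Σ (PR 5) (λ t → ∀ a b c x y → ΠMatrix a b c x y ⟺ (eval zeroOracle t (a ∷ b ∷ c ∷ x ∷ y ∷ []) ≡ 0)) →
                      Π⁰₃ (λ x y → F x ≡ y)
        fromProgram (t , spec) = t , λ x y →
            (λ e a → proj₁ (proj₁ (graph-Π x y) e a) , λ c → proj₁ (spec a _ c x y) (proj₂ (proj₁ (graph-Π x y) e a) c))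
          , (λ h → proj₂ (graph-Π x y) λ a → proj₁ (h a) , λ c → proj₂ (spec a _ c x y) (proj₂ (h a) c))

      F-below-cone : ∀ {d} → Cone-Δ⁰₃ d → Closure.Fn1 (PRIn-clone d) F
      F-below-cone {d} cone = below (cone F (graph-Σ⁰₃ , graph-Π⁰₃))
        where
        below : F ≤PR d → Closure.Fn1 (PRIn-clone d) F
        below (t , e) = Closure.fn1 (mkPR t λ { (x ∷ []) → e x })

  module FromCone (d : ℕ → ℕ) (cone : Cone-Δ⁰₃ d) {A : Punctual} (I : IsoωPlusη A) where
    open OrderωPlusη (orderOf I)
    module D = Closure (PRIn-clone d)
    PA = presents I

    opaque
      O-relZ : Z.Rel2 O
      O-relZ = Z.rel2 (Z.rext (λ ρ → proj₂ (Presents.O⟺ PA _ _)) (λ ρ → proj₁ (Presents.O⟺ PA _ _))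
                              (Z.Rel2.rel (Rel-rel zeroOracle A)))

      O-relD : D.Rel2 O
      O-relD = D.rel2 (D.rext (λ ρ → proj₂ (Presents.O⟺ PA _ _)) (λ ρ → proj₁ (Presents.O⟺ PA _ _))
                              (D.Rel2.rel (Rel-rel d A)))

    Far : ℕ → ℕ → ℕ → Set
    Far x b c = b ≤ c × O c x

    W-not-far : ∀ {x} → W x → ¬ (∀ b → ∃ λ c → Far x b c)
    W-not-far w h with bound-ex w
    ... | n , k with h n
    ...   | c , le , o = <⇒≱ (k c o) le

    far-H : ∀ {x} → (∀ b → ∃ λ c → Far x b c) → H x
    far-H {x} h = [ (λ w → ⊥-elim (W-not-far w h)) , (λ z → z) ]′ (Presents.all PA x)

    -- The value 0 signals that x lies in the copy of η, a Π⁰₂ condition;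
    -- on the copy of ω the value is the successor of the least solution of U.
    module OnW (U : ℕ → ℕ → ℕ → Set) (U-rel : Z.Rel3 U)
               (anti : ∀ {x y b b'} → b' ≤ b → U x y b → U x y b')
               (tot : ∀ {x} → W x → ∃ λ y → ∀ b → U x y b) where
      T : ℕ → ℕ → ℕ → ℕ → Set
      T x p b c = (p ≡ 0 × Far x b c) ⊎ (p ≢ 0 × U x (pred p) b)

      T-anti : ∀ x p c {b b'} → b' ≤ b → T x p b c → T x p b' c
      T-anti x p c le (inj₁ (e , le' , o)) = inj₁ (e , ≤-trans le le' , o)
      T-anti x p c le (inj₂ (e , u)) = inj₂ (e , anti le u)

      zero-sol : ∀ {x} → (∀ b → ∃ λ c → T x 0 b c) → H x
      zero-sol h = far-H λ b → [ (λ (_ , f) → proj₁ (h b) , f) , (λ (n , _) → ⊥-elim (n refl)) ]′ (proj₂ (h b))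

      T-total : ∀ x → ∃ λ p → ∀ b → ∃ λ c → T x p b c
      T-total x with Presents.all PA x
      ... | inj₁ w = let y , u = tot w in suc y , λ b → 0 , inj₂ ((λ ()) , u b)
      ... | inj₂ h = 0 , λ b → let c , f = H-unbounded (orderOf I) h b in c , inj₁ (refl , f)

      opaque
        T-rel : Z.Rel4 T
        T-rel = Z.rel4 (((Z.v1 Z.≡ᵣ Z.zeroᶜ) Z.∧ᵣ (Z.v2 Z.≤ᵣ Z.v3) Z.∧ᵣ Z.rap2 O-relZ Z.v3 Z.v0)
                   Z.∨ᵣ (Z.¬ᵣ (Z.v1 Z.≡ᵣ Z.zeroᶜ) Z.∧ᵣ Z.rap3 U-rel Z.v0 (Z.predᶜ Z.v1) Z.v2))

      module L = LeastΠ₂ T T-rel T-anti T-total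

      F-H : ∀ {x} → H x → L.F x ≡ 0
      F-H {x} h = L.F-unique (λ b → let c , f = H-unbounded (orderOf I) h b in c , inj₁ (refl , f)) (λ _ ())

      F-W : ∀ {x} → W x → (L.F x ≢ 0) × (∀ b → U x (pred (L.F x)) b)
      F-W {x} w = ne , λ b → [ (λ (e , _) → ⊥-elim (ne e)) , proj₂ ]′ (proj₂ (L.F-sat x b))
        where
        ne : L.F x ≢ 0
        ne e = disj w (zero-sol (subst (λ p → ∀ b → ∃ λ c → T x p b c) e (L.F-sat x)))

    BoundBelow NextBelow : ℕ → ℕ → ℕ → Set
    BoundBelow x n b = ∀ z → z < b → O z x → z < n
    NextBelow x y b = O x y × (∀ z → z < b → ¬ (O x z × O z y))

    opaque
      bound-rel : Z.Rel3 BoundBelow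
      bound-rel = Z.rel3 (Z.∀ᵣ Z.v2 (Z.rap2 O-relZ Z.v0 Z.v1 Z.⇒ᵣ (Z.v0 Z.<ᵣ Z.v2)))

      next-rel : Z.Rel3 NextBelow
      next-rel = Z.rel3 (Z.rap2 O-relZ Z.v0 Z.v1
        Z.∧ᵣ Z.∀ᵣ Z.v2 (Z.¬ᵣ (Z.rap2 O-relZ Z.v1 Z.v0 Z.∧ᵣ Z.rap2 O-relZ Z.v0 Z.v2)))

    bound-anti : ∀ {x n b b'} → b' ≤ b → BoundBelow x n b → BoundBelow x n b'
    bound-anti le u z lt = u z (≤-trans lt le)

    bound-total : ∀ {x} → W x → ∃ λ n → ∀ b → BoundBelow x n b
    bound-total w with bound-ex w
    ... | n , h = n , λ b z _ → h z

    next-anti : ∀ {x y b b'} → b' ≤ b → NextBelow x y b → NextBelow x y b'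
    next-anti le (o , u) = o , λ z lt → u z (≤-trans lt le)

    next-total : ∀ {x} → W x → ∃ λ y → ∀ b → NextBelow x y b
    next-total w with succ-ex w
    ... | y , _ , o , h = y , λ b → o , λ z _ → h z

    module Bound = OnW BoundBelow bound-rel bound-anti bound-total
    module Next = OnW NextBelow next-rel next-anti next-total

    -- A value 2w is an element w < u of the copy of η, a value 2n + 1 a bound n for the elements below u.
    module Low where
      T : ℕ → ℕ → ℕ → ℕ → Set
      T u p b c = (par p ≡ 0 × O (half p) u × Far (half p) b c) ⊎ (par p ≡ 1 × (∀ z → z < b → O z u → z < half p))

      T-anti : ∀ x p c {b b'} → b' ≤ b → T x p b c → T x p b' c
      T-anti x p c le (inj₁ (e , o , le' , o')) = inj₁ (e , o , ≤-trans le le' , o')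
      T-anti x p c le (inj₂ (e , u)) = inj₂ (e , λ z lt → u z (≤-trans lt le))

      T-total : ∀ x → ∃ λ p → ∀ b → ∃ λ c → T x p b c
      T-total x with Presents.all PA x
      ... | inj₁ w = let n , h = bound-ex w in suc (n + n) , λ b → 0 ,
              inj₂ (par-dbl1 n , λ z _ o → subst (z <_) (sym (half-dbl1 n)) (h z o))
      ... | inj₂ h = let y , h' , o = low-ex h in y + y , λ b → let c , f = H-unbounded (orderOf I) h' b in c ,
              inj₁ (par-dbl y , subst (λ z → O z x × Far z b c) (sym (half-dbl y)) (o , f))

      opaque
        T-rel : Z.Rel4 T
        T-rel = Z.rel4 (((Z.ap1 Z.par-fn Z.v1 Z.≡ᵣ Z.zeroᶜ) Z.∧ᵣ Z.rap2 O-relZ (Z.ap1 Z.half-fn Z.v1) Z.v0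
                      Z.∧ᵣ (Z.v2 Z.≤ᵣ Z.v3) Z.∧ᵣ Z.rap2 O-relZ Z.v3 (Z.ap1 Z.half-fn Z.v1))
                   Z.∨ᵣ ((Z.ap1 Z.par-fn Z.v1 Z.≡ᵣ Z.const 1)
                      Z.∧ᵣ Z.∀ᵣ Z.v2 (Z.rap2 O-relZ Z.v0 Z.v1 Z.⇒ᵣ (Z.v0 Z.<ᵣ Z.ap1 Z.half-fn Z.v2))))

      module L = LeastΠ₂ T T-rel T-anti T-total

      -- An odd value would bound the elements below `u`, against `H-unbounded`. For an even value
      -- the clause `Far` puts the element in the copy of η.
      spec : ∀ {u} → H u → H (half (L.F u)) × O (half (L.F u)) u
      spec {u} h with par-cases (L.F u)
      ... | inj₁ e = far-H (λ b → let c , _ , f = even b in c , f) , proj₁ (proj₂ (even 0))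
        where
        even : ∀ b → ∃ λ c → O (half (L.F u)) u × Far (half (L.F u)) b c
        even b with L.F-sat u b
        ... | c , inj₁ (_ , o , f) = c , o , f
        ... | c , inj₂ (e' , _) with trans (sym e) e'
        ...   | ()
      ... | inj₂ e with H-unbounded (orderOf I) h (half (L.F u))
      ...   | c , le , o with L.F-sat u (suc c)
      ...     | _ , inj₂ (_ , k) = ⊥-elim (<⇒≱ (k c ≤-refl o) le)
      ...     | _ , inj₁ (e' , _) with trans (sym e) e'
      ...       | ()

    -- The value 0 signals that nothing lies above, which keeps the function total; at points of `H`
    -- an actual upper element refutes it. `Mid` follows the same pattern.
    module Up where
      T : ℕ → ℕ → ℕ → ℕ → Set
      T x p b c = (p ≡ 0 × (∀ z → z < b → ¬ O x z)) ⊎ (p ≢ 0 × O x (pred p))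

      T-anti : ∀ x p c {b b'} → b' ≤ b → T x p b c → T x p b' c
      T-anti x p c le (inj₁ (e , k)) = inj₁ (e , λ z lt → k z (≤-trans lt le))
      T-anti x p c le (inj₂ k) = inj₂ k

      T-total : ∀ x → ∃ λ p → ∀ b → ∃ λ c → T x p b c
      T-total x with lem (∃ λ z → O x z)
      ... | yes (z , o) = suc z , λ b → 0 , inj₂ ((λ ()) , o)
      ... | no h = 0 , λ b → 0 , inj₁ (refl , λ z _ o → h (z , o))

      opaque
        T-rel : Z.Rel4 T
        T-rel = Z.rel4 (((Z.v1 Z.≡ᵣ Z.zeroᶜ) Z.∧ᵣ Z.∀ᵣ Z.v2 (Z.¬ᵣ (Z.rap2 O-relZ Z.v1 Z.v0)))
                   Z.∨ᵣ (Z.¬ᵣ (Z.v1 Z.≡ᵣ Z.zeroᶜ) Z.∧ᵣ Z.rap2 O-relZ Z.v0 (Z.predᶜ Z.v1)))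

      module L = LeastΠ₂ T T-rel T-anti T-total

      spec : ∀ {x} → H x → O x (pred (L.F x))
      spec {x} h with up-ex h
      ... | z , o with L.F-sat x (suc z)
      ...   | _ , inj₁ (_ , k) = ⊥-elim (k z ≤-refl o)
      ...   | _ , inj₂ (_ , o') = o'

    module Mid where
      T : ℕ → ℕ → ℕ → ℕ → Set
      T x p b c = (p ≡ 0 × (∀ z → z < b → ¬ (O (π₁ x) z × O z (π₂ x)))) ⊎ (p ≢ 0 × O (π₁ x) (pred p) × O (pred p) (π₂ x))

      T-anti : ∀ x p c {b b'} → b' ≤ b → T x p b c → T x p b' c
      T-anti x p c le (inj₁ (e , k)) = inj₁ (e , λ z lt → k z (≤-trans lt le))
      T-anti x p c le (inj₂ k) = inj₂ k

      T-total : ∀ x → ∃ λ p → ∀ b → ∃ λ c → T x p b c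
      T-total x with lem (∃ λ z → O (π₁ x) z × O z (π₂ x))
      ... | yes (z , o) = suc z , λ b → 0 , inj₂ ((λ ()) , o)
      ... | no h = 0 , λ b → 0 , inj₁ (refl , λ z _ o → h (z , o))

      opaque
        T-rel : Z.Rel4 T
        T-rel = Z.rel4 (((Z.v1 Z.≡ᵣ Z.zeroᶜ) Z.∧ᵣ Z.∀ᵣ Z.v2
                      (Z.¬ᵣ (Z.rap2 O-relZ (Z.ap1 Z.π₁-fn Z.v1) Z.v0 Z.∧ᵣ Z.rap2 O-relZ Z.v0 (Z.ap1 Z.π₂-fn Z.v1))))
                   Z.∨ᵣ (Z.¬ᵣ (Z.v1 Z.≡ᵣ Z.zeroᶜ) Z.∧ᵣ Z.rap2 O-relZ (Z.ap1 Z.π₁-fn Z.v0) (Z.predᶜ Z.v1)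
                         Z.∧ᵣ Z.rap2 O-relZ (Z.predᶜ Z.v1) (Z.ap1 Z.π₂-fn Z.v0)))

      module L = LeastΠ₂ T T-rel T-anti T-total

      spec : ∀ {u v} → H u → H v → O u v → O u (pred (L.F (pair u v))) × O (pred (L.F (pair u v))) v
      spec {u} {v} h h' o with mid-ex h h' o
      ... | z , a , b with L.F-sat (pair u v) (suc z)
      ...   | _ , inj₁ (_ , k) = ⊥-elim (k z ≤-refl (subst₂ (λ s t → O s z × O z t)
                (sym (π₁-pair u v)) (sym (π₂-pair u v)) (a , b)))
      ...   | _ , inj₂ (_ , o') = subst₂ (λ s t → O s (pred (L.F (pair u v))) × O (pred (L.F (pair u v))) t)
                (π₁-pair u v) (π₂-pair u v) o'

    opaque
      bound-FnD : D.Fn1 Bound.L.F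
      bound-FnD = Bound.L.F-below-cone cone

      presented-cone : Presented (PRIn d) (PRIn-clone d) (orderOf I)
      presented-cone = record
        { O-rel = O-relD
        ; W-rel = D.rel1 (D.rext
            (λ ρ ne → [ (λ w → w) , (λ h → ⊥-elim (ne (Bound.F-H h))) ]′ (Presents.all PA _))
            (λ ρ w → proj₁ (Bound.F-W w)) (D.¬ᵣ (D.ap1 bound-FnD D.v0 D.≡ᵣ D.zeroᶜ)))
        ; H-rel = D.rel1 (D.rext
            (λ ρ e → [ (λ w → ⊥-elim (proj₁ (Bound.F-W w) e)) , (λ h → h) ]′ (Presents.all PA _))
            (λ ρ h → Bound.F-H h) (D.ap1 bound-FnD D.v0 D.≡ᵣ D.zeroᶜ))
        ; next = λ x → pred (Next.L.F x)
        ; bound = λ x → pred (Bound.L.F x)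
        ; low = λ x → half (Low.L.F x)
        ; up = λ x → pred (Up.L.F x)
        ; mid = λ x y → pred (Mid.L.F (pair x y))
        ; next-fn = D.fn1 (D.predᶜ (D.ap1 (Next.L.F-below-cone cone) D.v0))
        ; bound-fn = D.fn1 (D.predᶜ (D.ap1 bound-FnD D.v0))
        ; low-fn = D.fn1 (D.ap1 D.half-fn (D.ap1 (Low.L.F-below-cone cone) D.v0))
        ; up-fn = D.fn1 (D.predᶜ (D.ap1 (Up.L.F-below-cone cone) D.v0))
        ; mid-fn = D.fn2 (D.predᶜ (D.ap1 (Mid.L.F-below-cone cone) (D.ap2 D.pair-fn D.v0 D.v1)))
        ; next-spec = next-spec
        ; bound-spec = λ w y → proj₂ (Bound.F-W w) (suc y) y ≤-refl
        ; low-spec = Low.spec ; up-spec = Up.spec ; mid-spec = Mid.spec }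
        where
        next-spec : ∀ {x} → W x → W (pred (Next.L.F x)) × O x (pred (Next.L.F x)) × (∀ z → ¬ (O x z × O z (pred (Next.L.F x))))
        next-spec {x} w = inW (Presents.all PA _) , proj₁ (u 0) , λ z → proj₂ (u (suc z)) z ≤-refl
          where
          u : ∀ b → O x (pred (Next.L.F x)) × (∀ z → z < b → ¬ (O x z × O z (pred (Next.L.F x))))
          u = proj₂ (Next.F-W w)
          s : ℕ
          s = proj₁ (succ-ex w)
          sw : W s × O x s × (∀ z → ¬ (O x z × O z s))
          sw = proj₂ (succ-ex w)
          inW : W (pred (Next.L.F x)) ⊎ H (pred (Next.L.F x)) → W (pred (Next.L.F x))
          inW (inj₁ w') = w'
          -- The true successor `s` would lie strictly between `x` and a point of the copy of η.
          inW (inj₂ h) = ⊥-elim (proj₂ (u (suc s)) s ≤-refl (proj₁ (proj₂ sw) , W<H (proj₁ sw) h))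

  cone⇒prCat : ∀ {A} → IsoωPlusη A → ∀ d → Cone-Δ⁰₃ d → PrCat A d
  cone⇒prCat {A} I d cone B i = result (TwoOrders.isomorphism (FromCone.presented-cone d cone I) (FromCone.presented-cone d cone I′))
    where
    I′ : IsoωPlusη B
    I′ = transfer I i
    Result : Set
    Result = Σ (Iso A B) λ j → (Iso.f j ≤PR d) × (Iso.g j ≤PR d)
    result : (∃ λ f → ∃ λ g → Closure.Fn1 (PRIn-clone d) f × Closure.Fn1 (PRIn-clone d) g
               × IsoOn (orderOf I) (orderOf I′) f g × IsoOn (orderOf I′) (orderOf I) g f) → Result
    result (f , g , Closure.fn1 (mkPR t e) , Closure.fn1 (mkPR u e') , a , b) =
      iso-from (presents I) (presents I′) a b , (t , λ x → e (x ∷ [])) , (u , λ x → e' (x ∷ []))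

-- An explicit numbering of ω + η and a standard punctual copy.

module Standard (lem : Classical) where
  open ConeBound lem public

  dbl-inj : ∀ {m n} → m + m ≡ n + n → m ≡ n
  dbl-inj {m} {n} e = trans (sym (half-dbl m)) (trans (cong half e) (half-dbl n))

  dbl≢dbl1 : ∀ {m n} → m + m ≢ suc (n + n)
  dbl≢dbl1 {m} {n} e with trans (sym (par-dbl m)) (trans (cong par e) (par-dbl1 n))
  ... | ()

  encℤ : ℤ.ℤ → ℕ
  encℤ (ℤ.+ n) = n + n
  encℤ (ℤ.-[1+ n ]) = suc (n + n)

  encℤ-inj : ∀ {i j} → encℤ i ≡ encℤ j → i ≡ j
  encℤ-inj {ℤ.+ m} {ℤ.+ n} e = cong ℤ.+_ (dbl-inj e)
  encℤ-inj {ℤ.+ m} {ℤ.-[1+ n ]} e = ⊥-elim (dbl≢dbl1 {m} {n} e)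
  encℤ-inj {ℤ.-[1+ m ]} {ℤ.+ n} e = ⊥-elim (dbl≢dbl1 {n} {m} (sym e))
  encℤ-inj {ℤ.-[1+ m ]} {ℤ.-[1+ n ]} e = cong ℤ.-[1+_] (dbl-inj (suc-injective e))

  encℚ : Q.ℚ → ℕ
  encℚ q = pair (encℤ (Q.ℚ.numerator q)) (Q.ℚ.denominator-1 q)

  encℚ-inj : ∀ {p q} → encℚ p ≡ encℚ q → p ≡ q
  encℚ-inj {Q.mkℚ n d c} {Q.mkℚ n' d' c'} e with pair-inj {encℤ n} {d} {encℤ n'} {d'} e
  ... | a , b = Q.mkℚ-cong (encℤ-inj a) b

  enc : Point → ℕ
  enc (inj₁ n) = n + n
  enc (inj₂ q) = suc (encℚ q + encℚ q)

  enc-inj : ∀ {u v} → enc u ≡ enc v → u ≡ v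
  enc-inj {inj₁ m} {inj₁ n} e = cong inj₁ (dbl-inj e)
  enc-inj {inj₁ m} {inj₂ q} e = ⊥-elim (dbl≢dbl1 {m} {encℚ q} e)
  enc-inj {inj₂ q} {inj₁ n} e = ⊥-elim (dbl≢dbl1 {n} {encℚ q} (sym e))
  enc-inj {inj₂ p} {inj₂ q} e = cong inj₂ (encℚ-inj (dbl-inj (suc-injective e)))

  -- Compares `X` with the numbered order. Codes of unreduced fractions are not points there, which
  -- is why `W` and `H` need not exhaust the numbers.
  presents⇒iso : ∀ {A X} → Presents A X → IsoωPlusη A
  presents⇒iso {A} {X} PA = fromIso (isomorphic X order)
    where
    open Coded enc (λ {u} {v} → enc-inj {u} {v})
    open Presents PA
    good : ∀ u → W (enc u) ⊎ H (enc u)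
    good (inj₁ n) = inj₁ (n , refl)
    good (inj₂ q) = inj₂ (q , refl)
    fromIso : (∃ λ f → ∃ λ g → IsoOn X order f g × IsoOn order X g f) → IsoωPlusη A
    fromIso (f , g , i , j) = record
      { h = h ; h⁻¹ = λ u → g (enc u)
      ; left = left
      ; right = λ u → enc-inj (trans (proj₂ (point (good' (g (enc u))))) (IsoOn.gf j (good u)))
      ; pres = λ x y →
          (λ r → O-enc (subst₂ O (sym (proj₂ (point (good' x)))) (sym (proj₂ (point (good' y))))
                   (IsoOn.f-O i (all x) (all y) (proj₂ (O⟺ x y) r))))
        , (λ l → proj₁ (O⟺ x y) (subst₂ (OrderωPlusη.O X) (left x) (left y)
                   (IsoOn.f-O j (good (h x)) (good (h y)) (enc-O {h x} {h y} l)))) }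
      where
      good' : ∀ x → W (f x) ⊎ H (f x)
      good' x = [ (λ w → inj₁ (IsoOn.f-W i w)) , (λ k → inj₂ (IsoOn.f-H i k)) ]′ (all x)
      h : ℕ → Point
      h x = proj₁ (point (good' x))
      left : ∀ x → g (enc (h x)) ≡ x
      left x = trans (cong g (proj₂ (point (good' x)))) (IsoOn.gf i (all x))

  opaque
    punctual : {O : ℕ → ℕ → Set} → Z.Rel2 O → Σ Punctual λ B → ∀ x y → O x y ⟺ Rel B x y
    punctual {O} (Z.rel2 (Z.isRec (mkPR t e))) = record { χ = t } , λ x y →
        (λ o → trans (e (x ∷ y ∷ [])) (𝟙-yes o)) , (λ r → 𝟙-true (trans (sym (e (x ∷ y ∷ []))) r))

  -- The even numbers form the copy of ω; the odd number 2e + 1 stands for the eventually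
  -- zero sequence coded by e + 1, and these form a copy of η under the lexicographic order.
  module 𝕊 where
    W H : ℕ → Set
    W x = par x ≡ 0
    H x = par x ≡ 1

    -- The shift by one omits the zero sequence, which would be a least element of the copy of η.
    code : ℕ → ℕ
    code x = suc (half x)

    decode : ℕ → ℕ
    decode c = suc (pred c + pred c)

    H-decode : ∀ c → H (decode c)
    H-decode c = par-dbl1 (pred c)

    code-decode : ∀ {c} → c ≢ 0 → code (decode c) ≡ c
    code-decode {zero} h = ⊥-elim (h refl)
    code-decode {suc c} h = cong suc (half-dbl1 c)

    O : ℕ → ℕ → Set
    O x y = (W x × W y × x < y) ⊎ (W x × H y) ⊎ (H x × H y × Lexᶜ (code x) (code y))

    disj : ∀ {x} → W x → ¬ H x
    disj w h with trans (sym w) h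
    ... | ()

    O-W : ∀ {x y} → O x y → W y → W x × x < y
    O-W (inj₁ (w , _ , lt)) w' = w , lt
    O-W (inj₂ (inj₁ (_ , h))) w' = ⊥-elim (disj w' h)
    O-W (inj₂ (inj₂ (_ , h , _))) w' = ⊥-elim (disj w' h)

    O-H : ∀ {x y} → O x y → H x → H y × Lexᶜ (code x) (code y)
    O-H (inj₁ (w , _)) h = ⊥-elim (disj w h)
    O-H (inj₂ (inj₁ (w , _))) h = ⊥-elim (disj w h)
    O-H (inj₂ (inj₂ (_ , h , l))) _ = h , l

    all : ∀ x → W x ⊎ H x
    all x = par-cases x

    irr : ∀ {x} → ¬ O x x
    irr {x} o = [ (λ w → <-irrefl refl (proj₂ (O-W o w))) , (λ h → lex-irr (proj₂ (O-H o h))) ]′ (all x)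

    trans< : ∀ {x y z} → O x y → O y z → O x z
    trans< {x} {y} {z} o o' with all x | all z
    ... | inj₁ w | inj₂ h = inj₂ (inj₁ (w , h))
    ... | inj₁ w | inj₁ w' = inj₁ (w , w' , <-trans (proj₂ (O-W o (proj₁ (O-W o' w')))) (proj₂ (O-W o' w')))
    ... | inj₂ h | _ = inj₂ (inj₂ (h , proj₁ (O-H o' hy) , lex-trans (proj₂ (O-H o h)) (proj₂ (O-H o' hy))))
      where
      hy : H y
      hy = proj₁ (O-H o h)

    tri : ∀ {x y} → W x ⊎ H x → W y ⊎ H y → x ≡ y ⊎ (O x y ⊎ O y x)
    tri {x} {y} (inj₁ w) (inj₁ w') with <-cmp x y
    ... | tri< lt _ _ = inj₂ (inj₁ (inj₁ (w , w' , lt)))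
    ... | tri≈ _ e _ = inj₁ e
    ... | tri> _ _ gt = inj₂ (inj₂ (inj₁ (w' , w , gt)))
    tri (inj₁ w) (inj₂ h) = inj₂ (inj₁ (inj₂ (inj₁ (w , h))))
    tri (inj₂ h) (inj₁ w) = inj₂ (inj₂ (inj₂ (inj₁ (w , h))))
    tri {x} {y} (inj₂ h) (inj₂ h') with lexᶜ-tri (code x) (code y)
    ... | inj₁ e = inj₁ (trans (sym (odd-half h)) (trans (cong (λ k → suc (k + k)) (suc-injective e)) (odd-half h')))
    ... | inj₂ (inj₁ l) = inj₂ (inj₁ (inj₂ (inj₂ (h , h' , l))))
    ... | inj₂ (inj₂ l) = inj₂ (inj₂ (inj₂ (inj₂ (h' , h , l))))

    W-suc : ∀ {x} → W x → H (suc x)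
    W-suc {x} w = trans (par-suc x) (cong (1 ∸_) w)

    W-suc² : ∀ {x} → W x → W (suc (suc x))
    W-suc² {x} w = trans (par-suc (suc x)) (cong (1 ∸_) (W-suc w))

    no-between : ∀ {x} → W x → ∀ z → ¬ (O x z × O z (suc (suc x)))
    no-between {x} w z (o , o') with O-W o' (W-suc² w)
    ... | wz , lt with O-W o wz
    ...   | _ , lt' = disj wz (subst H (≤-antisym lt' (≤-pred lt)) (W-suc w))

    low : ℕ → ℕ
    low x = decode (pair 0 (code x))

    low-code : ∀ x → code (low x) ≡ pair 0 (code x)
    low-code x = code-decode λ e → n≮0 (subst (suc (half x) ≤_) e (snd≤pair 0 (code x)))

    low-O : ∀ {x} → H x → O (low x) x
    low-O {x} h = inj₂ (inj₂ (H-decode (pair 0 (code x)) , h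
      , subst (λ c → Lexᶜ c (code x)) (sym (low-code x)) (lexᶜ-below (code x) (λ ()))))

    H-order : ∀ {x c} → H x → Lexᶜ (code x) c → O x (decode c)
    H-order {x} {c} h l = inj₂ (inj₂ (h , H-decode c , subst (Lexᶜ (code x)) (sym (code-decode (lexᶜ-nonzero l))) l))

    order : OrderωPlusη
    order = record
      { O = O ; W = W ; H = H ; irr = irr
      ; trans< = trans<
      ; tri = tri ; disj = disj
      ; W<H = λ w h → inj₂ (inj₁ (w , h))
      ; W-down = λ o w → proj₁ (O-W o w)
      ; H-up = λ o h → proj₁ (O-H o h)
      ; e₀ = 0 ; W-e₀ = par-dbl 0
      ; e₀-least = λ { {zero} _ → inj₁ refl ; {suc x} w → inj₂ (inj₁ (par-dbl 0 , w , s≤s z≤n)) }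
      ; succ-ex = λ {x} w → suc (suc x) , W-suc² w , inj₁ (w , W-suc² w , m<n⇒m<1+n ≤-refl) , no-between w
      ; bound-ex = λ {x} w → x , λ y o → proj₂ (O-W o w)
      ; q₀ = 1 ; H-q₀ = par-dbl1 0
      ; low-ex = λ {x} h → low x , H-decode (pair 0 (code x)) , low-O h
      ; up-ex = λ {x} h → decode (proj₁ (lexᶜ-above (code x))) , H-order h (proj₂ (lexᶜ-above (code x)))
      ; mid-ex = λ {x} {y} h h' o → mid h h' (proj₂ (O-H o h)) }
      where
      mid : ∀ {x y} → H x → H y → Lexᶜ (code x) (code y) → ∃ λ z → O x z × O z y
      mid {x} {y} h h' l with lexᶜ-between {code x} {code y} l
      ... | c , a , b = decode c , H-order h a , inj₂ (inj₂ (H-decode c , h'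
            , subst (λ c → Lexᶜ c (code y)) (sym (code-decode (lexᶜ-nonzero a))) b))

    opaque
      O-rel : Z.Rel2 O
      O-rel = Z.rel2 ((W0 Z.∧ᵣ W1 Z.∧ᵣ (Z.v0 Z.<ᵣ Z.v1)) Z.∨ᵣ ((W0 Z.∧ᵣ H1) Z.∨ᵣ (H0 Z.∧ᵣ H1
          Z.∧ᵣ Z.rap2 Z.lexᶜ-rel (Z.succᶜ (Z.ap1 Z.half-fn Z.v0)) (Z.succᶜ (Z.ap1 Z.half-fn Z.v1)))))
        where
        W0 : Z.Rec {2} (λ ρ → W (lookup ρ fz))
        W0 = Z.ap1 Z.par-fn Z.v0 Z.≡ᵣ Z.zeroᶜ
        W1 : Z.Rec {2} (λ ρ → W (lookup ρ (fs fz)))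
        W1 = Z.ap1 Z.par-fn Z.v1 Z.≡ᵣ Z.zeroᶜ
        H0 : Z.Rec {2} (λ ρ → H (lookup ρ fz))
        H0 = Z.ap1 Z.par-fn Z.v0 Z.≡ᵣ Z.const 1
        H1 : Z.Rec {2} (λ ρ → H (lookup ρ (fs fz)))
        H1 = Z.ap1 Z.par-fn Z.v1 Z.≡ᵣ Z.const 1

    S : Punctual
    S = proj₁ (punctual O-rel)

    S-presents : Presents S order
    S-presents = record { O⟺ = proj₂ (punctual O-rel) ; all = all }

    S-iso : IsoωPlusη S
    S-iso = presents⇒iso S-presents

-- The inclusion (⊆): a copy that hides the true path.

module Coding (lem : Classical) (θ : ℕ → ℕ → ℕ → ℕ → Set)
              (solvable : ∀ i → ∃ λ p → ∀ b → ∃ λ c → θ i p b c) where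
  open Standard lem public

  Sol : ℕ → ℕ → Set
  Sol i p = ∀ b → ∃ λ c → θ i p b c

  opaque
    sol : ℕ → ℕ
    sol i = proj₁ (least {Sol i} (solvable i))

    sol-sat : ∀ i → Sol i (sol i)
    sol-sat i = proj₁ (proj₂ (least {Sol i} (solvable i)))

    sol-min : ∀ i p → p < sol i → ¬ Sol i p
    sol-min i = proj₂ (proj₂ (least {Sol i} (solvable i)))

  opaque
    -- The true path: an entry 2p + 1 encodes the solution p, even entries are never true.
    path : ℕ → ℕ
    path i = suc (sol i + sol i)

    path>0 : ∀ i → 0 < path i
    path>0 i = s≤s z≤n

    par-path : ∀ i → par (path i) ≡ 1
    par-path i = par-dbl1 (sol i)

    half-path : ∀ i → half (path i) ≡ sol i
    half-path i = half-dbl1 (sol i)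

    half< : ∀ {i v} → par v ≡ 1 → v < path i → half v < sol i
    half< {i} {v} o lt with half v <? sol i
    ... | yes p = p
    ... | no p = ⊥-elim (<⇒≱ lt (≤-trans (s≤s (+-mono-≤ (≮⇒≥ p) (≮⇒≥ p))) (≤-reflexive (odd-half o))))

  par-suc-path : ∀ i → par (suc (path i)) ≡ 0
  par-suc-path i = trans (par-suc (path i)) (cong (1 ∸_) (par-path i))

  odd≢even : ∀ {a} → par a ≡ 1 → par a ≢ 0
  odd≢even o e with trans (sym o) e
  ... | ()

  -- At stage r there is evidence of strength j that the entry v is true at place i.
  EvAt : ℕ → ℕ → ℕ → ℕ → Set
  EvAt i v j r = ∀ b → b < j → ∃ λ c → c < r × θ i (half v) b c

  Ev : ℕ → ℕ → ℕ → ℕ → Set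
  Ev e n j r = ∀ i → i < n → EvAt i (seq e i) j r

  EvAt-mono : ∀ {i v j j' r r'} → j' ≤ j → r ≤ r' → EvAt i v j r → EvAt i v j' r'
  EvAt-mono p q h b lt with h b (≤-trans lt p)
  ... | c , c< , t = c , ≤-trans c< q , t

  Ev-mono : ∀ {e n j r r'} → r ≤ r' → Ev e n j r → Ev e n j r'
  Ev-mono q h i lt = EvAt-mono ≤-refl q (h i lt)

  path-evidence : ∀ i j → ∃ λ r → EvAt i (path i) j r
  path-evidence i j = collect (λ { le (c , lt , t) → c , ≤-trans lt le , t }) j λ b _ →
    suc (proj₁ (sol-sat i b)) , proj₁ (sol-sat i b) , ≤-refl ,
    subst (λ p → θ i p b (proj₁ (sol-sat i b))) (sym (half-path i)) (proj₂ (sol-sat i b))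

  prefix-evidence : ∀ e n j → Agree n (seq e) path → ∃ λ r → Ev e n j r
  prefix-evidence e n j ag = collect (λ le → EvAt-mono ≤-refl le) n λ i lt →
    proj₁ (path-evidence i j) , subst (λ v → EvAt i v j (proj₁ (path-evidence i j))) (sym (ag i lt)) (proj₂ (path-evidence i j))

  Limited : ℕ → ℕ → ℕ → Set
  Limited i v L = par v ≡ 1 → v < path i → ∀ j r → EvAt i v j r → j ≤ L

  -- An odd entry left of the true one names a `p` below the least solution; it fails at some `b`,
  -- so evidence never exceeds strength `b`.
  limited : ∀ i v → ∃ (Limited i v)
  limited i v with lem (par v ≡ 1 × v < path i)
  ... | no h = 0 , λ o lt → ⊥-elim (h (o , lt))
  ... | yes (o , lt) with ¬∀⇒∃¬ (sol-min i (half v) (half< o lt))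
  ...   | b , nb = b , λ _ _ j r h → ≮⇒≥ λ b<j → nb (proj₁ (h b b<j) , proj₂ (proj₂ (h b b<j)))

  limits : ∀ n → ∃ λ L → ∀ i → i < n → ∀ v → Limited i v L
  limits n = collect (λ le h v o lt j r k → ≤-trans (h v o lt j r k) le) n λ i _ → perPlace i
    where
    perPlace : ∀ i → ∃ λ L → ∀ v → Limited i v L
    perPlace i with collect {Limited i} (λ le h o lt j r k → ≤-trans (h o lt j r k) le) (path i) (λ v _ → limited i v)
    ... | L , h = L , λ v o lt → h v lt o lt

  First : ℕ → ℕ → Set
  First e n = par (seq e n) ≡ 0 × (∀ i → i < n → par (seq e i) ≡ 1)

  Tail0 : ℕ → ℕ → Set
  Tail0 e n = ∀ i → n < i → seq e i ≡ 0

  Trunc : ℕ → ℕ → ℕ → Set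
  Trunc e n t = (∀ i → i < suc n → seq t i ≡ seq e i) × Tail0 t n

  -- The strength is the code `e` itself: if `e` is right of the true path, the path eventually
  -- provides it; left of the path, only finitely many `e` that leave it at a given place can obtain
  -- it.
  Fire : ℕ → ℕ → ℕ → Set
  Fire e n r = Σ ℕ λ i → i < suc n × Σ ℕ λ v → v < seq e i × par v ≡ 1 × Ev e i e r × EvAt i v e r

  -- Strength `t` for the prefix is shared by all extensions of `t`, so one supported truncation can
  -- carry infinitely many points. The condition `1 ≤ n` reserves the sequences 2k, 0, 0, ... for
  -- spare positions.
  Wanted : ℕ → ℕ → ℕ → ℕ → Set
  Wanted e n t r = First e n × Trunc e n t × Ev e n t r × ((e ≡ t × 1 ≤ n) ⊎ (e ≢ t × Fire e n r))

  -- The sequence e is wanted at stage r.  With τ the prefix of odd entries of e, of length n, and t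
  -- the sequence e cut off after its first even entry, evidence of strength t for τ is required;
  -- then t itself is wanted (n ≥ 1), and any other e waits for evidence of strength e for
  -- a sequence to its left.
  Want : ℕ → ℕ → Set
  Want e r = Σ ℕ λ n → n < suc e × Σ ℕ λ t → t < suc e × Wanted e n t r

  trunc≤ : ∀ {e n t} → Trunc e n t → t ≤ e
  trunc≤ {e} {n} {t} (a , z) = seq-mono λ i → [ (λ lt → ≤-reflexive (a i lt)) , (λ le → ≤-trans (≤-reflexive (z i le)) z≤n) ]′ (<-≤-connex i (suc n))

  first≤ : ∀ {e n} → First e n → n ≤ e
  first≤ {e} {n} (_ , o) = ≮⇒≥ λ lt → odd≢even (o e lt) (trans (cong par (seq-tail e e ≤-refl)) (par-dbl 0))

  want : ∀ {e n t r} → Wanted e n t r → Want e r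
  want {n = n} {t} w@(f , tr , _) = n , s≤s (first≤ f) , t , s≤s (trunc≤ tr) , w

  -- Only the first stage counts, so a wanted sequence is attached to exactly one number.
  New : ℕ → ℕ → Set
  New e r = Want e r × (∀ r' → r' < r → ¬ Want e r')

  first-stage : ∀ {e r} → Want e r → ∃ λ r' → r' ≤ r × New e r'
  first-stage {e} {r} w with least {Want e} (r , w)
  ... | r' , w' , h = r' , ≮⇒≥ (λ lt → h r lt w) , w' , h

  New-unique : ∀ {e r r'} → New e r → New e r' → r ≡ r'
  New-unique {e} {r} {r'} (w , h) (w' , h') = ≤-antisym (≮⇒≥ (λ lt → h r' lt w')) (≮⇒≥ (λ lt → h' r lt w))

  -- The element k of the copy stands for the sequence pt k.  When nothing is wanted it is
  -- placed at 2k, 0, 0, …, a sequence which is never wanted.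
  opaque
    pt : ℕ → ℕ
    pt k = ite (New (π₁ k) (π₂ k)) (π₁ k) (pair (k + k) 0)

    pt-cases : ∀ k → (New (π₁ k) (π₂ k) × pt k ≡ π₁ k) ⊎ pt k ≡ pair (k + k) 0
    pt-cases k with lem (New (π₁ k) (π₂ k))
    ... | yes n = inj₁ (n , ite-yes n)
    ... | no n = inj₂ (ite-no n)

    pt-new : ∀ {e r} → New e r → pt (pair e r) ≡ e
    pt-new {e} {r} n = trans (ite-yes (subst₂ New (sym (π₁-pair e r)) (sym (π₂-pair e r)) n)) (π₁-pair e r)

  spare-0 : ∀ k → seq (pair (k + k) 0) 0 ≡ k + k
  spare-0 k = seq-pair0 (k + k) 0

  spare-tail : ∀ k → Tail0 (pair (k + k) 0) 0
  spare-tail k (suc i) _ = trans (seq-pairS (k + k) 0 i) (seq0 i)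

  spare-first : ∀ k → First (pair (k + k) 0) 0
  spare-first k = trans (cong par (spare-0 k)) (par-dbl k) , λ _ ()

  spare-trunc : ∀ k → Trunc (pair (k + k) 0) 0 (pair (k + k) 0)
  spare-trunc k = (λ _ _ → refl) , spare-tail k

  trunc-self : ∀ {e n t} → Trunc e n t → Tail0 e n → t ≡ e
  trunc-self {e} {n} {t} (a , z) z' = seq-inj λ i → [ a i , (λ le → trans (z i le) (sym (z' i le))) ]′ (<-≤-connex i (suc n))

  spare-unwanted : ∀ k r → ¬ Want (pair (k + k) 0) r
  spare-unwanted k r (suc n , _ , t , _ , (_ , o) , _) =
    odd≢even (o 0 (s≤s z≤n)) (trans (cong par (spare-0 k)) (par-dbl k))
  spare-unwanted k r (zero , _ , t , _ , f , tr , _ , inj₁ (_ , ()))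
  spare-unwanted k r (zero , _ , t , _ , f , tr , _ , inj₂ (ne , _)) = ne (sym (trunc-self tr (spare-tail k)))

  pt-inj : ∀ {k k'} → pt k ≡ pt k' → k ≡ k'
  pt-inj {k} {k'} e with pt-cases k | pt-cases k'
  ... | inj₁ (n , a) | inj₁ (n' , a') = trans (sym (pair-π k)) (trans (cong₂ pair π₁≡ (New-unique n
          (subst (λ z → New z (π₂ k')) (sym π₁≡) n'))) (pair-π k'))
    where
    π₁≡ : π₁ k ≡ π₁ k'
    π₁≡ = trans (sym a) (trans e a')
  ... | inj₁ (n , a) | inj₂ a' = ⊥-elim (spare-unwanted k' (π₂ k)
          (subst (λ z → Want z (π₂ k)) (trans (sym a) (trans e a')) (proj₁ n)))
  ... | inj₂ a | inj₁ (n' , a') = ⊥-elim (spare-unwanted k (π₂ k')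
          (subst (λ z → Want z (π₂ k')) (trans (sym a') (trans (sym e) a)) (proj₁ n')))
  ... | inj₂ a | inj₂ a' = dbl-inj (proj₁ (pair-inj {k + k} {0} {k' + k'} {0} (trans (sym a) (trans e a'))))

  O : ℕ → ℕ → Set
  O k k' = Lexᶜ (pt k) (pt k')

  W H : ℕ → Set
  W k = Lex (seq (pt k)) path
  H k = Lex path (seq (pt k))

  -- No point lies on the true path: points are eventually zero and the path is positive everywhere.
  all : ∀ k → W k ⊎ H k
  all k = lex-tri (pt k) λ e → <⇒≢ (path>0 (pt k)) (trans (sym (seq-tail (pt k) (pt k) ≤-refl)) e)

  tri : ∀ k k' → k ≡ k' ⊎ (O k k' ⊎ O k' k)
  tri k k' = [ (λ e → inj₁ (pt-inj e)) , inj₂ ]′ (lexᶜ-tri (pt k) (pt k'))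

  index : ∀ {e r} → Want e r → ∃ λ k → k ≤ pair e r × pt k ≡ e
  index {e} {r} w with first-stage w
  ... | r' , le , n = pair e r' , pair-mono ≤-refl le , pt-new n

  place≤first : ∀ {e n i} → First e n → Agree i (seq e) path → i ≤ n
  place≤first {e} {n} {i} (ev , _) ag = ≮⇒≥ λ lt → odd≢even (par-path n) (trans (cong par (sym (ag n lt))) ev)

  -- Being wanted almost always exhibits evidence of strength `e` for an odd entry left of the path,
  -- and `limits` bounds that strength. The one exception is a path prefix cut off at a smaller even
  -- entry; its code is at most that of the path prefix.
  points-bounded : ∀ n → ∃ λ E → ∀ e r i → i ≤ n → LexAt i (seq e) path → Want e r → e ≤ E
  points-bounded n with limits (suc n) | code-exists path (suc n)
  ... | L , lim | c , ca , _ = L + c , go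
    where
    go : ∀ e r i → i ≤ n → LexAt i (seq e) path → Want e r → e ≤ L + c
    go e r i i≤n (ag , lt) (m , _ , t , _ , f , tr , ev , k) with k
    -- Here `e` is its own truncation, so its prefix has evidence of strength `e`.
    ... | inj₁ (refl , _) = [ strict , (λ e → ≤-trans (inside e) (m≤n+m c L)) ]′ (m≤n⇒m<n∨m≡n (place≤first f ag))
      where
      strict : i < m → e ≤ L + c
      strict i<m = ≤-trans (lim i (s≤s i≤n) (seq e i) (proj₂ f i i<m) lt e r (ev i i<m)) (m≤m+n L c)
      inside : i ≡ m → e ≤ c
      inside refl = seq-mono λ j → at j (<-cmp j i)
        where
        at : ∀ j → Tri (j < i) (j ≡ i) (i < j) → seq e j ≤ seq c j
        at j (tri< l _ _) = ≤-reflexive (trans (ag j l) (sym (ca j (≤-trans l (m≤n⇒m≤1+n i≤n)))))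
        at j (tri≈ _ refl _) = ≤-trans (<⇒≤ lt) (≤-reflexive (sym (ca j (s≤s i≤n))))
        at j (tri> _ _ g) = ≤-trans (≤-reflexive (proj₂ tr j g)) z≤n
    ... | inj₂ (_ , i' , i'≤ , v , v< , o , evs , ea) = ≤-trans (at (<-cmp i' i)) (m≤m+n L c)
      where
      at : Tri (i' < i) (i' ≡ i) (i < i') → e ≤ L
      at (tri< l _ _) = lim i' (≤-trans l (m≤n⇒m≤1+n i≤n)) v o (subst (v <_) (ag i' l) v<) e r ea
      at (tri≈ _ refl _) = lim i (s≤s i≤n) v o (<-trans v< lt) e r ea
      -- The fired sequence still follows `e` at the place where `e` leaves the path, and that entry
      -- is odd.
      at (tri> _ _ g) = lim i (s≤s i≤n) (seq e i) (proj₂ f i (≤-trans g (≤-pred i'≤))) lt e r (evs i g)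

  stages-bounded : ∀ E → ∃ λ M → ∀ e → e < E → ∀ r → New e r → r ≤ M
  stages-bounded E = collect (λ le h r n → ≤-trans (h r n) le) E λ e _ → one e
    where
    one : ∀ e → ∃ λ M → ∀ r → New e r → r ≤ M
    one e with lem (∃ (New e))
    ... | yes (r , n) = r , λ r' n' → ≤-reflexive (New-unique n' n)
    ... | no h = 0 , λ r n → ⊥-elim (h (r , n))

  -- Wanted points have bounded code and bounded stage; a spare point left of the path has 2k at
  -- most `path 0`.
  W-bounded : ∀ n → ∃ λ M → ∀ k i → i ≤ n → LexAt i (seq (pt k)) path → k ≤ M
  W-bounded n with points-bounded n
  ... | E , h with stages-bounded (suc E)
  ...   | M , h' = pair E M + path 0 , go
    where
    go : ∀ k i → i ≤ n → LexAt i (seq (pt k)) path → k ≤ pair E M + path 0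
    go k i le l with pt-cases k
    ... | inj₁ (nw , e) = ≤-trans (≤-reflexive (sym (pair-π k))) (≤-trans (pair-mono e≤ (h' (π₁ k) (s≤s e≤) (π₂ k) nw)) (m≤m+n _ _))
      where
      e≤ : π₁ k ≤ E
      e≤ = h (π₁ k) (π₂ k) i le (subst (λ z → LexAt i (seq z) path) e l) (proj₁ nw)
    ... | inj₂ e = ≤-trans (≤-trans (m≤m+n k k) (≤-trans (≤-reflexive (sym (trans (cong (λ z → seq z 0) e) (spare-0 k)))) (at0 i l)))
                     (m≤n+m _ (pair E M))
      where
      at0 : ∀ i → LexAt i (seq (pt k)) path → seq (pt k) 0 ≤ path 0
      at0 zero (_ , lt) = <⇒≤ lt
      at0 (suc i) (ag , _) = ≤-reflexive (ag 0 (s≤s z≤n))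

  preds-bounded : ∀ {k} → W k → ∃ λ M → ∀ k' → O k' k → k' < M
  preds-bounded {k} (n , l) = suc (proj₁ (W-bounded n)) , below
    where
    below : ∀ k' → O k' k → k' < suc (proj₁ (W-bounded n))
    below k' (m , l') with lexAt-trans {seq (pt k')} {seq (pt k)} {path} {m} {n} l' l
    ... | i , _ , i≤ , l'' = s≤s (proj₂ (W-bounded n) k' i i≤ l'')

  -- The prefix is on the true path, so evidence of every strength eventually appears. Even entries
  -- 0 and `path n` + 1 give points on either side, cofinal in the copy of ω and coinitial in the
  -- copy of η.
  separator : ∀ n {e} → 1 ≤ n → Agree n (seq e) path → par (seq e n) ≡ 0 → Tail0 e n → ∃ λ k → pt k ≡ e
  separator n {e} 1≤n ag ev z = let r , p = prefix-evidence e n e ag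
                                    k , _ , q = index {e} {r} (want (f , ((λ _ _ → refl) , z) , p , inj₁ (refl , 1≤n)))
                                in k , q
    where
    f : First e n
    f = ev , λ i lt → trans (cong par (ag i lt)) (par-path i)

  left-of : ∀ n → 1 ≤ n → ∃ λ k → LexAt n (seq (pt k)) path
  left-of n 1≤n with splice-exists path n 0
  ... | e , ag , v , z with separator n 1≤n ag (trans (cong par v) (par-dbl 0)) z
  ...   | k , q = k , subst (λ e → LexAt n (seq e) path) (sym q) (ag , subst (_< path n) (sym v) (path>0 n))

  right-of : ∀ n → 1 ≤ n → ∃ λ k → LexAt n path (seq (pt k))
  right-of n 1≤n with splice-exists path n (suc (path n))
  ... | e , ag , v , z with separator n 1≤n ag (trans (cong par v) (par-suc-path n)) z
  ...   | k , q = k , subst (λ e → LexAt n path (seq e)) (sym q) ((λ i lt → sym (ag i lt)) , ≤-reflexive (sym v))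

  Supported : ℕ → Set
  Supported e = Σ ℕ λ n → Σ ℕ λ t → Σ ℕ λ r → First e n × Trunc e n t × Ev e n t r

  supported : ∀ k → Supported (pt k)
  supported k with pt-cases k
  ... | inj₁ ((( n , _ , t , _ , f , tr , ev , _) , _) , e) = subst Supported (sym e) (n , t , π₂ k , f , tr , ev)
  ... | inj₂ e = subst Supported (sym e) (0 , pair (k + k) 0 , 0 , spare-first k , spare-trunc k , λ _ ())

  fires : ∀ {e n} → First e n → Lex path (seq e) → ∃ λ r → Fire e n r
  fires {e} {n} f (i , ag , lt) with prefix-evidence e i e (λ j l → sym (ag j l)) | path-evidence i e
  ... | r , p | r' , p' = r + r' , i , s≤s (place≤first f (λ j l → sym (ag j l))) , path i , lt , par-path i
        , Ev-mono (m≤m+n r r') p , EvAt-mono ≤-refl (m≤n+m r' r) p'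

  -- Raising an entry beyond the first even one leaves prefix and truncation alone, so the evidence
  -- for `pt k` can be reused; the new sequence is still right of the path, hence fires. This gives
  -- density and the lack of a greatest element.
  bump : ∀ {k} → H k → ∀ N → ∃ λ k' → ∃ λ m → N < m × LexAt m (seq (pt k)) (seq (pt k'))
  bump {k} h N with supported k
  ... | n , t , r , (ev , od) , (ta , tz) , p = raise (splice-exists (seq (pt k)) m (suc (seq (pt k) m)))
    where
    m : ℕ
    m = suc (n + N)
    n<m : n < m
    n<m = s≤s (m≤m+n n N)
    raise : (∃ λ c → (∀ i → i < m → seq c i ≡ seq (pt k) i) × seq c m ≡ suc (seq (pt k) m) × (∀ i → m < i → seq c i ≡ 0)) →
            ∃ λ k' → ∃ λ m → N < m × LexAt m (seq (pt k)) (seq (pt k'))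
    raise (c , ag , v , _) with fires {c} {n} f (lex-trans h (m , l))
      where
      f : First c n
      f = trans (cong par (ag n n<m)) ev , λ i lt → trans (cong par (ag i (<-trans lt n<m))) (od i lt)
      l : LexAt m (seq (pt k)) (seq c)
      l = (λ i lt → sym (ag i lt)) , ≤-reflexive (sym v)
    ... | r' , fi with index {c} {r + r'} (want (f , tr , evd , inj₂ (ne , fire′ fi)))
      where
      f : First c n
      f = trans (cong par (ag n n<m)) ev , λ i lt → trans (cong par (ag i (<-trans lt n<m))) (od i lt)
      tr : Trunc c n t
      tr = (λ i lt → trans (ta i lt) (sym (ag i (≤-trans lt n<m)))) , tz
      evd : Ev c n t (r + r')
      evd i lt = subst (λ w → EvAt i w t (r + r')) (sym (ag i (<-trans lt n<m))) (EvAt-mono ≤-refl (m≤m+n r r') (p i lt))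
      ne : c ≢ t
      ne e = 1+n≢0 (trans (sym v) (trans (cong (λ z → seq z m) e) (tz m n<m)))
      fire′ : Fire c n r' → Fire c n (r + r')
      fire′ (i , i< , w , w< , o , a , b) = i , i< , w , w< , o , Ev-mono (m≤n+m r' r) a , EvAt-mono ≤-refl (m≤n+m r' r) b
    ...   | k' , _ , q = k' , m , s≤s (m≤n+m N n) , subst (λ z → LexAt m (seq (pt k)) (seq z)) (sym q)
              ((λ i lt → sym (ag i lt)) , ≤-reflexive (sym v))

  -- Predecessors of any member have bounded index, so the least member is found among finitely many
  -- numbers.
  minimal : (P : ℕ → Set) → (∀ {k} → P k → W k) → ∃ P → ∃ λ k → P k × (∀ k' → P k' → ¬ O k' k)
  minimal P PW (y , py) with preds-bounded (PW py)
  ... | M , h with max-below {P} {λ i j → ¬ O i j} (suc (y + M))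
        (λ {i} {j} _ _ _ _ → tot i j) (λ {i} {j} {l} _ _ _ _ _ _ → tr i j l)
    where
    tot : ∀ i j → ¬ O i j ⊎ ¬ O j i
    tot i j with lem (O i j)
    ... | yes o = inj₂ (lex-asym o)
    ... | no o = inj₁ o
    tr : ∀ i j l → ¬ O i j → ¬ O j l → ¬ O i l
    tr i j l a b o with tri i j
    ... | inj₁ refl = b o
    ... | inj₂ (inj₁ o') = a o'
    ... | inj₂ (inj₂ o') = b (lex-trans o' o)
  ...   | inj₁ none = ⊥-elim (none y (s≤s (m≤m+n y M)) py)
  ...   | inj₂ (z , z< , pz , mx) = z , pz , least-z
    where
    below-y : ∀ {k'} → O k' z → O k' y
    below-y {k'} o with tri z y
    ... | inj₁ refl = o
    ... | inj₂ (inj₁ o') = lex-trans o o'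
    ... | inj₂ (inj₂ o') = ⊥-elim (mx y (s≤s (m≤m+n y M)) py o')
    least-z : ∀ k' → P k' → ¬ O k' z
    least-z k' pk o = mx k' (≤-trans (h k' (below-y o)) (≤-trans (m≤n+m M y) (n≤1+n _))) pk o

  first-element : ∃ λ k → W k × (∀ k' → W k' → ¬ O k' k)
  first-element = minimal W (λ w → w) (proj₁ (left-of 1 ≤-refl) , 1 , proj₂ (left-of 1 ≤-refl))

  order : OrderωPlusη
  order = record
    { O = O ; W = W ; H = H ; irr = lex-irr ; trans< = lex-trans
    ; tri = λ {k} {k'} _ _ → tri k k'
    ; disj = lex-asym
    ; W<H = lex-trans
    ; W-down = lex-trans
    ; H-up = λ o h → lex-trans h o
    ; e₀ = proj₁ first-element
    ; W-e₀ = proj₁ (proj₂ first-element)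
    ; e₀-least = λ {k} w → [ inj₁ , [ (λ o → ⊥-elim (proj₂ (proj₂ first-element) k w o)) , inj₂ ]′ ]′ (tri k _)
    ; succ-ex = succ-ex
    ; bound-ex = preds-bounded
    ; q₀ = proj₁ (right-of 1 ≤-refl)
    ; H-q₀ = 1 , proj₂ (right-of 1 ≤-refl)
    ; low-ex = low-ex
    ; up-ex = λ h → let k' , m , _ , l = bump h 0 in k' , m , l
    ; mid-ex = mid-ex }
    where
    Above : ℕ → ℕ → Set
    Above k z = W z × O k z
    succ-ex : ∀ {k} → W k → ∃ λ k' → W k' × O k k' × (∀ z → ¬ (O k z × O z k'))
    succ-ex {k} (n , ag , lt) = immediate (minimal (Above k) proj₁ (above (left-of (suc n) (s≤s z≤n))))
      where
      above : (∃ λ z → LexAt (suc n) (seq (pt z)) path) → ∃ (Above k)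
      above (z , l) = z , (suc n , l) , n , (λ i i< → trans (ag i i<) (sym (proj₁ l i (m<n⇒m<1+n i<))))
                    , subst (seq (pt k) n <_) (sym (proj₁ l n ≤-refl)) lt
      immediate : (∃ λ k' → Above k k' × (∀ z → Above k z → ¬ O z k')) →
                  ∃ λ k' → W k' × O k k' × (∀ z → ¬ (O k z × O z k'))
      immediate (k' , (w' , o) , mn) = k' , w' , o , λ z (a , b) → mn z (lex-trans b w' , a) b
    low-ex : ∀ {k} → H k → ∃ λ k' → H k' × O k' k
    -- A point that leaves the path one place later lies closer to it.
    low-ex {k} (i , ag , lt) = below (right-of (suc i) (s≤s z≤n))
      where
      below : (∃ λ z → LexAt (suc i) path (seq (pt z))) → ∃ λ k' → H k' × O k' k
      below (k' , l) = k' , (suc i , l) , i , (λ j j< → trans (sym (proj₁ l j (m<n⇒m<1+n j<))) (ag j j<))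
                     , subst (_< seq (pt k) i) (proj₁ l i ≤-refl) lt
    mid-ex : ∀ {k k'} → H k → H k' → O k k' → ∃ λ z → O k z × O z k'
    mid-ex {k} {k'} h h' (n , ag , lt) = between (bump h n)
      where
      between : (∃ λ z → ∃ λ m → n < m × LexAt m (seq (pt k)) (seq (pt z))) → ∃ λ z → O k z × O z k'
      between (z , m , n<m , l) = z , (m , l) , n , (λ i i< → trans (sym (proj₁ l i (<-trans i< n<m))) (ag i i<))
                                , subst (_< seq (pt k') n) (proj₁ l n n<m) lt

  -- The copy is primitive recursive.

  module InClone {𝒞 : (n : ℕ) → (Vec ℕ n → ℕ) → Set} (clone : Clone 𝒞) (θ-rel : Closure.Rel4 clone θ) where
    open Closure clone

    opaque
      EvAt-rel : Rel4 EvAt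
      EvAt-rel = rel4 (∀ᵣ v2 (∃ᵣ v4 (rap4 θ-rel v2 (ap1 half-fn v3) v1 v0)))

      Ev-rel : Rel4 Ev
      Ev-rel = rel4 (∀ᵣ v1 (rap4 EvAt-rel v0 (ap2 seq-fn v1 v0) v3 v4))

      First-rel : Rel2 First
      First-rel = rel2 ((ap1 par-fn (ap2 seq-fn v0 v1) ≡ᵣ zeroᶜ)
                        ∧ᵣ ∀ᵣ v1 (ap1 par-fn (ap2 seq-fn v1 v0) ≡ᵣ const 1))

      Tail0-rel : Rel2 Tail0
      Tail0-rel = rel2 (rext
        (λ ρ h i lt → [ (λ i< → h i i< lt) , seq-tail (lookup ρ fz) i ]′ (<-≤-connex i (lookup ρ fz)))
        (λ ρ h i _ lt → h i lt)
        (∀ᵣ v0 ((v2 <ᵣ v0) ⇒ᵣ (ap2 seq-fn v1 v0 ≡ᵣ zeroᶜ))))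

      Trunc-rel : Rel3 Trunc
      Trunc-rel = rel3 (∀ᵣ (succᶜ v1) (ap2 seq-fn v3 v0 ≡ᵣ ap2 seq-fn v1 v0) ∧ᵣ rap2 Tail0-rel v2 v1)

      Fire-rel : Rel3 Fire
      Fire-rel = rel3 (∃ᵣ (succᶜ v1) (∃ᵣ (ap2 seq-fn v1 v0)
        ((ap1 par-fn v0 ≡ᵣ const 1) ∧ᵣ rap4 Ev-rel v2 v1 v2 v4 ∧ᵣ rap4 EvAt-rel v1 v0 v2 v4)))

      Wanted-rel : Rel4 Wanted
      Wanted-rel = rel4 (rap2 First-rel v0 v1 ∧ᵣ rap3 Trunc-rel v0 v1 v2 ∧ᵣ rap4 Ev-rel v0 v1 v2 v3
        ∧ᵣ (((v0 ≡ᵣ v2) ∧ᵣ (const 1 ≤ᵣ v1)) ∨ᵣ (¬ᵣ (v0 ≡ᵣ v2) ∧ᵣ rap3 Fire-rel v0 v1 v3)))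

      Want-rel : Rel2 Want
      Want-rel = rel2 (∃ᵣ (succᶜ v0) (∃ᵣ (succᶜ v1) (rap4 Wanted-rel v2 v1 v0 v3)))

      New-rel : Rel2 New
      New-rel = rel2 (rap2 Want-rel v0 v1 ∧ᵣ ∀ᵣ v1 (¬ᵣ (rap2 Want-rel v1 v0)))

    opaque
      unfolding pt
      pt-fn : Fn1 pt
      pt-fn = fn1 (iteᶜ (rap2 New-rel (ap1 π₁-fn v0) (ap1 π₂-fn v0)) (ap1 π₁-fn v0) (ap2 pair-fn (v0 +ᶜ v0) zeroᶜ))

    opaque
      O-rel : Rel2 O
      O-rel = rel2 (rap2 lexᶜ-rel (ap1 pt-fn v0) (ap1 pt-fn v1))

  -- From an isomorphism F between the standard copy and this one, with inverse G, the true path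
  -- is read off entry by entry.  The element K x lies right of the true path and agrees with it
  -- up to place x.  If its entry at x is too large, then the separator with entry path x + 1 at x has
  -- a smaller index; it is recognised by means of G, and any element of the copy of η below it
  -- agrees with the true path also at x.
  module Readout (F G : ℕ → ℕ) (F-H : ∀ {x} → 𝕊.H x → H (F x)) (G-H : ∀ {k} → 𝕊.H (G k) → H k)
                 (H-G : ∀ {k} → H k → 𝕊.H (G k)) (F-O : ∀ {x y} → 𝕊.O x y → O (F x) (F y))
                 (FG : ∀ k → F (G k) ≡ k) where

    Cand : ℕ → ℕ → ℕ → Set
    Cand x K κ = (∀ i → i < x → seq (pt κ) i ≡ seq (pt K) i) × par (seq (pt κ) x) ≡ 0
                 × seq (pt κ) x ≤ seq (pt K) x × Tail0 (pt κ) x × 𝕊.H (G κ)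

    Best : ℕ → ℕ → ℕ → Set
    Best x K κ = Cand x K κ × (∀ κ' → κ' < suc K → Cand x K κ' → seq (pt κ) x ≤ seq (pt κ') x)

    opaque
      best : ℕ → ℕ → ℕ
      best x K = μ (Best x K) K

      best-sat : ∀ {x K κ} → κ ≤ K → Best x K κ → Best x K (best x K)
      best-sat {x} {K} = μ-sat (Best x K)

      step : ℕ → ℕ → ℕ
      -- The search also returns `K` when it fails, so its result is tested again.
      step x K = ite (Best x K (best x K)) (F (𝕊.low (G (best x K)))) K

      step-yes : ∀ {x K} → Best x K (best x K) → step x K ≡ F (𝕊.low (G (best x K)))
      step-yes = ite-yes

      step-no : ∀ {x K} → ¬ Best x K (best x K) → step x K ≡ K
      step-no = ite-no

    Inv : ℕ → ℕ → Set
    Inv x K = Agree x (seq (pt K)) path × H K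

    place≥ : ∀ {x k} → Inv x k → ∃ λ i → x ≤ i × LexAt i path (seq (pt k))
    place≥ {x} (ag , i , l) = i , ≮⇒≥ (λ i<x → <⇒≢ (proj₂ l) (sym (ag i i<x))) , l

    above-path : ∀ {x k} → Inv x k → path x ≤ seq (pt k) x
    above-path inv with place≥ inv
    ... | i , x≤i , ag , lt = [ (λ x<i → ≤-reflexive (ag _ x<i)) , (λ { refl → <⇒≤ lt }) ]′ (m≤n⇒m<n∨m≡n x≤i)

    -- A point right of the path that agrees with it below `x` has at least the true entry at `x`;
    -- parity excludes equality.
    cand-above : ∀ {x K κ} → Inv x K → Cand x K κ → path x < seq (pt κ) x
    cand-above {x} {K} {κ} (agK , _) (ag , ev , _ , _ , h) =
      ≤∧≢⇒< (above-path ((λ i lt → trans (ag i lt) (agK i lt)) , G-H h))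
            (λ e → odd≢even (par-path x) (trans (cong par e) ev))

    module Step {x K} (1≤x : 1 ≤ x) (inv : Inv x K) where
      agK : Agree x (seq (pt K)) path
      agK = proj₁ inv

      -- Spare points start with an even entry, whereas `K` starts with `path 0`.
      K-wanted : New (π₁ K) (π₂ K) × pt K ≡ π₁ K
      K-wanted with pt-cases K
      ... | inj₁ n = n
      ... | inj₂ e = ⊥-elim (odd≢even (trans (cong par (trans (cong (λ z → seq z 0) (sym e)) (agK 0 1≤x))) (par-path 0))
                             (trans (cong par (spare-0 K)) (par-dbl K)))

      module _ (small : path x < seq (pt K) x) where
        Separator : ℕ → Set
        Separator κ = κ ≤ K × (∀ i → i < x → seq (pt κ) i ≡ path i) × seq (pt κ) x ≡ suc (path x) × Tail0 (pt κ) x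

        sep-exists : ∃ Separator
        sep-exists = build (proj₁ (proj₁ K-wanted)) (splice-exists path x (suc (path x)))
          where
          pt≡ : π₁ K ≡ pt K
          pt≡ = sym (proj₂ K-wanted)
          agK′ : Agree x (seq (π₁ K)) path
          agK′ = subst (λ e → Agree x (seq e) path) (proj₂ K-wanted) agK
          build : Want (π₁ K) (π₂ K) →
                  (∃ λ c → (∀ i → i < x → seq c i ≡ path i) × seq c x ≡ suc (path x) × (∀ i → x < i → seq c i ≡ 0)) →
                  ∃ Separator
          build (n , _ , t , _ , f , tr , ev , _) (z , ag , v , tl) = found (index {z} {π₂ K} (want (fz′ , ((λ _ _ → refl) , tl) , evz , inj₁ (refl , 1≤x))))
            where
            x≤n : x ≤ n
            x≤n = place≤first f agK′
            at : ∀ i → Tri (i < x) (i ≡ x) (x < i) → seq z i ≤ seq t i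
            at i (tri< l _ _) = ≤-reflexive (trans (ag i l) (trans (sym (agK′ i l)) (sym (proj₁ tr i (s≤s (≤-trans (<⇒≤ l) x≤n))))))
            at i (tri≈ _ refl _) = ≤-trans (≤-reflexive v) (≤-trans small
              (≤-reflexive (trans (cong (λ e → seq e x) (sym pt≡)) (sym (proj₁ tr x (s≤s x≤n))))))
            at i (tri> _ _ g) = ≤-trans (≤-reflexive (tl i g)) z≤n
            z≤t : z ≤ t
            z≤t = seq-mono λ i → at i (<-cmp i x)
            fz′ : First z x
            fz′ = trans (cong par v) (par-suc-path x) , λ i lt → trans (cong par (ag i lt)) (par-path i)
            evz : Ev z x z (π₂ K)
            evz i lt = subst (λ w → EvAt i w z (π₂ K)) (trans (agK′ i lt) (sym (ag i lt)))
                         (EvAt-mono z≤t ≤-refl (ev i (≤-trans lt x≤n)))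
            found : (∃ λ κ → κ ≤ pair z (π₂ K) × pt κ ≡ z) → ∃ Separator
            found (κ , le , refl) = κ
              , ≤-trans le (≤-trans (pair-mono (≤-trans z≤t (trunc≤ tr)) ≤-refl) (≤-reflexive (pair-π K)))
              , ag , v , tl

        sep-H : ∀ {κ} → Separator κ → H κ
        sep-H (_ , ag , v , _) = x , (λ i lt → sym (ag i lt)) , ≤-reflexive (sym v)

        sep-cand : ∀ {κ} → Separator κ → Cand x K κ
        sep-cand s@(_ , ag , v , tl) = (λ i lt → trans (ag i lt) (sym (agK i lt)))
          , trans (cong par v) (par-suc-path x) , ≤-trans (≤-reflexive v) small , tl , H-G (sep-H s)

        sep-best : ∀ {κ} → Separator κ → Best x K κ
        sep-best s = sep-cand s , λ κ' _ c → ≤-trans (≤-reflexive (proj₁ (proj₂ (proj₂ s)))) (cand-above inv c)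

        best-best : Best x K (best x K)
        best-best = best-sat (proj₁ (proj₂ sep-exists)) (sep-best (proj₂ sep-exists))

        best-place : seq (pt (best x K)) x ≡ suc (path x)
        best-place = ≤-antisym
          (≤-trans (proj₂ best-best (proj₁ sep-exists) (s≤s (proj₁ (proj₂ sep-exists))) (sep-cand (proj₂ sep-exists)))
            (≤-reflexive (proj₁ (proj₂ (proj₂ (proj₂ sep-exists))))))
          (cand-above inv (proj₁ best-best))

        next : ℕ
        next = F (𝕊.low (G (best x K)))

        next-H : H next
        next-H = F-H (𝕊.H-decode (pair 0 (𝕊.code (G (best x K)))))

        next-below : O next (best x K)
        next-below = subst (O next) (FG (best x K)) (F-O (𝕊.low-O (proj₂ (proj₂ (proj₂ (proj₂ (proj₁ best-best)))))))

        -- `next` lies between the path and the best candidate, whose entry at `x` is `path x` + 1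
        -- and which is zero afterwards. To be below it, `next` must differ at `x` already, which
        -- leaves only the true entry.
        next-agree : Agree (suc x) (seq (pt next)) path
        next-agree = go next-H next-below
          where
          z = best x K
          zag : ∀ i → i < x → seq (pt z) i ≡ path i
          zag i lt = trans (proj₁ (proj₁ best-best) i lt) (agK i lt)
          ztail : Tail0 (pt z) x
          ztail = proj₁ (proj₂ (proj₂ (proj₂ (proj₁ best-best))))
          go : H next → O next z → Agree (suc x) (seq (pt next)) path
          go (m , l) (n , l') with lexAt-trans {path} {seq (pt next)} {seq (pt z)} {m} {n} l l'
          ... | k , k≤m , k≤n , lk = λ i lt → sym (proj₁ l i (≤-trans lt x<m))
            where
            x≤k : x ≤ k
            x≤k = ≮⇒≥ λ k<x → <⇒≢ (proj₂ lk) (sym (zag k k<x))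
            n≤x : n ≤ x
            n≤x = ≮⇒≥ λ x<n → n≮0 (subst (seq (pt next) n <_) (ztail n x<n) (proj₂ l'))
            n≡x : n ≡ x
            n≡x = ≤-antisym n≤x (≤-trans x≤k k≤n)
            next≤ : seq (pt next) x ≤ path x
            next≤ = ≤-pred (subst (seq (pt next) x <_) best-place (subst (λ i → seq (pt next) i < seq (pt z) i) n≡x (proj₂ l')))
            x<m : x < m
            x<m = ≤∧≢⇒< (≤-trans x≤k k≤m) λ { refl → <⇒≱ (proj₂ l) next≤ }

      step-inv : Inv (suc x) (step x K)
      step-inv with path x <? seq (pt K) x
      ... | yes small = subst (Inv (suc x)) (sym (step-yes (best-best small))) (next-agree small , next-H small)
      ... | no ¬small = subst (Inv (suc x)) (sym (step-no no-best)) (agree , proj₂ inv)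
        where
        no-best : ¬ Best x K (best x K)
        -- A candidate would put an entry above `path x` below that of `K`, which equals `path x`
        -- here.
        no-best (c , _) = ¬small (≤-trans (cand-above inv c) (proj₁ (proj₂ (proj₂ c))))
        agree : Agree (suc x) (seq (pt K)) path
        agree i lt = [ (λ l → agK i (≤-pred l)) , (λ { refl → ≤-antisym (≮⇒≥ ¬small) (above-path inv) }) ]′ (m≤n⇒m<n∨m≡n lt)

    -- Place 0 is handled by one fixed element, since separators exist only from place 1 on.
    start : ∃ (Inv 1)
    start = inv (right-of 1 ≤-refl)
      where
      inv : (∃ λ k → LexAt 1 path (seq (pt k))) → ∃ (Inv 1)
      inv (k , l) = k , (λ i lt → sym (proj₁ l i lt)) , 1 , l

    opaque
      K : ℕ → ℕ
      K = natrec (proj₁ start) (λ n a → step (suc n) a)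

      K-inv : ∀ n → Inv (suc n) (K n)
      K-inv zero = proj₂ start
      K-inv (suc n) = Step.step-inv (s≤s z≤n) (K-inv n)

    path-read : ∀ n → half (seq (pt (K n)) n) ≡ sol n
    path-read n = trans (cong half (proj₁ (K-inv n) n ≤-refl)) (half-path n)

    module ReadoutIn {𝒞 : (n : ℕ) → (Vec ℕ n → ℕ) → Set} (clone : Clone 𝒞) (θ-rel : Closure.Rel4 clone θ)
                     (F-fn : Closure.Fn1 clone F) (G-fn : Closure.Fn1 clone G) where
      open Closure clone
      open InClone clone θ-rel

      opaque
        Cand-rel : Rel3 Cand
        Cand-rel = rel3 (∀ᵣ v0 (ap2 seq-fn (ap1 pt-fn v3) v0 ≡ᵣ ap2 seq-fn (ap1 pt-fn v2) v0)
          ∧ᵣ (ap1 par-fn (ap2 seq-fn (ap1 pt-fn v2) v0) ≡ᵣ zeroᶜ)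
          ∧ᵣ (ap2 seq-fn (ap1 pt-fn v2) v0 ≤ᵣ ap2 seq-fn (ap1 pt-fn v1) v0)
          ∧ᵣ rap2 Tail0-rel (ap1 pt-fn v2) v0 ∧ᵣ (ap1 par-fn (ap1 G-fn v2) ≡ᵣ const 1))

        Best-rel : Rel3 Best
        Best-rel = rel3 (rap3 Cand-rel v0 v1 v2 ∧ᵣ ∀ᵣ (succᶜ v1) (rap3 Cand-rel v1 v2 v0
          ⇒ᵣ (ap2 seq-fn (ap1 pt-fn v3) v1 ≤ᵣ ap2 seq-fn (ap1 pt-fn v0) v1)))

        low-fn : Fn1 𝕊.low
        low-fn = fn1 (succᶜ (predᶜ c +ᶜ predᶜ c))
          where
          c : 𝒞 1 (λ ρ → pair 0 (suc (half (lookup ρ fz))))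
          c = ap2 pair-fn zeroᶜ (succᶜ (ap1 half-fn v0))

      opaque
        unfolding step best
        best-fn : Fn2 best
        best-fn = fn2 (μᶜ (rap3 Best-rel v1 v2 v0) v1)

        step-fn : Fn2 step
        step-fn = fn2 (iteᶜ (rap3 Best-rel v0 v1 (ap2 best-fn v0 v1))
                        (ap1 F-fn (ap1 low-fn (ap1 G-fn (ap2 best-fn v0 v1)))) v1)

      opaque
        unfolding K
        K-fn : Fn1 K
        K-fn = fn1 (natrecᶜ (const (proj₁ start)) (ap2 step-fn (succᶜ v0) v1) v0)

      sol-fn : Fn1 sol
      sol-fn = fn1 (ext (λ ρ → path-read (lookup ρ fz)) (ap1 half-fn (ap2 seq-fn (ap1 pt-fn (ap1 K-fn v0)) v0)))

-- From categoricity to the cone.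

module FromPrCat (lem : Classical) where
  open Standard lem

  -- The points of the copy of η are those without an immediate successor.
  iso-H : ∀ {A B X Y} → Presents A X → Presents B Y → (i : Iso A B) →
          ∀ {x} → OrderωPlusη.H X x → OrderωPlusη.H Y (Iso.f i x)
  iso-H {A} {B} {X} {Y} PA PB i {x} h = [ (λ w → ⊥-elim (absurd (Y.succ-ex w))) , (λ k → k) ]′ (Presents.all PB (i.f x))
    where
    module X = OrderωPlusη X
    module Y = OrderωPlusη Y
    module i = Iso i
    forth : ∀ {a b} → X.O a b → Y.O (i.f a) (i.f b)
    forth o = proj₂ (Presents.O⟺ PB _ _) (proj₁ (i.pres _ _) (proj₁ (Presents.O⟺ PA _ _) o))
    back : ∀ {a y} → Y.O (i.f a) y → X.O a (i.g y)
    back {a} {y} o = proj₂ (Presents.O⟺ PA _ _) (proj₂ (i.pres _ _)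
      (subst (λ z → Rel B (i.f a) z) (sym (i.fg y)) (proj₁ (Presents.O⟺ PB _ _) o)))
    absurd : ¬ (∃ λ y → Y.W y × Y.O (i.f x) y × (∀ z → ¬ (Y.O (i.f x) z × Y.O z y)))
    absurd (y , _ , o , gap) with X.mid-ex h (X.H-up (back o) h) (back o)
    ... | z , a , b = gap (i.f z) (forth a , subst (Y.O (i.f z)) (i.fg y) (forth b))

  module _ {A : Punctual} (I : IsoωPlusη A) (d : ℕ → ℕ) (cat : PrCat A d) (f : ℕ → ℕ) (f-Σ⁰₃ : Σ⁰₃ (λ x y → f x ≡ y)) where

    t : PR 5
    t = proj₁ f-Σ⁰₃

    -- A solution p packs a guessed value `π₂ p` with an outer witness `π₁ p` for the Σ⁰₃ graph, so
    -- every solution, in particular the least, reveals f i.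
    θ : ℕ → ℕ → ℕ → ℕ → Set
    θ i p b c = eval zeroOracle t (π₁ p ∷ b ∷ c ∷ i ∷ π₂ p ∷ []) ≡ 0

    solvable : ∀ i → ∃ λ p → ∀ b → ∃ λ c → θ i p b c
    solvable i with proj₁ (proj₂ f-Σ⁰₃ i (f i)) refl
    ... | a , h = pair a (f i) , λ b → proj₁ (h b) , subst₂ (λ a y → eval zeroOracle t (a ∷ b ∷ proj₁ (h b) ∷ i ∷ y ∷ []) ≡ 0)
                    (sym (π₁-pair a (f i))) (sym (π₂-pair a (f i))) (proj₂ (h b))

    module C = Coding lem θ solvable

    value : ∀ i → π₂ (C.sol i) ≡ f i
    value i = sym (proj₂ (proj₂ f-Σ⁰₃ i (π₂ (C.sol i))) (π₁ (C.sol i) , C.sol-sat i))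

    opaque
      θ-rel : ∀ e → Closure.Rel4 (PRIn-clone e) θ
      θ-rel e = rel4 (sub (fromPR e t)
          (λ ρ → π₁ (lookup ρ (fs fz)) ∷ lookup ρ (fs (fs fz)) ∷ lookup ρ (fs (fs (fs fz))) ∷ lookup ρ fz ∷ π₂ (lookup ρ (fs fz)) ∷ [])
          (λ { fz → ap1 π₁-fn v1 ; (fs fz) → v2 ; (fs (fs fz)) → v3 ; (fs (fs (fs fz))) → v0
             ; (fs (fs (fs (fs fz)))) → ap1 π₂-fn v1 }) ≡ᵣ zeroᶜ)
        where open Closure (PRIn-clone e)

    B-program : Σ Punctual λ B → ∀ x y → C.O x y ⟺ Rel B x y
    B-program = punctual (C.InClone.O-rel (PRIn-clone zeroOracle) (θ-rel zeroOracle))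

    B : Punctual
    B = proj₁ B-program

    B-presents : Presents B C.order
    B-presents = record { O⟺ = proj₂ B-program ; all = C.all }

    isoTo : ∀ {B Y} → Presents B Y → Iso A B
    isoTo {B} {Y} PB = from (isomorphic (orderOf I) Y)
      where
      from : (∃ λ f → ∃ λ g → IsoOn (orderOf I) Y f g × IsoOn Y (orderOf I) g f) → Iso A B
      from (_ , _ , i , j) = iso-from (presents I) PB i j

    module D = Closure (PRIn-clone d)

    below⇒fn : ∀ {g} → g ≤PR d → D.Fn1 g
    below⇒fn (s , e) = D.fn1 (mkPR s λ { (x ∷ []) → e x })

    below : (Σ (Iso A 𝕊.S) λ i → (Iso.f i ≤PR d) × (Iso.g i ≤PR d)) →
            (Σ (Iso A B) λ i → (Iso.f i ≤PR d) × (Iso.g i ≤PR d)) → f ≤PR d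
    below (i , fi , gi) (j , fj , gj) = finish (D.ext (λ ρ → value (lookup ρ fz)) (D.ap1 D.π₂-fn (D.ap1 sol-fn D.v0)))
      where
      module i = Iso i
      module j = Iso j
      -- Categoricity bounds isomorphisms out of `A` only, so the standard copy is compared with `B`
      -- through `A`.
      j∘i⁻¹ : Iso 𝕊.S B
      j∘i⁻¹ = record
        { f = λ x → j.f (i.g x) ; g = λ k → i.f (j.g k)
        ; gf = λ x → trans (cong i.f (j.gf (i.g x))) (i.fg x)
        ; fg = λ k → trans (cong j.f (i.gf (j.g k))) (j.fg k)
        ; pres = λ x y →
            (λ r → proj₁ (j.pres _ _) (proj₂ (i.pres _ _) (subst₂ (Rel 𝕊.S) (sym (i.fg x)) (sym (i.fg y)) r)))
          , (λ r → subst₂ (Rel 𝕊.S) (i.fg x) (i.fg y) (proj₁ (i.pres _ _) (proj₂ (j.pres _ _) r))) }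
      i∘j⁻¹ : Iso B 𝕊.S
      i∘j⁻¹ = record
        { f = Iso.g j∘i⁻¹ ; g = Iso.f j∘i⁻¹ ; gf = Iso.fg j∘i⁻¹ ; fg = Iso.gf j∘i⁻¹
        ; pres = λ k k' →
            (λ r → proj₂ (Iso.pres j∘i⁻¹ _ _) (subst₂ (Rel B) (sym (Iso.fg j∘i⁻¹ k)) (sym (Iso.fg j∘i⁻¹ k')) r))
          , (λ r → subst₂ (Rel B) (Iso.fg j∘i⁻¹ k) (Iso.fg j∘i⁻¹ k') (proj₁ (Iso.pres j∘i⁻¹ _ _) r)) }
      F-H : ∀ {x} → 𝕊.H x → C.H (Iso.f j∘i⁻¹ x)
      F-H = iso-H 𝕊.S-presents B-presents j∘i⁻¹
      G-H : ∀ {k} → 𝕊.H (Iso.g j∘i⁻¹ k) → C.H k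
      G-H {k} h = subst C.H (Iso.fg j∘i⁻¹ k) (F-H h)
      H-G : ∀ {k} → C.H k → 𝕊.H (Iso.g j∘i⁻¹ k)
      H-G = iso-H B-presents 𝕊.S-presents i∘j⁻¹
      F-O : ∀ {x y} → 𝕊.O x y → C.O (Iso.f j∘i⁻¹ x) (Iso.f j∘i⁻¹ y)
      F-O {x} {y} o = proj₂ (Presents.O⟺ B-presents _ _) (proj₁ (Iso.pres j∘i⁻¹ x y) (proj₁ (Presents.O⟺ 𝕊.S-presents x y) o))
      F-fn : D.Fn1 (Iso.f j∘i⁻¹)
      F-fn = D.fn1 (D.ap1 (below⇒fn fj) (D.ap1 (below⇒fn gi) D.v0))
      G-fn : D.Fn1 (Iso.g j∘i⁻¹)
      G-fn = D.fn1 (D.ap1 (below⇒fn fi) (D.ap1 (below⇒fn gj) D.v0))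
      open C.Readout (Iso.f j∘i⁻¹) (Iso.g j∘i⁻¹) F-H G-H H-G F-O (Iso.fg j∘i⁻¹)
      open ReadoutIn (PRIn-clone d) (θ-rel d) F-fn G-fn using (sol-fn)
      finish : PRIn d 1 (λ ρ → f (lookup ρ fz)) → f ≤PR d
      finish (mkPR s e) = s , λ x → e (x ∷ [])

    f-below : f ≤PR d
    f-below = below (cat 𝕊.S (isoTo 𝕊.S-presents)) (cat B (isoTo B-presents))

theorem3p8 : Classical →
    Σ Punctual IsoωPlusη
    × ((A : Punctual) → IsoωPlusη A → (d : ℕ → ℕ) →
    (PrCat A d → Cone-Δ⁰₃ d) × (Cone-Δ⁰₃ d → PrCat A d))
theorem3p8 lem = (𝕊.S , 𝕊.S-iso) , λ A I d →
    (λ cat f (f-Σ⁰₃ , _) → FromPrCat.f-below lem I d cat f f-Σ⁰₃)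
  , cone⇒prCat I d
  where open Standard lem
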